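{- Let $n\ge 7$ be an integer. If $\mathcal{F}\subseteq\binom{[n]}{3}$ has VC-dimension at most $2$, then $|\mathcal{F}|\le\binom{n-1}{2}+1$.
   Context: Here $[n]=\{1,\dots,n\}$ and $\binom{[n]}{3}$ denotes the collection of all $3$-element subsets of $[n]$. A set system $\mathcal{F}\subseteq 2^{X}$ shatters $S\subseteq X$ if $\{F\cap S: F\in\mathcal{F}\}=2^{S}$, i.e. every subset of $S$ is the intersection of $S$ with some member of $\mathcal{F}$. The VC-dimension of $\mathcal{F}$ is the largest integer $d$ such that some $S\subseteq X$ with $|S|=d$ is shattered by $\mathcal{F}$; "VC-dimension at most $2$" means that no $3$-element subset of $[n]$ is shattered by $\mathcal{F}$. -}

module Defs where

open import Data.Fin.Subset using (Subset; _⊆_; _∩_; ∣_∣)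
open import Data.List using (List)
open import Data.List.Membership.Propositional using (_∈_)
open import Data.List.Relation.Unary.All using (All)
open import Data.Nat using (ℕ; suc)
open import Data.Product using (∃-syntax; _×_)
open import Relation.Binary.PropositionalEquality using (_≡_)
open import Relation.Nullary using (¬_)

-- The ground set [n] is Fin n.  A set system on it is a list of subsets;
-- its cardinality is the length of the list only when the list is Unique.
SetSystem : ℕ → Set
SetSystem n = List (Subset n)

Uniform : ∀ {n} → ℕ → SetSystem n → Set
Uniform k 𝓕 = All (λ F → ∣ F ∣ ≡ k) 𝓕

-- Only the inclusion 2^S ⊆ { F ∩ S : F ∈ 𝓕 } is required: the converse
-- holds for every 𝓕, since F ∩ S ⊆ S.
Shatters : ∀ {n} → SetSystem n → Subset n → Set
Shatters 𝓕 S = ∀ T → T ⊆ S → ∃[ F ] (F ∈ 𝓕 × F ∩ S ≡ T)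

-- Subsets of a shattered set are shattered, so the largest size of a
-- shattered set is at most d exactly when no set of size d + 1 is shattered.
VCDim≤ : ∀ {n} → SetSystem n → ℕ → Set
VCDim≤ 𝓕 d = ∀ S → ∣ S ∣ ≡ suc d → ¬ Shatters 𝓕 S

{-# OPTIONS --safe #-}

-- A triple F = xyz of a family of VC-dimension at most 2 misses a trace: F meets every member, or every
-- member through x meets {y, z}, or F is the only member through the pair xy (up to renaming x, y, z).
-- Removing triples together with pairs that they own keeps the graph of remaining pairs connected, so
-- a family of more than C(n-1, 2) triples has a core: a nonempty subfamily each of whose pairs lies in two
-- of its triples, where only the first two kinds of missing trace remain.  Suppose that there are at least
-- C(n-1, 2) + 2 triples; by induction, deleting a vertex, all degrees are then large.
-- If no member meets all the others, a core contains a tetrahedron.  Any two tetrahedra leave a pair of the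
-- ground set uncovered, and a pair may be dropped from the graph in exchange for one more deleted triple.
-- Hence one may go on deleting a face of each tetrahedron found, and finds another one, without end.
-- If abc meets all the others, a core off abc contains auv and buv, or abu, acu, bcu, abv, acv, bcv.
-- For n ≥ 8 the degrees leave only the case where auv and buv miss the traces {u} and {v}; such a
-- configuration is unique, so all pairs are covered, and a core off auv gives the contradiction.
-- For n = 6 and n = 7, where the bounds are 13 and 16, these cases are refuted by certified search trees.

module Submission where

open import Defs
open import Data.Bool using (Bool; true; false; _∨_; _∧_; T)
import Data.Bool.Properties as Bool
open import Data.Empty using (⊥; ⊥-elim)
open import Data.Fin using (Fin; zero; suc)
import Data.Fin.Properties as Fin
open import Data.Fin.Subset as Sub using (Subset; ∣_∣; ⁅_⁆; _∪_)
open import Data.Fin.Subset.Properties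
  using (⊆-antisym; x∈p∪q⁺; x∈p∪q⁻; x∈p∩q⁺; x∈p∩q⁻; x∈⁅x⁆; x∈⁅y⁆⇒x≡y)
open import Data.Vec as Vec using ([]; _∷_; here; there)
open import Data.Vec.Properties as Vec using ([]=⇒lookup; lookup⇒[]=)
open import Data.Fin.Patterns
open import Data.List
  using (List; []; _∷_; _++_; map; length; filter; lookup; allFin; removeAt)
open import Data.Bool.ListAction using (all; any)
open import Data.List.Properties using (length-map; length-++; filter-notAll; filter-all; map-tabulate; tabulate-lookup; length-tabulate)
open import Data.List.Membership.Propositional using (_∈_; _∉_; lose; find)
open import Data.List.Membership.Propositional.Properties
  using (∈-map⁺; ∈-map⁻; ∈-++⁺ˡ; ∈-∃++; ∈-filter⁺; ∈-filter⁻; ∈-allFin; ∈-lookup)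
open import Data.List.Relation.Binary.Permutation.Propositional
  using (_↭_; ↭-refl; ↭-sym; ↭-trans; prep; swap; refl; trans)
open import Data.List.Relation.Binary.Permutation.Propositional.Properties
  using (shift; ↭-length; ∈-resp-↭; All-resp-↭)
open import Data.List.Relation.Binary.Subset.Propositional using (_⊆_)
open import Data.List.Relation.Unary.All as All using (All; []; _∷_)
open import Data.List.Relation.Unary.All.Properties using (¬All⇒Any¬; all⁺)
open import Data.List.Relation.Unary.AllPairs using ([]; _∷_)
open import Data.List.Relation.Unary.Any as Any using (Any; here; there; any?)
open import Data.List.Relation.Unary.Any.Properties using (++⁺ˡ; ++⁺ʳ; map⁺; any⁻)
open import Data.List.Relation.Unary.Unique.Propositional using (Unique)
open import Data.List.Relation.Unary.Unique.Propositional.Properties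
  using (filter⁺; allFin⁺) renaming (map⁺ to Unique-map⁺)
open import Data.Nat
  using (ℕ; zero; suc; _+_; _∸_; _≤_; _<_; _≥_; _≤?_; z≤n; s≤s; _<ᵇ_; s≤s⁻¹)
import Data.Nat as Nat
open import Data.Nat.Properties
open import Data.Nat.Solver using (module +-*-Solver)
open import Data.Nat.Combinatorics using (_C_; nC1≡n; nCk+nC[k+1]≡[n+1]C[k+1])
open import Data.Product using (Σ; ∃; ∃₂; ∃-syntax; _×_; _,_; proj₁; proj₂; uncurry)
open import Data.Product.Properties using (≡-dec)
open import Data.Sum using (_⊎_; inj₁; inj₂; [_,_]′) renaming (swap to ⊎-swap; map to ⊎-map)
open import Data.Unit using (⊤; tt)
open import Data.Maybe as Maybe using (Maybe; just; nothing; _>>=_)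
open import Data.List.Relation.Binary.Pointwise using (Pointwise; []; _∷_)
open import Function using (_∘_; id; case_of_; mk⇔)
open import Relation.Binary using (DecidableEquality; Decidable; Symmetric)
open import Relation.Binary.PropositionalEquality
  using (_≡_; _≢_; refl; sym; trans; cong; cong₂; subst; ≢-sym; module ≡-Reasoning)
import Relation.Binary.PropositionalEquality as ≡
open import Relation.Nullary using (¬_; Dec; yes; no; does; contradiction)
open import Relation.Nullary.Decidable using (_×-dec_; _⊎-dec_; ¬?; map′; dec-true; dec-false; does-⇔; False; toWitnessFalse)
open import Relation.Unary using () renaming (Decidable to Decidable₁)

-- Counting singletons, pairs and triples of a list

-- The number C(n-1, 2) is the cycle rank of the complete graph: each triple that is removed takes
-- an edge with it, while a connected graph keeps at least n - 1 edges. Counts are therefore kept in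
-- the form `length E + 1 < size H + length vs`, which is unaffected by deleting a pair together
-- with a triple. A family of C(n-1, 2) + 2 triples has a surplus of two: one triple of choice may
-- be deleted and a core still exists, while every further deletion has to be paid for by a pair
-- that no triple covers. Hence the search for uncovered pairs, with and without a meeting member.
-- If abc meets all the others, the links of suitable vertices are covered by about n pairs, and
-- this number has to be compared with the degree n - 1 that the induction provides. That degree is
-- available only from eight vertices on, where the bound of the theorem already holds for n - 1. On
-- five vertices all ten triples form an admissible family, so that bound is false there, and the
-- induction climbs from 5 to 7 with bounds of its own.

⟦_⟧ : {P : Set} → Dec P → ℕ
⟦ yes _ ⟧ = 1
⟦ no _ ⟧ = 0

⟦⟧-mono : {P Q : Set} (P? : Dec P) (Q? : Dec Q) → (P → Q) → ⟦ P? ⟧ ≤ ⟦ Q? ⟧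
⟦⟧-mono (yes p) (yes q) f = ≤-refl
⟦⟧-mono (yes p) (no ¬q) f = ⊥-elim (¬q (f p))
⟦⟧-mono (no ¬p) Q? f = z≤n

⟦⟧≤1 : {P : Set} (P? : Dec P) → ⟦ P? ⟧ ≤ 1
⟦⟧≤1 (yes p) = ≤-refl
⟦⟧≤1 (no ¬p) = z≤n

⟦⟧-no : {P : Set} (P? : Dec P) → ¬ P → ⟦ P? ⟧ ≡ 0
⟦⟧-no (yes p) ¬p = ⊥-elim (¬p p)
⟦⟧-no (no _) ¬p = refl

module _ {A : Set} where

  Decidable₃ : (A → A → A → Set) → Set
  Decidable₃ F = ∀ x y z → Dec (F x y z)

  #₁ : {P : A → Set} → Decidable₁ P → List A → ℕ
  #₁ P? [] = 0
  #₁ P? (x ∷ xs) = ⟦ P? x ⟧ + #₁ P? xs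

  #₂ : {P : A → A → Set} → Decidable P → List A → ℕ
  #₂ P? [] = 0
  #₂ P? (x ∷ xs) = #₁ (P? x) xs + #₂ P? xs

  #₃ : {F : A → A → A → Set} → Decidable₃ F → List A → ℕ
  #₃ F? [] = 0
  #₃ F? (x ∷ xs) = #₂ (F? x) xs + #₃ F? xs

  #₁-mono : {P Q : A → Set} (P? : Decidable₁ P) (Q? : Decidable₁ Q) → ∀ xs →
    (∀ {x} → x ∈ xs → P x → Q x) → #₁ P? xs ≤ #₁ Q? xs
  #₁-mono P? Q? [] f = z≤n
  #₁-mono P? Q? (x ∷ xs) f =
    +-mono-≤ (⟦⟧-mono (P? x) (Q? x) (f (here refl))) (#₁-mono P? Q? xs (f ∘ there))

  #₂-mono : {P Q : A → A → Set} (P? : Decidable P) (Q? : Decidable Q) → ∀ xs →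
    (∀ {x y} → x ∈ xs → y ∈ xs → P x y → Q x y) → #₂ P? xs ≤ #₂ Q? xs
  #₂-mono P? Q? [] f = z≤n
  #₂-mono P? Q? (x ∷ xs) f =
    +-mono-≤ (#₁-mono (P? x) (Q? x) xs (λ y∈ → f (here refl) (there y∈)))
             (#₂-mono P? Q? xs (λ x∈ y∈ → f (there x∈) (there y∈)))

  #₃-mono : {F G : A → A → A → Set} (F? : Decidable₃ F) (G? : Decidable₃ G) → ∀ xs →
    (∀ {x y z} → x ∈ xs → y ∈ xs → z ∈ xs → F x y z → G x y z) → #₃ F? xs ≤ #₃ G? xs
  #₃-mono F? G? [] f = z≤n
  #₃-mono F? G? (x ∷ xs) f =
    +-mono-≤ (#₂-mono (F? x) (G? x) xs (λ y∈ z∈ → f (here refl) (there y∈) (there z∈)))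
             (#₃-mono F? G? xs (λ x∈ y∈ z∈ → f (there x∈) (there y∈) (there z∈)))

  #₁≤length : {P : A → Set} (P? : Decidable₁ P) → ∀ xs → #₁ P? xs ≤ length xs
  #₁≤length P? [] = z≤n
  #₁≤length P? (x ∷ xs) = +-mono-≤ (⟦⟧≤1 (P? x)) (#₁≤length P? xs)

  #₁-none : {P : A → Set} (P? : Decidable₁ P) → ∀ xs → (∀ {x} → x ∈ xs → ¬ P x) → #₁ P? xs ≡ 0
  #₁-none P? [] f = refl
  #₁-none P? (x ∷ xs) f = cong₂ _+_ (⟦⟧-no (P? x) (f (here refl))) (#₁-none P? xs (f ∘ there))

  #₂-none : {P : A → A → Set} (P? : Decidable P) → ∀ xs →
    (∀ {x y} → x ∈ xs → y ∈ xs → ¬ P x y) → #₂ P? xs ≡ 0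
  #₂-none P? [] f = refl
  #₂-none P? (x ∷ xs) f =
    cong₂ _+_ (#₁-none (P? x) xs (λ y∈ → f (here refl) (there y∈)))
              (#₂-none P? xs (λ x∈ y∈ → f (there x∈) (there y∈)))

  #₃-none : {F : A → A → A → Set} (F? : Decidable₃ F) → ∀ xs →
    (∀ {x y z} → x ∈ xs → y ∈ xs → z ∈ xs → ¬ F x y z) → #₃ F? xs ≡ 0
  #₃-none F? [] f = refl
  #₃-none F? (x ∷ xs) f =
    cong₂ _+_ (#₂-none (F? x) xs (λ y∈ z∈ → f (here refl) (there y∈) (there z∈)))
              (#₃-none F? xs (λ x∈ y∈ z∈ → f (there x∈) (there y∈) (there z∈)))

  private
    interchange : ∀ a b c d → a + b + (c + d) ≡ a + c + (b + d)
    interchange = solve 4 (λ a b c d → a :+ b :+ (c :+ d) := a :+ c :+ (b :+ d)) refl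
      where open +-*-Solver

  #₁-↭ : {P : A → Set} (P? : Decidable₁ P) → ∀ {xs ys} → xs ↭ ys → #₁ P? xs ≡ #₁ P? ys
  #₁-↭ P? refl = refl
  #₁-↭ P? (prep x p) = cong (⟦ P? x ⟧ +_) (#₁-↭ P? p)
  #₁-↭ P? {_ ∷ _ ∷ xs} {_ ∷ _ ∷ ys} (swap x y p) = begin
    ⟦ P? x ⟧ + (⟦ P? y ⟧ + #₁ P? xs)  ≡⟨ +-assoc ⟦ P? x ⟧ ⟦ P? y ⟧ _ ⟨
    ⟦ P? x ⟧ + ⟦ P? y ⟧ + #₁ P? xs    ≡⟨ cong₂ _+_ (+-comm ⟦ P? x ⟧ _) (#₁-↭ P? p) ⟩
    ⟦ P? y ⟧ + ⟦ P? x ⟧ + #₁ P? ys    ≡⟨ +-assoc ⟦ P? y ⟧ _ _ ⟩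
    ⟦ P? y ⟧ + (⟦ P? x ⟧ + #₁ P? ys)  ∎
    where open ≡-Reasoning
  #₁-↭ P? (trans p q) = ≡.trans (#₁-↭ P? p) (#₁-↭ P? q)

  #₂-↭ : {P : A → A → Set} (P? : Decidable P) → Symmetric P →
    ∀ {xs ys} → xs ↭ ys → #₂ P? xs ≡ #₂ P? ys
  #₂-↭ P? s refl = refl
  #₂-↭ P? s (prep x p) = cong₂ _+_ (#₁-↭ (P? x) p) (#₂-↭ P? s p)
  #₂-↭ P? s {_ ∷ _ ∷ xs} {_ ∷ _ ∷ ys} (swap x y p) = begin
    ⟦ P? x y ⟧ + #₁ (P? x) xs + (#₁ (P? y) xs + #₂ P? xs)
      ≡⟨ interchange ⟦ P? x y ⟧ _ _ _ ⟩
    ⟦ P? x y ⟧ + #₁ (P? y) xs + (#₁ (P? x) xs + #₂ P? xs)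
      ≡⟨ cong₂ _+_ (cong₂ _+_ (≤-antisym (⟦⟧-mono (P? x y) (P? y x) s) (⟦⟧-mono (P? y x) (P? x y) s))
                              (#₁-↭ (P? y) p))
                   (cong₂ _+_ (#₁-↭ (P? x) p) (#₂-↭ P? s p)) ⟩
    ⟦ P? y x ⟧ + #₁ (P? y) ys + (#₁ (P? x) ys + #₂ P? ys) ∎
    where open ≡-Reasoning
  #₂-↭ P? s (trans p q) = ≡.trans (#₂-↭ P? s p) (#₂-↭ P? s q)

  #₃-↭ : {F : A → A → A → Set} (F? : Decidable₃ F) →
    (∀ {x y z} → F x y z → F y x z) → (∀ {x y z} → F x y z → F x z y) →
    ∀ {xs ys} → xs ↭ ys → #₃ F? xs ≡ #₃ F? ys
  #₃-↭ F? s t refl = refl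
  #₃-↭ F? s t (prep x p) = cong₂ _+_ (#₂-↭ (F? x) t p) (#₃-↭ F? s t p)
  #₃-↭ F? s t {_ ∷ _ ∷ xs} {_ ∷ _ ∷ ys} (swap x y p) = begin
    #₁ (F? x y) xs + #₂ (F? x) xs + (#₂ (F? y) xs + #₃ F? xs)
      ≡⟨ interchange (#₁ (F? x y) xs) _ _ _ ⟩
    #₁ (F? x y) xs + #₂ (F? y) xs + (#₂ (F? x) xs + #₃ F? xs)
      ≡⟨ cong₂ _+_ (cong₂ _+_ (≤-antisym (#₁-mono (F? x y) (F? y x) xs (λ _ → s))
                                         (#₁-mono (F? y x) (F? x y) xs (λ _ → s)))
                              (#₂-↭ (F? y) t p))
                   (cong₂ _+_ (#₂-↭ (F? x) t p) (#₃-↭ F? s t p)) ⟩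
    #₁ (F? y x) xs + #₂ (F? y) ys + (#₂ (F? x) ys + #₃ F? ys)
      ≡⟨ cong (λ k → k + #₂ (F? y) ys + (#₂ (F? x) ys + #₃ F? ys)) (#₁-↭ (F? y x) p) ⟩
    #₁ (F? y x) ys + #₂ (F? y) ys + (#₂ (F? x) ys + #₃ F? ys) ∎
    where open ≡-Reasoning
  #₃-↭ F? s t (trans p q) = ≡.trans (#₃-↭ F? s t p) (#₃-↭ F? s t q)

  Unique-resp-↭ : {xs ys : List A} → xs ↭ ys → Unique xs → Unique ys
  Unique-resp-↭ refl u = u
  Unique-resp-↭ (prep x p) (x∉ ∷ u) = All-resp-↭ p x∉ ∷ Unique-resp-↭ p u
  Unique-resp-↭ (swap x y p) ((x≢y ∷ x∉) ∷ y∉ ∷ u) =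
    (≢-sym x≢y ∷ All-resp-↭ p y∉) ∷ All-resp-↭ p x∉ ∷ Unique-resp-↭ p u
  Unique-resp-↭ (trans p q) u = Unique-resp-↭ q (Unique-resp-↭ p u)

  extract : {x : A} {xs : List A} → x ∈ xs → ∃[ ys ] xs ↭ x ∷ ys
  extract x∈ with ys , zs , refl ← ∈-∃++ x∈ = ys ++ zs , shift _ ys zs

  abstract
    extractAll : {ys xs : List A} → Unique ys → ys ⊆ xs → ∃[ ws ] xs ↭ ys ++ ws
    extractAll {[]} {xs} u ys⊆ = xs , ↭-refl
    extractAll {y ∷ ys} (y∉ ∷ u) ys⊆ with zs , p ← extract (ys⊆ (here refl))
      with ws , q ← extractAll {ys} {zs} u (λ {w} w∈ → case ∈-resp-↭ p (ys⊆ (there w∈)) of λ where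
        (here refl) → ⊥-elim (All.lookup y∉ w∈ refl)
        (there w∈′) → w∈′)
      = ws , ↭-trans p (prep y q)

  lookup-injective : {xs : List A} → Unique xs → ∀ {i j} → lookup xs i ≡ lookup xs j → i ≡ j
  lookup-injective {x ∷ xs} (x∉ ∷ u) {zero} {zero} eq = refl
  lookup-injective {x ∷ xs} (x∉ ∷ u) {zero} {suc j} eq = ⊥-elim (All.lookup x∉ (∈-lookup j) eq)
  lookup-injective {x ∷ xs} (x∉ ∷ u) {suc i} {zero} eq = ⊥-elim (All.lookup x∉ (∈-lookup i) (sym eq))
  lookup-injective {x ∷ xs} (x∉ ∷ u) {suc i} {suc j} eq = cong suc (lookup-injective u eq)

  pairs : List A → List (A × A)
  pairs [] = []
  pairs (x ∷ xs) = map (x ,_) xs ++ pairs xs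

  triples : List A → List (A × A × A)
  triples [] = []
  triples (x ∷ xs) = map (x ,_) (pairs xs) ++ triples xs

  -- Incidence of a vertex with a triple

  In : A → A → A → A → Set
  In x r s t = x ≡ r ⊎ x ≡ s ⊎ x ≡ t

  in? : DecidableEquality A → ∀ x r s t → Dec (In x r s t)
  in? _≟_ x r s t = (x ≟ r) ⊎-dec (x ≟ s) ⊎-dec (x ≟ t)

  trace : DecidableEquality A → A × A × A → A × A × A → Bool × Bool × Bool
  trace _≟_ (x , y , z) (r , s , t) =
    does (in? _≟_ x r s t) , does (in? _≟_ y r s t) , does (in? _≟_ z r s t)

  in-swap₁ : ∀ {x r s t} → In x r s t → In x s r t
  in-swap₁ (inj₁ p) = inj₂ (inj₁ p)
  in-swap₁ (inj₂ (inj₁ p)) = inj₁ p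
  in-swap₁ (inj₂ (inj₂ p)) = inj₂ (inj₂ p)

  in-swap₂ : ∀ {x r s t} → In x r s t → In x r t s
  in-swap₂ (inj₁ p) = inj₁ p
  in-swap₂ (inj₂ p) = inj₂ (⊎-swap p)

module _ {A : Set} where

  #₁-++ : {P : A → Set} (P? : Decidable₁ P) → ∀ xs ys → #₁ P? (xs ++ ys) ≡ #₁ P? xs + #₁ P? ys
  #₁-++ P? [] ys = refl
  #₁-++ P? (x ∷ xs) ys = ≡.trans (cong (⟦ P? x ⟧ +_) (#₁-++ P? xs ys)) (sym (+-assoc ⟦ P? x ⟧ _ _))

  #₁-map : {B : Set} {P : A → Set} (P? : Decidable₁ P) (f : B → A) → ∀ xs →
    #₁ P? (map f xs) ≡ #₁ (P? ∘ f) xs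
  #₁-map P? f [] = refl
  #₁-map P? f (x ∷ xs) = cong (⟦ P? (f x) ⟧ +_) (#₁-map P? f xs)

  #₂-map : {B : Set} {P : A → A → Set} (P? : Decidable P) (f : B → A) → ∀ xs →
    #₂ P? (map f xs) ≡ #₂ (λ x y → P? (f x) (f y)) xs
  #₂-map P? f [] = refl
  #₂-map P? f (x ∷ xs) = cong₂ _+_ (#₁-map (P? (f x)) f xs) (#₂-map P? f xs)

  #₃-map : {B : Set} {F : A → A → A → Set} (F? : Decidable₃ F) (f : B → A) → ∀ xs →
    #₃ F? (map f xs) ≡ #₃ (λ x y z → F? (f x) (f y) (f z)) xs
  #₃-map F? f [] = refl
  #₃-map F? f (x ∷ xs) = cong₂ _+_ (#₂-map (F? (f x)) f xs) (#₃-map F? f xs)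

module _ {A : Set} where

  #₂-pairs : {P : A → A → Set} (P? : Decidable P) → ∀ xs →
    #₂ P? xs ≡ #₁ (λ (x , y) → P? x y) (pairs xs)
  #₂-pairs P? [] = refl
  #₂-pairs P? (x ∷ xs) = sym (≡.trans (#₁-++ (λ (x , y) → P? x y) (map (x ,_) xs) (pairs xs))
    (cong₂ _+_ (#₁-map (λ (x , y) → P? x y) (x ,_) xs) (sym (#₂-pairs P? xs))))

  #₃-triples : {F : A → A → A → Set} (F? : Decidable₃ F) → ∀ xs →
    #₃ F? xs ≡ #₁ (λ (x , y , z) → F? x y z) (triples xs)
  #₃-triples F? [] = refl
  #₃-triples F? (x ∷ xs) = sym (≡.trans (#₁-++ F?′ (map (x ,_) (pairs xs)) (triples xs))
    (cong₂ _+_ (≡.trans (#₁-map F?′ (x ,_) (pairs xs)) (sym (#₂-pairs (F? x) xs)))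
               (sym (#₃-triples F? xs))))
    where
    F?′ = λ (x , y , z) → F? x y z

-- Traces on named vertices

Triple : ℕ → Set
Triple n = Fin n × Fin n × Fin n

-- A Boolean test that evaluates faster than the decision procedure of the library
_≡ᶠ_ : ∀ {m} → Fin m → Fin m → Bool
zero ≡ᶠ zero = true
suc i ≡ᶠ suc j = i ≡ᶠ j
_ ≡ᶠ _ = false

encode : Bool × Bool × Bool → ℕ
encode (false , false , false) = 0
encode (true , false , false) = 1
encode (false , true , false) = 2
encode (false , false , true) = 3
encode (true , true , false) = 4
encode (true , false , true) = 5
encode (false , true , true) = 6
encode (true , true , true) = 7

equals : ∀ {n} → Triple n → Triple n → Bool
equals (i , j , k) (r , s , t) = (i ≡ᶠ r) ∧ (j ≡ᶠ s) ∧ (k ≡ᶠ t)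

code : ∀ {n} → Triple n → Triple n → ℕ
code {n} (i , j , k) (r , s , t) = encode (on i , on j , on k)
  where
  on : Fin n → Bool
  on x = (x ≡ᶠ r) ∨ (x ≡ᶠ s) ∨ (x ≡ᶠ t)

patterns : List (Bool × Bool × Bool)
patterns =
  (false , false , false) ∷ (true , false , false) ∷ (false , true , false) ∷ (false , false , true) ∷
  (true , true , false) ∷ (true , false , true) ∷ (false , true , true) ∷ (true , true , true) ∷ []

∈-patterns : ∀ b → b ∈ patterns
∈-patterns (false , false , false) = here refl
∈-patterns (true , false , false) = there (here refl)
∈-patterns (false , true , false) = there (there (here refl))
∈-patterns (false , false , true) = there (there (there (here refl)))
∈-patterns (true , true , false) = there (there (there (there (here refl))))
∈-patterns (true , false , true) = there (there (there (there (there (here refl)))))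
∈-patterns (false , true , true) = there (there (there (there (there (there (here refl))))))
∈-patterns (true , true , true) = there (there (there (there (there (there (there (here refl)))))))

private
  ∧-split : ∀ x {y} → x ∧ y ≡ true → x ≡ true × y ≡ true
  ∧-split true eq = refl , eq

  ≡ᶠ-does : ∀ {m} (i j : Fin m) → i ≡ᶠ j ≡ does (i Fin.≟ j)
  ≡ᶠ-does zero zero = refl
  ≡ᶠ-does zero (suc j) = refl
  ≡ᶠ-does (suc i) zero = refl
  ≡ᶠ-does (suc i) (suc j) = ≡ᶠ-does i j

  ≡ᶠ-≡ : ∀ {m} (i j : Fin m) → i ≡ᶠ j ≡ true → i ≡ j
  ≡ᶠ-≡ zero zero eq = refl
  ≡ᶠ-≡ (suc i) (suc j) eq = cong suc (≡ᶠ-≡ i j eq)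

equals-≡ : ∀ {n} (G H : Triple n) → equals G H ≡ true → G ≡ H
equals-≡ (i , j , k) (r , s , t) eq with e₁ , eq′ ← ∧-split (i ≡ᶠ r) eq
  with e₂ , e₃ ← ∧-split (j ≡ᶠ s) eq′ =
  cong₂ _,_ (≡ᶠ-≡ i r e₁) (cong₂ _,_ (≡ᶠ-≡ j s e₂) (≡ᶠ-≡ k t e₃))

private
  decode : ℕ → Bool × Bool × Bool
  decode 0 = false , false , false
  decode 1 = true , false , false
  decode 2 = false , true , false
  decode 3 = false , false , true
  decode 4 = true , true , false
  decode 5 = true , false , true
  decode 6 = false , true , true
  decode _ = true , true , true

  decode-encode : ∀ b → decode (encode b) ≡ b
  decode-encode (false , false , false) = refl
  decode-encode (true , false , false) = refl
  decode-encode (false , true , false) = refl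
  decode-encode (false , false , true) = refl
  decode-encode (true , true , false) = refl
  decode-encode (true , false , true) = refl
  decode-encode (false , true , true) = refl
  decode-encode (true , true , true) = refl

code-≡ : ∀ {n} (G : Triple n) b (H : Triple n) → (encode b Nat.≡ᵇ code G H) ≡ true → trace Fin._≟_ G H ≡ b
code-≡ (i , j , k) b (r , s , t) eq = ≡.trans
  (cong₂ _,_ (on i) (cong₂ _,_ (on j) (on k)))
  (≡.trans (sym (decode-encode _)) (≡.trans
    (cong decode (sym (≡ᵇ⇒≡ (encode b) _ (subst T (sym eq) tt)))) (decode-encode b)))
  where
  on : ∀ x → does (in? Fin._≟_ x r s t) ≡ (x ≡ᶠ r) ∨ (x ≡ᶠ s) ∨ (x ≡ᶠ t)
  on x rewrite ≡ᶠ-does x r | ≡ᶠ-does x s | ≡ᶠ-does x t = refl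

-- Unordered pairs

module Systems {A : Set} (_≟_ : DecidableEquality A) where

  Same : A → A → A × A → Set
  Same s t (x , y) = (s ≡ x × t ≡ y) ⊎ (s ≡ y × t ≡ x)

  same? : ∀ s t e → Dec (Same s t e)
  same? s t (x , y) = ((s ≟ x) ×-dec (t ≟ y)) ⊎-dec ((s ≟ y) ×-dec (t ≟ x))

  same-swap : ∀ {s t e} → Same s t e → Same t s e
  same-swap (inj₁ (p , q)) = inj₂ (q , p)
  same-swap (inj₂ (p , q)) = inj₁ (q , p)

  _except_ : {P : A → A → Set} → Decidable P → (e : A × A) →
    Decidable (λ s t → P s t × ¬ Same s t e)
  (P? except e) s t = P? s t ×-dec ¬? (same? s t e)

  private
    #₁-≡ : ∀ y {P : A → Set} (P? : Decidable₁ P) {xs} → Unique xs →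
      (∀ {t} → t ∈ xs → P t → t ≡ y) → #₁ P? xs ≤ 1
    #₁-≡ y P? {[]} u f = z≤n
    #₁-≡ y P? {x ∷ xs} (x∉ ∷ u) f with P? x
    ... | no _ = #₁-≡ y P? u (f ∘ there)
    ... | yes p = s≤s (≤-reflexive (#₁-none P? xs λ t∈ q →
      All.lookup x∉ t∈ (≡.trans (f (here refl) p) (sym (f (there t∈) q)))))

    #₁-split : {P Q R : A → Set} (P? : Decidable₁ P) (Q? : Decidable₁ Q) (R? : Decidable₁ R) →
      (∀ {t} → P t → Q t ⊎ R t) → ∀ xs → #₁ P? xs ≤ #₁ R? xs + #₁ Q? xs
    #₁-split P? Q? R? f [] = z≤n
    #₁-split P? Q? R? f (x ∷ xs) with P? x | Q? x | R? x
    ... | no _ | q | r = ≤-trans (#₁-split P? Q? R? f xs) (+-mono-≤ (m≤n+m _ ⟦ r ⟧) (m≤n+m _ ⟦ q ⟧))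
    ... | yes _ | yes _ | r =
      ≤-trans (s≤s (#₁-split P? Q? R? f xs))
        (≤-trans (≤-reflexive (sym (+-suc _ _))) (+-monoˡ-≤ _ (m≤n+m _ ⟦ r ⟧)))
    ... | yes _ | no _ | yes _ = s≤s (#₁-split P? Q? R? f xs)
    ... | yes p | no ¬q | no ¬r = ⊥-elim ([ ¬q , ¬r ]′ (f p))

    #₁-except : {P : A → A → Set} (P? : Decidable P) (s o : A) (e : A × A) → ∀ {xs} → Unique xs →
      (∀ {t} → Same s t e → t ≡ o) → #₁ (P? s) xs ≤ 1 + #₁ ((P? except e) s) xs
    #₁-except {P} P? s o e {xs} u f =
      ≤-trans (#₁-split (P? s) ((P? except e) s) (_≟ o) split xs)
              (+-monoˡ-≤ _ (#₁-≡ o (_≟ o) u (λ _ → id)))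
      where
      split : ∀ {t} → P s t → (P s t × ¬ Same s t e) ⊎ t ≡ o
      split {t} p with same? s t e
      ... | yes q = inj₂ (f q)
      ... | no ¬q = inj₁ (p , ¬q)

  -- A list without duplicates meets an unordered pair in a single position, so forbidding the pair
  -- costs at most one.
  #₂-except : {P : A → A → Set} (P? : Decidable P) (e : A × A) → ∀ {xs} → Unique xs →
    #₂ P? xs ≤ 1 + #₂ (P? except e) xs
  #₂-except P? e {[]} u = z≤n
  #₂-except {P} P? e@(x , y) {z ∷ zs} (z∉ ∷ u) = go (z ≟ x) (z ≟ y)
    where
    go : Dec (z ≡ x) → Dec (z ≡ y) → #₂ P? (z ∷ zs) ≤ 1 + #₂ (P? except e) (z ∷ zs)
    go (no z≢x) (no z≢y) = ≤-trans
      (+-mono-≤ (#₁-mono (P? z) ((P? except e) z) zs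
                   (λ _ p → p , λ where (inj₁ (q , _)) → z≢x q
                                        (inj₂ (q , _)) → z≢y q))
                (#₂-except P? e u))
      (≤-reflexive (+-suc _ _))
    go (yes refl) _ = +-mono-≤
      (#₁-except P? z y e u (λ where (inj₁ (_ , q)) → q
                                     (inj₂ (p , q)) → ≡.trans q p))
      (#₂-mono P? (P? except e) zs (λ s∈ t∈ p → p ,
        λ where (inj₁ (q , _)) → All.lookup z∉ s∈ (sym q)
                (inj₂ (_ , q)) → All.lookup z∉ t∈ (sym q)))
    go (no _) (yes refl) = +-mono-≤
      (#₁-except P? z x e u (λ where (inj₁ (p , q)) → ≡.trans q p
                                     (inj₂ (_ , q)) → q))
      (#₂-mono P? (P? except e) zs (λ s∈ t∈ p → p ,
        λ where (inj₁ (_ , q)) → All.lookup z∉ t∈ (sym q)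
                (inj₂ (q , _)) → All.lookup z∉ s∈ (sym q)))

  -- This is how degrees are bounded from above: the link of a vertex is covered by an explicit list
  -- of pairs.
  #₂-cover : {P : A → A → Set} (P? : Decidable P) (es : List (A × A)) → ∀ {xs} → Unique xs →
    (∀ {s t} → s ∈ xs → t ∈ xs → P s t → Any (Same s t) es) → #₂ P? xs ≤ length es
  #₂-cover P? [] {xs} u f =
    ≤-reflexive (#₂-none P? xs (λ s∈ t∈ p → case f s∈ t∈ p of λ ()))
  #₂-cover P? (e ∷ es) u f = ≤-trans (#₂-except P? e u)
    (s≤s (#₂-cover (P? except e) es u (λ s∈ t∈ (p , ¬q) → case f s∈ t∈ p of λ where
      (here q) → ⊥-elim (¬q q)
      (there q) → q)))

  -- Triple systems

  record TripleSystem (vs : List A) : Set₁ where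
    field
      Mem : A → A → A → Set
      mem? : Decidable₃ Mem
      swap₁ : ∀ {x y z} → Mem x y z → Mem y x z
      swap₂ : ∀ {x y z} → Mem x y z → Mem x z y
      distinct : ∀ {x y z} → Mem x y z → x ≢ y
      support : ∀ {x y z} → Mem x y z → x ∈ vs

    rot : ∀ {x y z} → Mem x y z → Mem y z x
    rot = swap₂ ∘ swap₁

    rot′ : ∀ {x y z} → Mem x y z → Mem z x y
    rot′ = swap₁ ∘ swap₂

    rev : ∀ {x y z} → Mem x y z → Mem z y x
    rev = swap₁ ∘ rot

    distinct₁₃ : ∀ {x y z} → Mem x y z → x ≢ z
    distinct₁₃ = distinct ∘ swap₂

    distinct₂₃ : ∀ {x y z} → Mem x y z → y ≢ z
    distinct₂₃ = distinct ∘ rot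

    size : ℕ
    size = #₃ mem? vs

  open TripleSystem

  _⊑_ : ∀ {vs ws} → TripleSystem vs → TripleSystem ws → Set
  F ⊑ G = ∀ {x y z} → Mem F x y z → Mem G x y z

  _∖_ : ∀ {vs} → TripleSystem vs → A × A × A → TripleSystem vs
  (F ∖ (x , y , z)) = record
    { Mem = λ r s t → Mem F r s t × ¬ (In x r s t × In y r s t × In z r s t)
    ; mem? = λ r s t → mem? F r s t ×-dec ¬? (in? _≟_ x r s t ×-dec in? _≟_ y r s t ×-dec in? _≟_ z r s t)
    ; swap₁ = λ (m , n) → swap₁ F m , λ (p , q , r) → n (in-swap₁ p , in-swap₁ q , in-swap₁ r)
    ; swap₂ = λ (m , n) → swap₂ F m , λ (p , q , r) → n (in-swap₂ p , in-swap₂ q , in-swap₂ r)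
    ; distinct = distinct F ∘ proj₁
    ; support = support F ∘ proj₁
    }

  size-↭ : ∀ {vs ws} (F : TripleSystem vs) → vs ↭ ws → size F ≡ #₃ (mem? F) ws
  size-↭ F = #₃-↭ (mem? F) (swap₁ F) (swap₂ F)

  ∖-∌ : ∀ {vs} (F : TripleSystem vs) {x y z} → ¬ Mem (F ∖ (x , y , z)) x y z
  ∖-∌ F (_ , n) = n (inj₁ refl , inj₂ (inj₁ refl) , inj₂ (inj₂ refl))

  unique₃ : ∀ {vs} (F : TripleSystem vs) {x y z} → Mem F x y z → Unique (x ∷ y ∷ z ∷ [])
  unique₃ F m = (distinct F m ∷ distinct₁₃ F m ∷ []) ∷ (distinct₂₃ F m ∷ []) ∷ [] ∷ []

  ⊆₃ : ∀ {vs} (F : TripleSystem vs) {x y z} → Mem F x y z → (x ∷ y ∷ z ∷ []) ⊆ vs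
  ⊆₃ F m (here refl) = support F m
  ⊆₃ F m (there (here refl)) = support F (rot F m)
  ⊆₃ F m (there (there (here refl))) = support F (rot′ F m)

  size-∖ : ∀ {vs} (F : TripleSystem vs) → Unique vs → ∀ {x y z} → Mem F x y z →
    size F ≤ 1 + size (F ∖ (x , y , z))
  size-∖ {vs} F u {x} {y} {z} m with ws , p ← extractAll (unique₃ F m) (⊆₃ F m)
    with (_ ∷ _ ∷ x∉) ∷ (_ ∷ y∉) ∷ z∉ ∷ _ ← Unique-resp-↭ p u = begin
    size F                                   ≡⟨ size-↭ F p ⟩
    #₃ (mem? F) (x ∷ y ∷ z ∷ ws)             ≤⟨ expanded ⟩
    1 + #₃ (mem? G) (x ∷ y ∷ z ∷ ws)         ≡⟨ cong suc (size-↭ G p) ⟨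
    1 + size G                               ∎
    where
    open ≤-Reasoning
    G = F ∖ (x , y , z)
    ∉⇒≢ : ∀ {a b xs} → All (a ≢_) xs → b ∈ xs → a ≢ b
    ∉⇒≢ all b∈ = All.lookup all b∈
    expanded : #₃ (mem? F) (x ∷ y ∷ z ∷ ws) ≤ 1 + #₃ (mem? G) (x ∷ y ∷ z ∷ ws)
    -- With x, y, z in front, the first summand counts the triple xyz alone; every other summand
    -- runs over triples that avoid one of x, y, z, and these survive the deletion.
    expanded = +-mono-≤ (+-mono-≤ (+-mono-≤ (⟦⟧≤1 (mem? F x y z)) (≤-trans
        (#₁-mono (mem? F x y) (mem? G x y) ws (λ w∈ n → n , λ where
          (_ , _ , inj₁ q) → distinct₁₃ F m (sym q)
          (_ , _ , inj₂ (inj₁ q)) → distinct₂₃ F m (sym q)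
          (_ , _ , inj₂ (inj₂ q)) → ∉⇒≢ z∉ w∈ q)) (m≤n+m _ ⟦ mem? G x y z ⟧)))
        (#₂-mono (mem? F x) (mem? G x) (z ∷ ws) (λ s∈ t∈ n → n , λ where
          (_ , inj₁ q , _) → distinct F m (sym q)
          (_ , inj₂ (inj₁ q) , _) → y∉′ s∈ q
          (_ , inj₂ (inj₂ q) , _) → y∉′ t∈ q)))
      (#₃-mono (mem? F) (mem? G) (y ∷ z ∷ ws) (λ r∈ s∈ t∈ n → n , λ where
          (inj₁ q , _) → x∉′ r∈ q
          (inj₂ (inj₁ q) , _) → x∉′ s∈ q
          (inj₂ (inj₂ q) , _) → x∉′ t∈ q))
      where
      y∉′ : ∀ {w} → w ∈ z ∷ ws → y ≢ w
      y∉′ (here refl) = distinct₂₃ F m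
      y∉′ (there w∈) = ∉⇒≢ y∉ w∈
      x∉′ : ∀ {w} → w ∈ y ∷ z ∷ ws → x ≢ w
      x∉′ (here refl) = distinct F m
      x∉′ (there (here refl)) = distinct₁₃ F m
      x∉′ (there (there w∈)) = ∉⇒≢ x∉ w∈

  -- Collapsing: a triple system without a core is at most as large as the cycle space of a graph

  Linked : List (A × A) → A → A → Set
  Linked E s t = Any (Same s t) E

  linked-sym : ∀ {E s t} → Linked E s t → Linked E t s
  linked-sym = Any.map same-swap

  same-trans : ∀ {s t x y e} → Same s t e → Same x y e → Same s t (x , y)
  same-trans (inj₁ (refl , refl)) (inj₁ (refl , refl)) = inj₁ (refl , refl)
  same-trans (inj₁ (refl , refl)) (inj₂ (refl , refl)) = inj₂ (refl , refl)
  same-trans (inj₂ (refl , refl)) (inj₁ (refl , refl)) = inj₂ (refl , refl)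
  same-trans (inj₂ (refl , refl)) (inj₂ (refl , refl)) = inj₁ (refl , refl)

  -- Connectivity is tested by labellings: one that is constant along edges is constant on all
  -- vertices. Deleting an edge then requires no rerouting of paths.
  Connected : List A → List (A × A) → Set
  Connected vs E = ∀ (κ : A → A) → (∀ {s t} → Linked E s t → κ s ≡ κ t) →
    ∀ {s t} → s ∈ vs → t ∈ vs → κ s ≡ κ t

  filter-≢ : ∀ a {xs} → Unique xs → length xs ≤ 1 + length (filter (λ x → ¬? (x ≟ a)) xs)
  filter-≢ a {[]} u = z≤n
  filter-≢ a {x ∷ xs} (x∉ ∷ u) with x ≟ a
  ... | no _ = s≤s (filter-≢ a u)
  ... | yes refl = s≤s (≤-reflexive (cong length (sym
          (filter-all (λ x → ¬? (x ≟ a)) (All.map ≢-sym x∉)))))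

  private
    -- κ sends every vertex to the representative of its component
    components : ∀ vs → Unique vs → ∀ E → ∃₂ λ (κ : A → A) rs →
      (∀ {s t} → Linked E s t → κ s ≡ κ t) × All (λ r → κ r ≡ r × r ∈ vs) rs ×
      Unique rs × length vs ≤ length E + length rs
    components vs u [] = id , vs , (λ ()) , All.tabulate (λ r∈ → refl , r∈) , u , ≤-refl
    components vs u ((x , y) ∷ E) with κ , rs , const , reps , u′ , le ← components vs u E =
      κ′ , filter (λ r → ¬? (r ≟ κ x)) rs , const′ ,
      All.tabulate (λ r∈ → let r∈′ , r≢ = ∈-filter⁻ (λ r → ¬? (r ≟ κ x)) r∈ in
        fixed (All.lookup reps r∈′) r≢) ,
      filter⁺ (λ r → ¬? (r ≟ κ x)) u′ ,
      ≤-trans le (≤-trans (+-monoʳ-≤ _ (filter-≢ (κ x) u′)) (≤-reflexive (+-suc _ _)))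
      where
      merge : A → A
      merge v with v ≟ κ x
      ... | yes _ = κ y
      ... | no _ = v
      κ′ = merge ∘ κ
      merge-x : merge (κ x) ≡ κ y
      merge-x with κ x ≟ κ x
      ... | yes _ = refl
      ... | no ¬r = ⊥-elim (¬r refl)
      merge-y : merge (κ y) ≡ κ y
      merge-y with κ y ≟ κ x
      ... | yes _ = refl
      ... | no _ = refl
      const′ : ∀ {s t} → Linked ((x , y) ∷ E) s t → κ′ s ≡ κ′ t
      const′ (here (inj₁ (refl , refl))) = ≡.trans merge-x (sym merge-y)
      const′ (here (inj₂ (refl , refl))) = ≡.trans merge-y (sym merge-x)
      const′ (there l) = cong merge (const l)
      fixed : ∀ {r} → κ r ≡ r × r ∈ vs → r ≢ κ x → κ′ r ≡ r × r ∈ vs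
      fixed {r} (eq , r∈) r≢ rewrite eq with r ≟ κ x
      ... | yes q = ⊥-elim (r≢ q)
      ... | no _ = refl , r∈

  -- Each edge merges at most two classes, so at least `length vs` minus `length E` representatives
  -- remain; two of them would be told apart by the labelling κ.
  connected-size : ∀ {vs} → Unique vs → ∀ E → Connected vs E → length vs ≤ length E + 1
  connected-size {vs} u E conn with components vs u E
  ... | κ , [] , const , reps , u′ , le = ≤-trans le (+-monoʳ-≤ (length E) z≤n)
  ... | κ , _ ∷ [] , const , reps , u′ , le = le
  ... | κ , r ∷ s ∷ _ , const , (eq , r∈) ∷ (eq′ , s∈) ∷ _ , (r≢s ∷ _) ∷ _ , le =
    ⊥-elim (r≢s (≡.trans (sym eq) (≡.trans (conn κ const r∈ s∈) eq′)))

  -- Since membership is symmetric, the one clause `again` speaks of all three pairs of a triple.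
  record Core {vs} (B : TripleSystem vs) : Set where
    field
      {x₀ y₀ z₀} : A
      member : Mem B x₀ y₀ z₀
      again : ∀ {x y z} → Mem B x y z → ∃[ t ] t ≢ z × Mem B x y t

  _CoveredBy_ : ∀ {vs} → TripleSystem vs → List (A × A) → Set
  H CoveredBy E = ∀ {x y z} → Mem H x y z → Linked E x y

  search : ∀ vs {P : A → A → A → Set} → Decidable₃ P →
    (∃[ x ] ∃[ y ] ∃[ z ] P x y z) ⊎ (∀ {x y z} → x ∈ vs → y ∈ vs → z ∈ vs → ¬ P x y z)
  search vs P? with any? (λ x → any? (λ y → any? (λ z → P? x y z) vs) vs) vs
  ... | yes p with x , _ , q ← find p with y , _ , r ← find q with z , _ , s ← find r =
    inj₁ (x , y , z , s)
  ... | no ¬p = inj₂ λ x∈ y∈ z∈ p → ¬p (lose x∈ (lose y∈ (lose z∈ p)))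

  _without_ : List (A × A) → A × A → List (A × A)
  E without (x , y) = filter (λ e → ¬? (same? x y e)) E

  linked-without : ∀ {E x y s t} → Linked E s t → ¬ Same s t (x , y) → Linked (E without (x , y)) s t
  linked-without {E} {x} {y} l ¬q with e , e∈ , p ← find l =
    lose (∈-filter⁺ (λ e → ¬? (same? x y e)) e∈ λ q → ¬q (same-trans p q)) p

  length-without : ∀ {E x y} → Linked E x y → length (E without (x , y)) < length E
  length-without {E} {x} {y} l =
    filter-notAll (λ e → ¬? (same? x y e)) E (Any.map (λ p ¬p → ¬p p) l)

  -- A labelling that respects the remaining edges agrees along the path x, z, y, hence also along
  -- the deleted edge.
  connected-without : ∀ {vs E x y} z → Connected vs E →
    Linked (E without (x , y)) x z → Linked (E without (x , y)) z y → Connected vs (E without (x , y))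
  connected-without {vs} {E} {x} {y} z conn l l′ κ const = conn κ λ {s} {t} m →
    case same? s t (x , y) of λ where
      (no ¬q) → const (linked-without m ¬q)
      (yes (inj₁ (refl , refl))) → ≡.trans (const l) (const l′)
      (yes (inj₂ (refl , refl))) → sym (≡.trans (const l) (const l′))

  -- The surplus survives when a pair and a triple are deleted together.
  shrink : ∀ {e e′ h h′ n} → e′ < e → h ≤ 1 + h′ → e + 1 < h + n → e′ + 1 < h′ + n
  shrink {n = n} e′<e h≤ lt =
    s≤s⁻¹ (≤-trans (s≤s (+-monoˡ-≤ 1 e′<e)) (≤-trans lt (+-monoˡ-≤ n h≤)))

  -- Removing a triple together with a pair that it owns keeps the graph connected, since the
  -- two remaining sides of the triple join the ends of that pair.
  core : ∀ {vs} → Unique vs → (H : TripleSystem vs) (E : List (A × A)) →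
    H CoveredBy E → Connected vs E → length E + 1 < size H + length vs →
    Σ (TripleSystem vs) λ B → B ⊑ H × Core B
  core {vs} u H E = go (length E) H E ≤-refl
    where
    go : ∀ k (H : TripleSystem vs) E → length E ≤ k →
      H CoveredBy E → Connected vs E → length E + 1 < size H + length vs →
      Σ (TripleSystem vs) λ B → B ⊑ H × Core B
    go k H E le cov conn lt with search vs (mem? H)
    -- With no triple left, the hypothesis says that a connected graph has fewer than |V| - 1 edges.
    ... | inj₂ none = contradiction (connected-size u E conn) (<⇒≱
            (≤-trans lt (≤-reflexive (cong (_+ length vs) (#₃-none (mem? H) vs none)))))
    ... | inj₁ (x₀ , y₀ , z₀ , m₀)
      with search vs (λ x y z → mem? H x y z ×-dec ¬? (any? (λ t → ¬? (t ≟ z) ×-dec mem? H x y t) vs))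
    ... | inj₂ none = H , id , record
      { member = m₀
      ; again = λ {x} {y} {z} m → case any? (λ t → ¬? (t ≟ z) ×-dec mem? H x y t) vs of λ where
          (yes p) → let t , _ , q = find p in t , q
          (no ¬p) → ⊥-elim (none (support H m) (support H (rot H m)) (support H (rot′ H m)) (m , ¬p))
      }
    go zero H E le cov conn lt | inj₁ _ | inj₁ (x , y , z , m , owns) =
      contradiction (≤-trans (length-without (cov m)) le) λ ()
    go (suc k) H E le cov conn lt | inj₁ _ | inj₁ (x , y , z , m , owns) =
      let B , B⊑ , c = go k (H ∖ (x , y , z)) (E without (x , y))
                         (s≤s⁻¹ (≤-trans (length-without (cov m)) le)) cov′ conn′ lt′
      in B , proj₁ ∘ B⊑ , c
      where
      own : ∀ {t} → Mem H x y t → t ≡ z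
      own {t} n with t ≟ z
      ... | yes eq = eq
      ... | no t≢z = ⊥-elim (owns (lose (support H (rot′ H n)) (t≢z , n)))
      cov′ : (H ∖ (x , y , z)) CoveredBy (E without (x , y))
      cov′ (n , ¬T) = linked-without (cov n) λ where
        (inj₁ (refl , refl)) → ¬T (inj₁ refl , inj₂ (inj₁ refl) , inj₂ (inj₂ (sym (own n))))
        (inj₂ (refl , refl)) → ¬T (inj₂ (inj₁ refl) , inj₁ refl , inj₂ (inj₂ (sym (own (swap₁ H n)))))
      conn′ : Connected vs (E without (x , y))
      conn′ = connected-without z conn
        (linked-without (cov (swap₂ H m)) λ where
          (inj₁ (_ , z≡y)) → distinct₂₃ H m (sym z≡y)
          (inj₂ (x≡y , _)) → distinct H m x≡y)
        (linked-without (cov (rev H m)) λ where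
          (inj₁ (z≡x , _)) → distinct₁₃ H m (sym z≡x)
          (inj₂ (z≡y , _)) → distinct₂₃ H m (sym z≡y))
      lt′ : length (E without (x , y)) + 1 < size (H ∖ (x , y , z)) + length vs
      lt′ = shrink (length-without (cov m)) (size-∖ H u m) lt

  pairs-linked : ∀ {vs s t} → s ∈ vs → t ∈ vs → s ≢ t → Linked (pairs vs) s t
  pairs-linked (here refl) (here refl) s≢t = ⊥-elim (s≢t refl)
  pairs-linked {x ∷ xs} (here refl) (there t∈) s≢t =
    lose (∈-++⁺ˡ (∈-map⁺ (x ,_) t∈)) (inj₁ (refl , refl))
  pairs-linked {x ∷ xs} (there s∈) (here refl) s≢t =
    lose (∈-++⁺ˡ (∈-map⁺ (x ,_) s∈)) (inj₂ (refl , refl))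
  pairs-linked {x ∷ xs} (there s∈) (there t∈) s≢t = ++⁺ʳ (map (x ,_) xs) (pairs-linked s∈ t∈ s≢t)

  pairs-covering : ∀ {vs} (H : TripleSystem vs) → H CoveredBy pairs vs
  pairs-covering H m = pairs-linked (support H m) (support H (rot H m)) (distinct H m)

  pairs-connected : ∀ {vs} → Connected vs (pairs vs)
  pairs-connected κ const {s} {t} s∈ t∈ with s ≟ t
  ... | yes refl = refl
  ... | no s≢t = const (pairs-linked s∈ t∈ s≢t)

  -- The seven ways in which a member of a family can fail to be shattered

  Missing : ∀ {vs} → TripleSystem vs → A × A × A → Bool × Bool × Bool → Set
  Missing F T b = ∀ {r s t} → Mem F r s t → trace _≟_ T (r , s , t) ≢ b

  -- Both the tested triples and the traces come from the family, so the property is inherited by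
  -- subfamilies, as the deletion of a vertex requires.
  Good : ∀ {vs} → TripleSystem vs → Set
  Good F = ∀ {x y z} → Mem F x y z → ∃[ b ] Missing F (x , y , z) b

  -- Meets, Dom and Own say that the traces ∅, {x} and {x, y} of the triple xyz are missing.

  Meets : ∀ {vs} → TripleSystem vs → A → A → A → Set
  Meets F x y z = ∀ {r s t} → Mem F r s t → In x r s t ⊎ In y r s t ⊎ In z r s t

  Dom : ∀ {vs} → TripleSystem vs → A → A → A → Set
  Dom F x y z = ∀ {s t} → Mem F x s t → (s ≡ y ⊎ s ≡ z) ⊎ (t ≡ y ⊎ t ≡ z)

  Own : ∀ {vs} → TripleSystem vs → A → A → A → Set
  Own F x y z = ∀ {t} → Mem F x y t → t ≡ z

  data Kind {vs} (F : TripleSystem vs) (x y z : A) : Set where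
    meets : Meets F x y z → Kind F x y z
    dom₁ : Dom F x y z → Kind F x y z
    dom₂ : Dom F y x z → Kind F x y z
    dom₃ : Dom F z x y → Kind F x y z
    own₁ : Own F y z x → Kind F x y z
    own₂ : Own F x z y → Kind F x y z
    own₃ : Own F x y z → Kind F x y z

  module _ {vs} (F : TripleSystem vs) (good : Good F) where
    private
      has-true : ∀ {x r s t} → In x r s t → does (in? _≟_ x r s t) ≡ true
      has-true {x} {r} {s} {t} = dec-true (in? _≟_ x r s t)

      has-false : ∀ {x r s t} → ¬ In x r s t → does (in? _≟_ x r s t) ≡ false
      has-false {x} {r} {s} {t} = dec-false (in? _≟_ x r s t)

      triple : ∀ {a b c a′ b′ c′ : Bool} → a ≡ a′ → b ≡ b′ → c ≡ c′ → (a , b , c) ≡ (a′ , b′ , c′)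
      triple refl refl refl = refl

      to-meets : ∀ {x y z} → Missing F (x , y , z) (false , false , false) → Meets F x y z
      to-meets {x} {y} {z} miss {r} {s} {t} m
        with in? _≟_ x r s t | in? _≟_ y r s t | in? _≟_ z r s t
      ... | yes p | _ | _ = inj₁ p
      ... | no _ | yes p | _ = inj₂ (inj₁ p)
      ... | no _ | no _ | yes p = inj₂ (inj₂ p)
      ... | no p | no q | no r = ⊥-elim (miss m (triple (has-false p) (has-false q) (has-false r)))

      to-dom : ∀ {x y z} → x ≢ y → x ≢ z →
        (∀ {s t} → Mem F x s t → ¬ (¬ In y x s t × ¬ In z x s t)) → Dom F x y z
      to-dom {x} {y} {z} x≢y x≢z miss {s} {t} m with in? _≟_ y x s t | in? _≟_ z x s t
      ... | no p | no q = ⊥-elim (miss m (p , q))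
      ... | yes (inj₁ p) | _ = ⊥-elim (x≢y (sym p))
      ... | yes (inj₂ (inj₁ p)) | _ = inj₁ (inj₁ (sym p))
      ... | yes (inj₂ (inj₂ p)) | _ = inj₂ (inj₁ (sym p))
      ... | no _ | yes (inj₁ p) = ⊥-elim (x≢z (sym p))
      ... | no _ | yes (inj₂ (inj₁ p)) = inj₁ (inj₂ (sym p))
      ... | no _ | yes (inj₂ (inj₂ p)) = inj₂ (inj₂ (sym p))

      to-own : ∀ {x y z} → x ≢ z → y ≢ z →
        (∀ {t} → Mem F x y t → ¬ ¬ In z x y t) → Own F x y z
      to-own {x} {y} {z} x≢z y≢z miss {t} m with in? _≟_ z x y t
      ... | no p = ⊥-elim (miss m p)
      ... | yes (inj₁ p) = ⊥-elim (x≢z (sym p))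
      ... | yes (inj₂ (inj₁ p)) = ⊥-elim (y≢z (sym p))
      ... | yes (inj₂ (inj₂ p)) = sym p

    classify : ∀ {x y z} → Mem F x y z → Kind F x y z
    classify {x} {y} {z} m = go (good m)
      where
      x≢y = distinct F m
      x≢z = distinct₁₃ F m
      y≢z = distinct₂₃ F m
      1st : ∀ {x s t : A} → In x x s t
      1st = inj₁ refl
      2nd : ∀ {x s t : A} → In x s x t
      2nd = inj₂ (inj₁ refl)
      3rd : ∀ {x s t : A} → In x s t x
      3rd = inj₂ (inj₂ refl)
      go : ∃ (Missing F (x , y , z)) → Kind F x y z
      go ((true , true , true) , miss) =
        ⊥-elim (miss m (triple (has-true 1st) (has-true 2nd) (has-true 3rd)))
      go ((true , true , false) , miss) = own₃ (to-own x≢z y≢z λ n p →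
        miss n (triple (has-true 1st) (has-true 2nd) (has-false p)))
      go ((true , false , true) , miss) = own₂ (to-own x≢y (≢-sym y≢z) λ n p →
        miss n (triple (has-true 1st) (has-false p) (has-true 2nd)))
      go ((false , true , true) , miss) = own₁ (to-own (≢-sym x≢y) (≢-sym x≢z) λ n p →
        miss n (triple (has-false p) (has-true 1st) (has-true 2nd)))
      go ((true , false , false) , miss) = dom₁ (to-dom x≢y x≢z λ n (p , q) →
        miss n (triple (has-true 1st) (has-false p) (has-false q)))
      go ((false , true , false) , miss) = dom₂ (to-dom (≢-sym x≢y) y≢z λ n (p , q) →
        miss n (triple (has-false p) (has-true 1st) (has-false q)))
      go ((false , false , true) , miss) = dom₃ (to-dom (≢-sym x≢z) (≢-sym y≢z) λ n (p , q) →
        miss n (triple (has-false p) (has-false q) (has-true 1st)))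
      go ((false , false , false) , miss) = meets (to-meets miss)

  module _ {vs} (F : TripleSystem vs) where
    private
      clash : {P : Set} (P? : Dec P) → P → does P? ≢ false
      clash (yes _) p ()
      clash (no ¬p) p _ = ¬p p

      holds : {P : Set} (P? : Dec P) → does P? ≡ true → P
      holds (yes p) _ = p

    missing-meets : ∀ {x y z} → Meets F x y z → Missing F (x , y , z) (false , false , false)
    missing-meets {x} {y} {z} mt {r} {s} {t} m eq with mt m
    ... | inj₁ p = clash (in? _≟_ x r s t) p (cong proj₁ eq)
    ... | inj₂ (inj₁ p) = clash (in? _≟_ y r s t) p (cong (proj₁ ∘ proj₂) eq)
    ... | inj₂ (inj₂ p) = clash (in? _≟_ z r s t) p (cong (proj₂ ∘ proj₂) eq)

    missing-dom : ∀ {x y z} → Dom F x y z → Missing F (x , y , z) (true , false , false)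
    missing-dom {x} {y} {z} d {r} {s} {t} m eq with holds (in? _≟_ x r s t) (cong proj₁ eq)
    ... | inj₁ refl = absurd (d m)
      where
      absurd : (s ≡ y ⊎ s ≡ z) ⊎ (t ≡ y ⊎ t ≡ z) → ⊥
      absurd (inj₁ (inj₁ refl)) = clash (in? _≟_ y r s t) (inj₂ (inj₁ refl)) (cong (proj₁ ∘ proj₂) eq)
      absurd (inj₁ (inj₂ refl)) = clash (in? _≟_ z r s t) (inj₂ (inj₁ refl)) (cong (proj₂ ∘ proj₂) eq)
      absurd (inj₂ (inj₁ refl)) = clash (in? _≟_ y r s t) (inj₂ (inj₂ refl)) (cong (proj₁ ∘ proj₂) eq)
      absurd (inj₂ (inj₂ refl)) = clash (in? _≟_ z r s t) (inj₂ (inj₂ refl)) (cong (proj₂ ∘ proj₂) eq)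
    ... | inj₂ (inj₁ refl) = absurd (d (swap₁ F m))
      where
      absurd : (r ≡ y ⊎ r ≡ z) ⊎ (t ≡ y ⊎ t ≡ z) → ⊥
      absurd (inj₁ (inj₁ refl)) = clash (in? _≟_ y r s t) (inj₁ refl) (cong (proj₁ ∘ proj₂) eq)
      absurd (inj₁ (inj₂ refl)) = clash (in? _≟_ z r s t) (inj₁ refl) (cong (proj₂ ∘ proj₂) eq)
      absurd (inj₂ (inj₁ refl)) = clash (in? _≟_ y r s t) (inj₂ (inj₂ refl)) (cong (proj₁ ∘ proj₂) eq)
      absurd (inj₂ (inj₂ refl)) = clash (in? _≟_ z r s t) (inj₂ (inj₂ refl)) (cong (proj₂ ∘ proj₂) eq)
    ... | inj₂ (inj₂ refl) = absurd (d (rot′ F m))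
      where
      absurd : (r ≡ y ⊎ r ≡ z) ⊎ (s ≡ y ⊎ s ≡ z) → ⊥
      absurd (inj₁ (inj₁ refl)) = clash (in? _≟_ y r s t) (inj₁ refl) (cong (proj₁ ∘ proj₂) eq)
      absurd (inj₁ (inj₂ refl)) = clash (in? _≟_ z r s t) (inj₁ refl) (cong (proj₂ ∘ proj₂) eq)
      absurd (inj₂ (inj₁ refl)) = clash (in? _≟_ y r s t) (inj₂ (inj₁ refl)) (cong (proj₁ ∘ proj₂) eq)
      absurd (inj₂ (inj₂ refl)) = clash (in? _≟_ z r s t) (inj₂ (inj₁ refl)) (cong (proj₂ ∘ proj₂) eq)

  -- Local contradictions among the named vertices of a list

  module Named {vs} (F : TripleSystem vs) {xs : List A} (u : Unique xs) where

    V : Set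
    V = Fin (length xs)

    Mem′ : V × V × V → Set
    Mem′ (i , j , k) = Mem F (lookup xs i) (lookup xs j) (lookup xs k)

    private
      has-lookup : ∀ (i j k l : V) → does (in? _≟_ (lookup xs i) (lookup xs j) (lookup xs k) (lookup xs l))
        ≡ does (in? Fin._≟_ i j k l)
      has-lookup i j k l = does-⇔ (mk⇔
        (⊎-map inj (⊎-map inj inj))
        (⊎-map (cong (lookup xs)) (⊎-map (cong (lookup xs)) (cong (lookup xs)))))
        (in? _≟_ _ _ _ _) (in? Fin._≟_ i j k l)
        where inj = lookup-injective u

    trace-lookup : ∀ (i j k r s t : V) →
      trace _≟_ (lookup xs i , lookup xs j , lookup xs k) (lookup xs r , lookup xs s , lookup xs t)
        ≡ trace Fin._≟_ (i , j , k) (r , s , t)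
    trace-lookup i j k r s t =
      cong₂ _,_ (has-lookup i r s t) (cong₂ _,_ (has-lookup j r s t) (has-lookup k r s t))

    distinct-names : ∀ i j → {False (i Fin.≟ j)} → lookup xs i ≢ lookup xs j
    distinct-names i j {ne} eq = toWitnessFalse ne (lookup-injective u eq)

    shatters : V × V × V → List (V × V × V) → Bool
    shatters G L = all (λ b → any (λ H → encode b Nat.≡ᵇ code G H) L) patterns

    -- Named vertices are pairwise distinct, so traces can be computed on their indices. The
    -- implicit argument is the evaluated check that all eight traces on `G` occur; `G` itself gives
    -- the full one.
    shatter : Good F → ∀ G L → All Mem′ (G ∷ L) → {T (shatters G (G ∷ L))} → ⊥
    shatter good G@(i , j , k) L ms@(m ∷ _) {sh} with b , miss ← good m
      with H@(r , s , t) , H∈ , eq ← find (any⁻ (λ H → encode b Nat.≡ᵇ code G H) (G ∷ L)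
             (All.lookup (all⁺ (λ b → any (λ H → encode b Nat.≡ᵇ code G H) (G ∷ L)) patterns sh) (∈-patterns b))) =
      miss (All.lookup ms H∈) (≡.trans (trace-lookup i j k r s t) (code-≡ G b H (T⇒≡ eq)))
      where
      T⇒≡ : ∀ {x} → T x → x ≡ true
      T⇒≡ {true} _ = refl

  -- Degrees and pairs that cover a link

  MinDegree : ∀ {vs} → TripleSystem vs → ℕ → Set
  MinDegree {vs} F d = ∀ {w ws} → vs ↭ w ∷ ws → d ≤ #₂ (mem? F w) ws

  module _ {vs} (u : Unique vs) (F : TripleSystem vs) {d} (deg : MinDegree F d) where

    degree-cover : ∀ {w} → w ∈ vs → (es : List (A × A)) →
      (∀ {s t} → Mem F w s t → Linked es s t) → d ≤ length es
    degree-cover w∈ es cov with ws , p ← extract w∈ with _ ∷ u′ ← Unique-resp-↭ p u =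
      ≤-trans (deg p) (#₂-cover (mem? F _) es u′ (λ _ _ → cov))

    -- The pairs of `es` that really belong to the link already cover it; if one did not belong,
    -- fewer than `d` pairs would cover.
    degree-tight : ∀ {w} → w ∈ vs → (es : List (A × A)) →
      (∀ {s t} → Mem F w s t → Linked es s t) → length es ≤ d → All (λ (s , t) → Mem F w s t) es
    degree-tight {w} w∈ es cov le with All.all? (λ (s , t) → mem? F w s t) es
    ... | yes all = all
    ... | no ¬all = contradiction (degree-cover w∈ (filter (λ (s , t) → mem? F w s t) es) cov′)
      (<⇒≱ (≤-trans (filter-notAll (λ (s , t) → mem? F w s t) es (¬All⇒Any¬ (λ (s , t) → mem? F w s t) es ¬all)) le))
      where
      cov′ : ∀ {s t} → Mem F w s t → Linked (filter (λ (s , t) → mem? F w s t) es) s t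
      cov′ m with find (cov m)
      ... | (x , y) , e∈ , inj₁ (refl , refl) =
        lose (∈-filter⁺ (λ (s , t) → mem? F w s t) e∈ m) (inj₁ (refl , refl))
      ... | (x , y) , e∈ , inj₂ (refl , refl) =
        lose (∈-filter⁺ (λ (s , t) → mem? F w s t) e∈ (swap₂ F m)) (inj₂ (refl , refl))

    Covers : A → List (A × A) → Set
    Covers w es = ∀ {s t} → Mem F w s t → Linked es s t

    covers-removeAt : ∀ {w} (es : List (A × A)) i → let (x , y) = lookup es i in
      ¬ Mem F w x y → Covers w es → Covers w (removeAt es i)
    covers-removeAt {w} es i ¬m cov m = go es i (cov m) λ where
        (inj₁ (refl , refl)) → ¬m m
        (inj₂ (refl , refl)) → ¬m (swap₂ F m)
      where
      go : ∀ {P : A × A → Set} es i → Any P es → ¬ P (lookup es i) → Any P (removeAt es i)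
      go (e ∷ es) zero (here p) ¬p = ⊥-elim (¬p p)
      go (e ∷ es) zero (there p) ¬p = p
      go (e ∷ es) (suc i) (here p) ¬p = here p
      go (e ∷ es) (suc i) (there p) ¬p = there (go es i p ¬p)

  third : ∀ {vs} (F : TripleSystem vs) {x y z w l t} → Meets F x y z → Mem F w l t →
    w ≢ x → w ≢ y → w ≢ z → l ≢ x → l ≢ y → l ≢ z → t ≡ x ⊎ t ≡ y ⊎ t ≡ z
  third F mt m w≢x w≢y w≢z l≢x l≢y l≢z with mt m
  ... | inj₁ (inj₁ p) = ⊥-elim (w≢x (sym p))
  ... | inj₁ (inj₂ (inj₁ p)) = ⊥-elim (l≢x (sym p))
  ... | inj₁ (inj₂ (inj₂ p)) = inj₁ (sym p)
  ... | inj₂ (inj₁ (inj₁ p)) = ⊥-elim (w≢y (sym p))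
  ... | inj₂ (inj₁ (inj₂ (inj₁ p))) = ⊥-elim (l≢y (sym p))
  ... | inj₂ (inj₁ (inj₂ (inj₂ p))) = inj₂ (inj₁ (sym p))
  ... | inj₂ (inj₂ (inj₁ p)) = ⊥-elim (w≢z (sym p))
  ... | inj₂ (inj₂ (inj₂ (inj₁ p))) = ⊥-elim (l≢z (sym p))
  ... | inj₂ (inj₂ (inj₂ (inj₂ p))) = inj₂ (inj₂ (sym p))

  dom-third : ∀ {vs} (F : TripleSystem vs) {x y z l t} → Dom F x y z → Mem F x l t →
    l ≢ y → l ≢ z → t ≡ y ⊎ t ≡ z
  dom-third F d m l≢y l≢z with d m
  ... | inj₁ (inj₁ p) = ⊥-elim (l≢y p)
  ... | inj₁ (inj₂ p) = ⊥-elim (l≢z p)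
  ... | inj₂ p = p

  dom-miss : ∀ {vs} (F : TripleSystem vs) {x y z s t} → Dom F x y z → Mem F x s t →
    s ≢ y → s ≢ z → t ≢ y → t ≢ z → ⊥
  dom-miss F d m s≢y s≢z t≢y t≢z = [ t≢y , t≢z ]′ (dom-third F d m s≢y s≢z)

-- Families in which no member meets all the others

module NoMeets {A : Set} (_≟_ : DecidableEquality A) {vs} (u : Unique vs)
  (F : Systems.TripleSystem _≟_ vs) (good : Systems.Good _≟_ F)
  (deg : Systems.MinDegree _≟_ F 4)
  (noMeets : ∀ {x y z} → Systems.TripleSystem.Mem F x y z → ¬ Systems.Meets _≟_ F x y z) where

  open Systems _≟_
  open TripleSystem

  -- The further triples through p, q and r show that no pair is owned, and a meeting member is
  -- excluded; only the three traces of size one remain.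
  shared : ∀ {x y z p q r} → Mem F x y z → Mem F y z p → p ≢ x → Mem F x z q → q ≢ y →
    Mem F x y r → r ≢ z → Dom F x y z ⊎ Dom F y x z ⊎ Dom F z x y
  shared m a p≢x b q≢y c r≢z with classify F good m
  ... | meets t = ⊥-elim (noMeets m t)
  ... | dom₁ t = inj₁ t
  ... | dom₂ t = inj₂ (inj₁ t)
  ... | dom₃ t = inj₂ (inj₂ t)
  ... | own₁ t = ⊥-elim (p≢x (t a))
  ... | own₂ t = ⊥-elim (q≢y (t b))
  ... | own₃ t = ⊥-elim (r≢z (t c))

  few : ∀ {w} (es : List (A × A)) → w ∈ vs → (∀ {s t} → Mem F w s t → Linked es s t) → ¬ length es ≤ 3
  few es w∈ cov le = <⇒≱ (s≤s le) (degree-cover u F {4} deg w∈ es cov)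

  -- Tetrahedra

  Clique : TripleSystem vs → List A → Set
  Clique H Q = ∀ {p q r} → p ∈ Q → q ∈ Q → r ∈ Q → p ≢ q → p ≢ r → q ≢ r → Mem H p q r

  record Tetra (H : TripleSystem vs) (Q : List A) : Set where
    field
      unique : Unique Q
      four : length Q ≡ 4
      clique : Clique H Q
  open Tetra

  tetra-↭ : ∀ {H Q Q′} → Q ↭ Q′ → Tetra H Q → Tetra H Q′
  tetra-↭ p t = record
    { unique = Unique-resp-↭ p (unique t)
    ; four = ≡.trans (sym (↭-length p)) (four t)
    ; clique = λ a b c → clique t (back a) (back b) (back c)
    }
    where
    back : ∀ {x} → x ∈ _ → x ∈ _
    back = ∈-resp-↭ (↭-sym p)

  tetra-⊑ : ∀ {H G Q} → H ⊑ G → Tetra H Q → Tetra G Q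
  tetra-⊑ H⊑G t = record
    { unique = unique t
    ; four = four t
    ; clique = λ p∈ q∈ r∈ p≢q p≢r q≢r → H⊑G (clique t p∈ q∈ r∈ p≢q p≢r q≢r)
    }

  private
    link-∷ : ∀ (H : TripleSystem vs) {x y Q} → (∀ {r} → r ∈ Q → Mem H x y r) →
      (∀ {q r} → q ∈ Q → r ∈ Q → q ≢ r → Mem H x q r) →
      ∀ {q r} → q ∈ y ∷ Q → r ∈ y ∷ Q → q ≢ r → Mem H x q r
    link-∷ H row rest (here refl) (here refl) ne = ⊥-elim (ne refl)
    link-∷ H row rest (here refl) (there r∈) ne = row r∈
    link-∷ H row rest (there q∈) (here refl) ne = swap₂ H (row q∈)
    link-∷ H row rest (there q∈) (there r∈) ne = rest q∈ r∈ ne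

    clique-∷ : ∀ (H : TripleSystem vs) {x Q} → (∀ {q r} → q ∈ Q → r ∈ Q → q ≢ r → Mem H x q r) →
      Clique H Q → Clique H (x ∷ Q)
    clique-∷ H link rest (here refl) (here refl) _ p≢q _ _ = ⊥-elim (p≢q refl)
    clique-∷ H link rest (here refl) (there _) (here refl) _ p≢r _ = ⊥-elim (p≢r refl)
    clique-∷ H link rest (here refl) (there q∈) (there r∈) _ _ q≢r = link q∈ r∈ q≢r
    clique-∷ H link rest (there _) (here refl) (here refl) _ _ q≢r = ⊥-elim (q≢r refl)
    clique-∷ H link rest (there p∈) (here refl) (there r∈) _ p≢r _ = swap₁ H (link p∈ r∈ p≢r)
    clique-∷ H link rest (there p∈) (there q∈) (here refl) p≢q _ _ = rot H (link p∈ q∈ p≢q)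
    clique-∷ H link rest (there p∈) (there q∈) (there r∈) = rest p∈ q∈ r∈

    one : ∀ {P : A → Set} {x} → P x → ∀ {r} → r ∈ x ∷ [] → P r
    one p (here refl) = p

    two : ∀ {P : A → Set} {x y} → P x → P y → ∀ {r} → r ∈ x ∷ y ∷ [] → P r
    two p q (here refl) = p
    two p q (there (here refl)) = q

  tetra : ∀ (H : TripleSystem vs) {x y z v} → Mem H x y z → Mem H x y v → Mem H x z v → Mem H y z v →
    Tetra H (x ∷ y ∷ z ∷ v ∷ [])
  tetra H {x} {y} {z} {v} xyz xyv xzv yzv = record
    { unique = (distinct H xyz ∷ distinct H xzv ∷ distinct₁₃ H xzv ∷ []) ∷
               (distinct H yzv ∷ distinct₁₃ H yzv ∷ []) ∷ (distinct₂₃ H yzv ∷ []) ∷ [] ∷ []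
    ; four = refl
    ; clique =
        clique-∷ H (link-∷ H (two xyz xyv) (link-∷ H (one xzv) (link-∷ H (λ ()) λ ())))
          (clique-∷ H (link-∷ H (one yzv) (link-∷ H (λ ()) λ ()))
            (clique-∷ H (link-∷ H (λ ()) λ ()) (clique-∷ H (λ ()) λ ())))
    }

  -- The link of x in a core contains y – z – v – y as soon as it is dominated by an edge yz.
  core-tetra : ∀ {B : TripleSystem vs} → B ⊑ F → Core B → ∃[ Q ] Tetra B Q
  core-tetra {B} B⊑F c = [ from member , [ from (swap₁ B member) , from (rot′ B member) ]′ ]′ (sharedB member)
    where
    open Core c
    sharedB : ∀ {x y z} → Mem B x y z → Dom F x y z ⊎ Dom F y x z ⊎ Dom F z x y
    sharedB m with p , p≢ , m₁ ← again (rot B m) | q , q≢ , m₂ ← again (swap₂ B m) | r , r≢ , m₃ ← again m =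
      shared (B⊑F m) (B⊑F m₁) p≢ (B⊑F m₂) q≢ (B⊑F m₃) r≢
    -- The core has a second triple through xv, and domination leaves only z as its third vertex.
    neighbour : ∀ {x y z v} → Dom F x y z → Mem B x y v → v ≢ z → Mem B x z v
    neighbour d m v≢z with t , t≢y , n ← again (swap₂ B m) with d (B⊑F n)
    ... | inj₁ (inj₁ refl) = ⊥-elim (distinct₂₃ B m refl)
    ... | inj₁ (inj₂ refl) = ⊥-elim (v≢z refl)
    ... | inj₂ (inj₁ t≡y) = ⊥-elim (t≢y t≡y)
    ... | inj₂ (inj₂ refl) = swap₂ B n
    from : ∀ {x y z} → Mem B x y z → Dom F x y z → ∃[ Q ] Tetra B Q
    from {x} {y} {z} xyz d with v , v≢z , xyv ← again xyz =
      _ , tetra B xyz xyv xzv yzv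
      where
      xzv = neighbour d xyv v≢z
      yzv : Mem B y z v
      yzv with sharedB xyv | sharedB xzv
      ... | inj₂ (inj₁ e) | _ = swap₂ B (neighbour e (swap₁ B xyz) (≢-sym v≢z))
      ... | inj₂ (inj₂ e) | _ = rot B (neighbour e (rot′ B xzv) (≢-sym (distinct₂₃ B xyz)))
      ... | inj₁ _ | inj₂ (inj₁ e) = rot′ B (neighbour e (rot′ B xyz) (distinct₂₃ B xyv))
      ... | inj₁ _ | inj₂ (inj₂ e) = rev B (neighbour e (rot′ B xyv) (distinct₂₃ B xyz))
      -- Now xyz, xyv and xzv all fail at x. A pair in the link of x meets every two of y, z, v, so
      -- it is a side of the triangle yzv, and the degree of x is at most three.
      ... | inj₁ e | inj₁ f = ⊥-elim (few ((y , z) ∷ (y , v) ∷ (z , v) ∷ []) (support B xyz) cov ≤-refl)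
        where
        y≢z = distinct₂₃ B xyz
        y≢v = distinct₂₃ B xyv
        z≢v = distinct₂₃ B xzv
        cov : ∀ {s t} → Mem F x s t → Linked ((y , z) ∷ (y , v) ∷ (z , v) ∷ []) s t
        cov m with d m | e m | f m
        ... | inj₁ (inj₁ refl) | _ | inj₁ (inj₁ y≡z) = ⊥-elim (y≢z y≡z)
        ... | inj₁ (inj₁ refl) | _ | inj₁ (inj₂ y≡v) = ⊥-elim (y≢v y≡v)
        ... | inj₁ (inj₁ refl) | _ | inj₂ (inj₁ refl) = here (inj₁ (refl , refl))
        ... | inj₁ (inj₁ refl) | _ | inj₂ (inj₂ refl) = there (here (inj₁ (refl , refl)))
        ... | inj₁ (inj₂ refl) | inj₁ (inj₁ z≡y) | _ = ⊥-elim (y≢z (sym z≡y))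
        ... | inj₁ (inj₂ refl) | inj₁ (inj₂ z≡v) | _ = ⊥-elim (z≢v z≡v)
        ... | inj₁ (inj₂ refl) | inj₂ (inj₁ refl) | _ = here (inj₂ (refl , refl))
        ... | inj₁ (inj₂ refl) | inj₂ (inj₂ refl) | _ = there (there (here (inj₁ (refl , refl))))
        ... | inj₂ (inj₁ refl) | _ | inj₁ (inj₁ refl) = here (inj₂ (refl , refl))
        ... | inj₂ (inj₁ refl) | _ | inj₁ (inj₂ refl) = there (here (inj₂ (refl , refl)))
        ... | inj₂ (inj₁ refl) | _ | inj₂ (inj₁ y≡z) = ⊥-elim (y≢z y≡z)
        ... | inj₂ (inj₁ refl) | _ | inj₂ (inj₂ y≡v) = ⊥-elim (y≢v y≡v)
        ... | inj₂ (inj₂ refl) | inj₁ (inj₁ refl) | _ = here (inj₁ (refl , refl))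
        ... | inj₂ (inj₂ refl) | inj₁ (inj₂ refl) | _ = there (there (here (inj₂ (refl , refl))))
        ... | inj₂ (inj₂ refl) | inj₂ (inj₁ z≡y) | _ = ⊥-elim (y≢z (sym z≡y))
        ... | inj₂ (inj₂ refl) | inj₂ (inj₂ z≡v) | _ = ⊥-elim (z≢v z≡v)

  front : ∀ {H Q p} → Tetra H Q → p ∈ Q → ∃[ a ] ∃[ b ] ∃[ c ] Q ↭ p ∷ a ∷ b ∷ c ∷ []
  front t p∈ with extract p∈
  ... | a ∷ b ∷ c ∷ [] , q = a , b , c , q
  ... | [] , q = contradiction (≡.trans (sym (four t)) (↭-length q)) λ ()
  ... | _ ∷ [] , q = contradiction (≡.trans (sym (four t)) (↭-length q)) λ ()
  ... | _ ∷ _ ∷ [] , q = contradiction (≡.trans (sym (four t)) (↭-length q)) λ ()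
  ... | _ ∷ _ ∷ _ ∷ _ ∷ _ , q = contradiction (≡.trans (sym (four t)) (↭-length q)) λ ()

  faces : ∀ {H a b c d} → Tetra H (a ∷ b ∷ c ∷ d ∷ []) →
    Mem H a b c × Mem H a b d × Mem H a c d × Mem H b c d
  faces t with (a≢b ∷ a≢c ∷ a≢d ∷ []) ∷ (b≢c ∷ b≢d ∷ []) ∷ (c≢d ∷ []) ∷ [] ∷ [] ← unique t =
    cl (here refl) (there (here refl)) (there (there (here refl))) a≢b a≢c b≢c ,
    cl (here refl) (there (here refl)) (there (there (there (here refl)))) a≢b a≢d b≢d ,
    cl (here refl) (there (there (here refl))) (there (there (there (here refl)))) a≢c a≢d c≢d ,
    cl (there (here refl)) (there (there (here refl))) (there (there (there (here refl)))) b≢c b≢d c≢d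
    where cl = clique t

  -- The face of Q opposite to p fails to be shattered at its vertex x
  record Apex (Q : List A) (p x : A) : Set where
    field
      {y z} : A
      order : Q ↭ p ∷ x ∷ y ∷ z ∷ []
      dom : Dom F x y z

  open Apex

  -- Each pair of the face opposite p also lies in a face through p, so `shared` applies to that
  -- face.
  apex : ∀ {Q p} → Tetra F Q → p ∈ Q → ∃[ x ] Apex Q p x
  apex {Q} {p} t p∈ with a , b , c , o ← front t p∈
    with (p≢a ∷ p≢b ∷ p≢c ∷ []) ∷ (a≢b ∷ a≢c ∷ []) ∷ (b≢c ∷ []) ∷ [] ∷ [] ← unique (tetra-↭ o t)
    with pab , pac , pbc , abc ← faces (tetra-↭ o t)
    with shared abc (rot F pbc) p≢a (rot F pac) p≢b (rot F pab) p≢c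
  ... | inj₁ d = a , record { order = o ; dom = d }
  ... | inj₂ (inj₁ d) = b , record { order = ↭-trans o (prep p (swap a b refl)) ; dom = d }
  ... | inj₂ (inj₂ d) = c , record
    { order = ↭-trans o (prep p (↭-trans (prep a (swap b c refl)) (swap a c refl))) ; dom = d }

  -- The faces through w realise the traces {x} and {y} on vxy, and {x} and {z} on vxz, so both of
  -- these fail at v. A pair in the link of v then contains x or is yz, and domination at x leaves
  -- only the three sides of xyz.
  two-tetrahedra : ∀ {x y z v w} → Dom F x y z → Tetra F (v ∷ x ∷ y ∷ z ∷ []) →
    Tetra F (w ∷ x ∷ y ∷ z ∷ []) → v ≢ w → ⊥
  two-tetrahedra {x} {y} {z} {v} {w} d s t v≢w
    with (v≢x ∷ v≢y ∷ v≢z ∷ []) ∷ (x≢y ∷ x≢z ∷ []) ∷ (y≢z ∷ []) ∷ [] ∷ [] ← unique s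
       | (w≢x ∷ w≢y ∷ w≢z ∷ []) ∷ _ ← unique t
       | vxy , vxz , vyz , xyz ← faces s
       | wxy , wxz , wyz , _ ← faces t
    with shared vxy xyz (≢-sym v≢z) vyz (≢-sym x≢z) vxz (≢-sym y≢z)
       | shared vxz (swap₂ F xyz) (≢-sym v≢y) (swap₂ F vyz) (≢-sym x≢y) vxy y≢z
  ... | inj₂ (inj₁ e) | _ = dom-miss F e (rot F wxz) (≢-sym v≢z) (≢-sym y≢z) (≢-sym v≢w) w≢y
  ... | inj₂ (inj₂ e) | _ = dom-miss F e (rot F wyz) (≢-sym v≢z) (≢-sym x≢z) (≢-sym v≢w) w≢x
  ... | inj₁ _ | inj₂ (inj₁ e) = dom-miss F e (rot F wxy) (≢-sym v≢y) y≢z (≢-sym v≢w) w≢z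
  ... | inj₁ _ | inj₂ (inj₂ e) = dom-miss F e (rot F (swap₂ F wyz)) (≢-sym v≢y) (≢-sym x≢y) (≢-sym v≢w) w≢x
  ... | inj₁ e | inj₁ f = few ((x , y) ∷ (x , z) ∷ (y , z) ∷ []) (support F vxy) cov ≤-refl
    where
    cov : ∀ {s t} → Mem F v s t → Linked ((x , y) ∷ (x , z) ∷ (y , z) ∷ []) s t
    through-x : ∀ {t} → Mem F v x t → Linked ((x , y) ∷ (x , z) ∷ (y , z) ∷ []) x t
    through-x m with d (swap₁ F m)
    ... | inj₁ (inj₁ v≡y) = ⊥-elim (v≢y v≡y)
    ... | inj₁ (inj₂ v≡z) = ⊥-elim (v≢z v≡z)
    ... | inj₂ (inj₁ refl) = here (inj₁ (refl , refl))
    ... | inj₂ (inj₂ refl) = there (here (inj₁ (refl , refl)))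
    cov m with e m | f m
    ... | inj₁ (inj₁ refl) | _ = through-x m
    ... | inj₂ (inj₁ refl) | _ = linked-sym (through-x (swap₂ F m))
    ... | _ | inj₁ (inj₁ refl) = through-x m
    ... | _ | inj₂ (inj₁ refl) = linked-sym (through-x (swap₂ F m))
    ... | inj₁ (inj₂ refl) | inj₁ (inj₂ y≡z) = ⊥-elim (y≢z y≡z)
    ... | inj₁ (inj₂ refl) | inj₂ (inj₂ refl) = there (there (here (inj₁ (refl , refl))))
    ... | inj₂ (inj₂ refl) | inj₁ (inj₂ refl) = there (there (here (inj₂ (refl , refl))))
    ... | inj₂ (inj₂ refl) | inj₂ (inj₂ y≡z) = ⊥-elim (y≢z y≡z)

  -- The link of x in `Q′` is a triangle, and a single vertex cannot meet all its sides. So both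
  -- ends of the dominating pair lie in `Q′`, and the two tetrahedra share the face at x.
  apex-determines : ∀ {Q Q′ p x} → Tetra F Q → Tetra F Q′ → Apex Q p x → x ∈ Q′ → Q ↭ Q′
  apex-determines {Q} {Q′} {p} {x} s t ap x∈ with a , b , c , o ← front t x∈ =
    ↭-trans (Apex.order ap) (↭-trans (all-edges o) (↭-sym o))
    where
    open Apex ap using () renaming (y to y₁; z to z₁; dom to d₁)
    s′ = tetra-↭ (Apex.order ap) s
    link : ∀ {a b c} → Q′ ↭ x ∷ a ∷ b ∷ c ∷ [] → Mem F x b c × Unique (x ∷ a ∷ b ∷ c ∷ [])
    link o = proj₁ (proj₂ (proj₂ (faces (tetra-↭ o t)))) , unique (tetra-↭ o t)
    yz : ∀ {w} → Q′ ↭ x ∷ y₁ ∷ z₁ ∷ w ∷ [] → p ∷ x ∷ y₁ ∷ z₁ ∷ [] ↭ x ∷ y₁ ∷ z₁ ∷ w ∷ []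
    yz {w} o with p ≟ w
    ... | yes refl = ↭-sym (shift p (x ∷ y₁ ∷ z₁ ∷ []) [])
    ... | no p≢w = ⊥-elim (two-tetrahedra d₁ s′
            (tetra-↭ (↭-trans o (shift w (x ∷ y₁ ∷ z₁ ∷ []) [])) t) p≢w)
    mid : ∀ {a b : A} {xs} → x ∷ a ∷ b ∷ xs ↭ x ∷ b ∷ a ∷ xs
    mid = prep _ (swap _ _ refl)
    end : ∀ {a b c : A} → x ∷ a ∷ b ∷ c ∷ [] ↭ x ∷ a ∷ c ∷ b ∷ []
    end = prep _ (prep _ (swap _ _ refl))
    via : ∀ {xs ys} → (Q′ ↭ ys → p ∷ x ∷ y₁ ∷ z₁ ∷ [] ↭ ys) → xs ↭ ys →
      Q′ ↭ xs → p ∷ x ∷ y₁ ∷ z₁ ∷ [] ↭ xs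
    via f q o = ↭-trans (f (↭-trans o q)) (↭-sym q)
    from-y : ∀ {b c} → Q′ ↭ x ∷ y₁ ∷ b ∷ c ∷ [] → p ∷ x ∷ y₁ ∷ z₁ ∷ [] ↭ x ∷ y₁ ∷ b ∷ c ∷ []
    from-y o with bc , _ ∷ (y≢b ∷ y≢c ∷ []) ∷ _ ← link o with d₁ bc
    ... | inj₁ (inj₁ b≡y) = ⊥-elim (y≢b (sym b≡y))
    ... | inj₁ (inj₂ refl) = yz o
    ... | inj₂ (inj₁ c≡y) = ⊥-elim (y≢c (sym c≡y))
    ... | inj₂ (inj₂ refl) = via yz end o
    from-z : ∀ {b c} → Q′ ↭ x ∷ z₁ ∷ b ∷ c ∷ [] → p ∷ x ∷ y₁ ∷ z₁ ∷ [] ↭ x ∷ z₁ ∷ b ∷ c ∷ []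
    from-z o with bc , _ ∷ (z≢b ∷ z≢c ∷ []) ∷ _ ← link o with d₁ bc
    ... | inj₁ (inj₁ refl) = via yz mid o
    ... | inj₁ (inj₂ b≡z) = ⊥-elim (z≢b (sym b≡z))
    ... | inj₂ (inj₁ refl) = via (via yz mid) end o
    ... | inj₂ (inj₂ c≡z) = ⊥-elim (z≢c (sym c≡z))
    all-edges : ∀ {a b c} → Q′ ↭ x ∷ a ∷ b ∷ c ∷ [] → p ∷ x ∷ y₁ ∷ z₁ ∷ [] ↭ x ∷ a ∷ b ∷ c ∷ []
    all-edges o with d₁ (proj₁ (link o))
    ... | inj₁ (inj₁ refl) = via from-y mid o
    ... | inj₁ (inj₂ refl) = via from-z mid o
    ... | inj₂ (inj₁ refl) = via from-y (↭-trans end mid) o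
    ... | inj₂ (inj₂ refl) = via from-z (↭-trans end mid) o

  private
    apex-∈ : ∀ {Q p x} → Apex Q p x → x ∈ Q
    apex-∈ ap = ∈-resp-↭ (↭-sym (order ap)) (there (here refl))

    base-∈ : ∀ {Q p x w} (ap : Apex Q p x) → w ≡ y ap ⊎ w ≡ z ap → w ∈ Q
    base-∈ ap (inj₁ refl) = ∈-resp-↭ (↭-sym (order ap)) (there (there (here refl)))
    base-∈ ap (inj₂ refl) = ∈-resp-↭ (↭-sym (order ap)) (there (there (there (here refl))))

  -- An apex of one tetrahedron never lies in the other, so a triple that covers two apices has its
  -- third vertex in both bases. If all such pairs were covered, the tetrahedra would share more and
  -- more vertices, until some face of `Q` had no room for its apex.
  uncovered-pair : ∀ {Q Q′} → Tetra F Q → Tetra F Q′ → ¬ (Q ↭ Q′) →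
    ∃[ x ] ∃[ q ] ∃[ s ] x ∈ Q × Apex Q′ q s × (∀ {t} → ¬ Mem F x s t)
  uncovered-pair {[]} t t′ Q≢Q′ = contradiction (four t) λ ()
  uncovered-pair {_ ∷ _} {[]} t t′ Q≢Q′ = contradiction (four t′) λ ()
  uncovered-pair {Q@(_ ∷ _)} {Q′@(_ ∷ _)} t t′ Q≢Q′
    with x₀ , ap₀ ← apex t (here refl) | s₀ , aq₀ ← apex t′ (here refl) = step₀
    where
    Goal = ∃[ x ] ∃[ q ] ∃[ s ] x ∈ Q × Apex Q′ q s × (∀ {t} → ¬ Mem F x s t)
    apart : ∀ {p x} → Apex Q p x → ¬ x ∈ Q′
    apart ap x∈ = Q≢Q′ (apex-determines t t′ ap x∈)
    apart′ : ∀ {q s} → Apex Q′ q s → ¬ s ∈ Q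
    apart′ aq s∈ = Q≢Q′ (↭-sym (apex-determines t′ t aq s∈))
    common : ∀ {p x q s w} (ap : Apex Q p x) (aq : Apex Q′ q s) → Mem F x s w →
      (w ≡ y ap ⊎ w ≡ z ap) × (w ≡ y aq ⊎ w ≡ z aq)
    common ap aq m =
      [ (λ e → ⊥-elim (apart′ aq (base-∈ ap e))) , id ]′ (dom ap m) ,
      [ (λ e → ⊥-elim (apart ap (base-∈ aq e))) , id ]′ (dom aq (swap₁ F m))
    covered : ∀ {p x q s} (ap : Apex Q p x) (aq : Apex Q′ q s) →
      Goal ⊎ ∃[ w ] (w ≡ y ap ⊎ w ≡ z ap) × (w ≡ y aq ⊎ w ≡ z aq) × Mem F x s w
    covered {p} {x} {q} {s} ap aq with any? (mem? F x s) vs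
    ... | yes c = let w , _ , m = find c in
      inj₂ (w , proj₁ (common ap aq m) , proj₂ (common ap aq m) , m)
    ... | no ¬c = inj₁ (x , q , s , apex-∈ ap , aq , λ m → ¬c (lose (support F (rot′ F m)) m))
    opposite-∉-base : ∀ {H R p x} → Tetra H R → (ap : Apex R p x) → ¬ (p ≡ y ap ⊎ p ≡ z ap)
    opposite-∉-base t ap e with (_ ∷ p≢y ∷ p≢z ∷ []) ∷ _ ← unique (tetra-↭ (order ap) t) = [ p≢y , p≢z ]′ e
    -- Here `Q` consists of p, x, q, r, and p and q lie in `Q′`. The apex of the face opposite r is
    -- outside `Q′`, so it can only be x; but then the triple xsr puts r into the base of the face
    -- opposite r.
    step₃ : ∀ {p x q s r} → p ∈ Q′ → q ∈ Q′ → r ∈ Q → (ap : Apex Q p x) →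
      (q ≡ y ap ⊎ q ≡ z ap) → (r ≡ y ap ⊎ r ≡ z ap) → q ≢ r → (aq : Apex Q′ q s) → Mem F x s r → Goal
    step₃ {p} {x} {q} {s} {r} p∈ q∈ r∈ ap q∈ap r∈ap q≢r aq m
      with x′ , ap′ ← apex t r∈
      with ∈-resp-↭ (order ap) (apex-∈ ap′) | unique (tetra-↭ (order ap′) t)
    ... | here refl | _ = ⊥-elim (apart ap′ p∈)
    ... | there (here refl) | _ = ⊥-elim (opposite-∉-base t ap′ (proj₁ (common ap′ aq m)))
    ... | there (there (here refl)) | (r≢x′ ∷ _) ∷ _ = ⊥-elim (other q∈ap r∈ap)
      where
      other : (q ≡ x′ ⊎ q ≡ z ap) → (r ≡ x′ ⊎ r ≡ z ap) → ⊥
      other (inj₁ refl) _ = apart ap′ q∈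
      other (inj₂ refl) (inj₁ r≡) = r≢x′ r≡
      other (inj₂ q≡) (inj₂ r≡) = q≢r (≡.trans q≡ (sym r≡))
    ... | there (there (there (here refl))) | (r≢x′ ∷ _) ∷ _ = ⊥-elim (other q∈ap r∈ap)
      where
      other : (q ≡ y ap ⊎ q ≡ x′) → (r ≡ y ap ⊎ r ≡ x′) → ⊥
      other (inj₂ refl) _ = apart ap′ q∈
      other (inj₁ q≡) (inj₁ r≡) = q≢r (≡.trans q≡ (sym r≡))
      other (inj₁ refl) (inj₂ r≡) = r≢x′ r≡
    step₂ : ∀ {p x q} → p ∈ Q′ → q ∈ Q′ → (ap : Apex Q p x) → (q ≡ y ap ⊎ q ≡ z ap) → Goal
    step₂ p∈ q∈ ap q∈ap with s₁ , aq ← apex t′ q∈ with covered ap aq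
    ... | inj₁ g = g
    ... | inj₂ (r , r∈ap , r∈aq , m) =
      step₃ p∈ q∈ (base-∈ ap r∈ap) ap q∈ap r∈ap (λ where refl → opposite-∉-base t′ aq r∈aq) aq m
    step₁ : ∀ {p} → p ∈ Q → p ∈ Q′ → Goal
    step₁ p∈Q p∈Q′ with x₁ , ap ← apex t p∈Q with covered ap aq₀
    ... | inj₁ g = g
    ... | inj₂ (q , q∈ap , q∈aq , m) = step₂ p∈Q′ (base-∈ aq₀ q∈aq) ap q∈ap
    step₀ : Goal
    step₀ with covered ap₀ aq₀
    ... | inj₁ g = g
    ... | inj₂ (p , p∈ap , p∈aq , m) = step₁ (base-∈ ap₀ p∈ap) (base-∈ aq₀ p∈aq)

  -- Every further tetrahedron leaves a new pair uncovered, so deleting one of its faces and that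
  -- pair keeps the surplus, and the process would never end.
  private
    descend : ∀ {Q₁} → Tetra F Q₁ → ∀ k (H : TripleSystem vs) E ss → length E ≤ k → H ⊑ F →
      F CoveredBy E → Connected vs E → length E + 1 < size H + length vs → ¬ Clique H Q₁ →
      (∀ {s} → s ∈ ss → s ∉ Q₁) → (∀ {s} → s ∈ ss → ∀ {Q} → Tetra H Q → s ∉ Q) →
      (∀ {s t} → s ∈ vs → t ∈ vs → s ∉ ss → t ∉ ss → s ≢ t → Linked E s t) → ⊥
    descend {Q₁} t₁ k H E ss le H⊑F cov conn lt ¬Q₁ off-Q₁ off links
      with B , B⊑H , c ← core u H E (cov ∘ H⊑F) conn lt
      with Q , tB ← core-tetra (H⊑F ∘ B⊑H) c = go k le
      where
      tH : Tetra H Q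
      tH = tetra-⊑ B⊑H tB
      t : Tetra F Q
      t = tetra-⊑ H⊑F tH
      Q₁≢Q : ¬ (Q₁ ↭ Q)
      Q₁≢Q p = ¬Q₁ (clique (tetra-↭ (↭-sym p) tH))
      go : ∀ k → length E ≤ k → ⊥
      go k le with uncovered-pair t₁ t Q₁≢Q
      ... | x , q , s , x∈ , aq , unc = last k le
        where
        s∉Q₁ : s ∉ Q₁
        s∉Q₁ s∈ = Q₁≢Q (↭-sym (apex-determines t t₁ aq s∈))
        -- Vertices in `ss` lie in no tetrahedron of `H`. Hence s has not been used before, and the
        -- pair xs is still available in `E`.
        s∉ss : s ∉ ss
        s∉ss s∈ = off s∈ tH (apex-∈ aq)
        fs = faces (tetra-↭ (order aq) tH)
        face : Mem H s (y aq) (z aq)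
        face = proj₂ (proj₂ (proj₂ fs))
        s∈vs : s ∈ vs
        s∈vs = support H face
        Q₁⊆vs : ∀ {w} → w ∈ Q₁ → w ∈ vs
        Q₁⊆vs w∈ with a , b , c , o ← front t₁ w∈ = support F (proj₁ (faces (tetra-↭ o t₁)))
        x≢s : x ≢ s
        x≢s refl = s∉Q₁ x∈
        Q₁∩ss : ∀ {w} → w ∈ Q₁ → w ∉ ss
        Q₁∩ss w∈ w∈ss = off-Q₁ w∈ss w∈
        link : ∀ {w} → w ∈ Q₁ → w ≢ s → Linked E w s
        link w∈ w≢s = links (Q₁⊆vs w∈) s∈vs (Q₁∩ss w∈) s∉ss w≢s
        H′ = H ∖ (s , y aq , z aq)
        E′ = E without (x , s)
        last : ∀ k → length E ≤ k → ⊥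
        last zero le = contradiction (≤-trans (length-without (link x∈ x≢s)) le) λ ()
        last (suc k) le with a , b , c , o ← front t₁ x∈ =
          descend t₁ k H′ E′ (s ∷ ss) (s≤s⁻¹ (≤-trans (length-without (link x∈ x≢s)) le))
            (H⊑F ∘ proj₁)
            (λ m → linked-without (cov m) λ where
              (inj₁ (refl , refl)) → unc m
              (inj₂ (refl , refl)) → unc (swap₁ F m))
            (connected-without a conn
              (linked-without (links (Q₁⊆vs x∈) (Q₁⊆vs a∈) (Q₁∩ss x∈) (Q₁∩ss a∈) (distinct F xab)) λ where
                (inj₁ (_ , refl)) → s∉Q₁ a∈
                (inj₂ (refl , _)) → s∉Q₁ x∈)
              (linked-without (link a∈ λ where refl → s∉Q₁ a∈) λ where
                (inj₁ (refl , _)) → distinct F xab refl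
                (inj₂ (refl , _)) → s∉Q₁ a∈))
            (shrink (length-without (link x∈ x≢s)) (size-∖ H u face) lt)
            (λ cl → ¬Q₁ λ p∈ q∈ r∈ p≢q p≢r q≢r → proj₁ (cl p∈ q∈ r∈ p≢q p≢r q≢r))
            (λ where (here refl) → s∉Q₁
                     (there w∈) → off-Q₁ w∈)
            (λ where
              -- By `apex-determines` a tetrahedron through s is `Q` itself, which has just lost a
              -- face.
              (here refl) tQ s∈Q → ∖-∌ H (proj₂ (proj₂ (proj₂ (faces (tetra-↭
                (↭-trans (↭-sym (apex-determines t (tetra-⊑ (H⊑F ∘ proj₁) tQ) aq s∈Q)) (order aq)) tQ)))))
              (there w∈) tQ → off w∈ (tetra-⊑ proj₁ tQ))
            (λ where
              s∈ t∈ s∉ t∉ s≢t → linked-without (links s∈ t∈ (s∉ ∘ there) (t∉ ∘ there) s≢t) λ where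
                (inj₁ (_ , refl)) → t∉ (here refl)
                (inj₂ (refl , _)) → s∉ (here refl))
          where
          xab = proj₁ (faces (tetra-↭ o t₁))
          a∈ : a ∈ Q₁
          a∈ = ∈-resp-↭ (↭-sym o) (there (here refl))

  -- One unit of surplus pays for a face of the first tetrahedron, so that it is gone from `H`; the
  -- other one starts the descent.
  surplus≤1 : ¬ (length (pairs vs) + 2 < size F + length vs)
  surplus≤1 lt with B , B⊑F , c ← core u F (pairs vs) (pairs-covering F) pairs-connected
                      (≤-trans (s≤s (+-monoʳ-≤ _ (s≤s z≤n))) lt)
    with core-tetra B⊑F c
  ... | [] , tB = contradiction (four tB) λ ()
  ... | Q@(p ∷ _) , tB with t ← tetra-⊑ B⊑F tB with a , b , c , o ← front t (here refl)
    with abc , _ ← faces (tetra-↭ o t) =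
    descend t _ (F ∖ (p , a , b)) (pairs vs) [] ≤-refl proj₁ (pairs-covering F) pairs-connected
      (s≤s⁻¹ (≤-trans (≤-reflexive (cong suc (sym (+-suc (length (pairs vs)) 1))))
        (≤-trans lt (+-monoˡ-≤ (length vs) (size-∖ F u abc)))))
      (λ cl → ∖-∌ F (proj₁ (faces {F ∖ (p , a , b)} (tetra-↭ o
        (record { unique = unique t ; four = four t ; clique = λ {p} → cl {p} })))))
      (λ ()) (λ ()) (λ s∈ t∈ _ _ s≢t → pairs-linked s∈ t∈ s≢t)

-- Refutation by case analysis on a bounded number of vertices: a triple is either absent, or it is
-- present with one of its traces missing.  A branch ends with a conflict, or with too few triples left.

-- i ▹ ts splits on the triple with index i: the first subtree is for its absence, the others are for its
-- missing traces in the order of patterns, and omitted subtrees stand for ·, the end of a branch.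

data Tree : Set where
  · : Tree
  _▹_ : ℕ → List Tree → Tree

infixr 6 _▹_

data Status : Set where
  undecided present absent : Status

data Fact (n : ℕ) : Set where
  has : Triple n → Fact n
  lacks : Triple n → Bool × Bool × Bool → Fact n

-- spare bounds the number of triples that may be absent
module Search (n spare : ℕ) where

  V³ : Set
  V³ = Triple n

  State : Set
  State = List Status

  set : Status → Maybe State → Maybe State
  set s = Maybe.map (s ∷_)

  include : ℕ → State → Maybe State
  include zero (absent ∷ st) = nothing
  include zero (_ ∷ st) = just (present ∷ st)
  include (suc i) (s ∷ st) = set s (include i st)
  include _ [] = just []

  drop : ℕ → State → Maybe State
  drop zero (present ∷ st) = nothing
  drop zero (_ ∷ st) = just (absent ∷ st)
  drop (suc i) (s ∷ st) = set s (drop i st)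
  drop _ [] = just []

  affirm : V³ → List V³ → State → Maybe State
  affirm G (H ∷ L) (s ∷ st) with equals G H | s
  ... | false | s = set s (affirm G L st)
  ... | true | absent = nothing
  ... | true | _ = set present (affirm G L st)
  affirm G _ st = just st

  -- Given the codes of the traces of all triples on a fixed one, forbid the trace with code c
  forbid : ℕ → List ℕ → State → Maybe State
  forbid c (d ∷ ds) (s ∷ st) with c Nat.≡ᵇ d | s
  ... | false | s = set s (forbid c ds st)
  ... | true | present = nothing
  ... | true | _ = set absent (forbid c ds st)
  forbid c _ st = just st

  absents : State → ℕ
  absents [] = 0
  absents (absent ∷ st) = suc (absents st)
  absents (_ ∷ st) = absents st

  nth : ℕ → List V³ → Maybe V³
  nth _ [] = nothing
  nth zero (G ∷ _) = just G
  nth (suc i) (_ ∷ L) = nth i L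

  module _ (L : List V³) where

    -- An argument rather than a local definition, so that the list of codes is evaluated once
    forbids : List ℕ → Maybe State → List (Maybe State)
    forbids ds st = map (λ b → st >>= forbid (encode b) ds) patterns

    branches : ℕ → V³ → State → List (Maybe State)
    branches i G st = drop i st ∷ forbids (map (code G) L) (include i st)

    refutes : Tree → Maybe State → Bool
    refutesAll : List Tree → List (Maybe State) → Bool

    refutes _ nothing = true
    refutes · (just st) = spare <ᵇ absents st
    refutes (i ▹ ts) (just st) with nth i L
    ... | nothing = false
    ... | just G = refutesAll ts (branches i G st)

    refutesAll ts [] = true
    refutesAll [] (st ∷ sts) = refutes · st ∧ refutesAll [] sts
    refutesAll (t ∷ ts) (st ∷ sts) = refutes t st ∧ refutesAll ts sts

    assume : List (Fact n) → Maybe State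
    assume [] = just (map (λ _ → undecided) L)
    assume (has G ∷ fs) = assume fs >>= affirm G L
    assume (lacks G b ∷ fs) = assume fs >>= forbid (encode b) (map (code G) L)

-- The letter α stands for the triples auv and buv, the letter β for all triples formed by two of a,
-- b, c and one of u, v. The index tells which traces are missing, up to the symmetries of the
-- configuration.
data Shape : Set where
  α₁ α₂ α₃ α₄ β₁ β₂ β₃ : Shape

nowhere only₁ : Bool × Bool × Bool
nowhere = false , false , false
only₁ = true , false , false

-- With the vertices a, b, c, u, v numbered 0, 1, 2, 3, 4
facts : ∀ m → Shape → List (Fact (5 + m))
facts m s = lacks (0F , 1F , 2F) nowhere ∷ has (0F , 1F , 2F) ∷ more s
  where
  edges prisms : List (Fact (5 + m)) → List (Fact (5 + m))
  edges fs = has (0F , 3F , 4F) ∷ has (1F , 3F , 4F) ∷ fs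
  prisms fs = has (0F , 1F , 3F) ∷ has (0F , 2F , 3F) ∷ has (1F , 2F , 3F) ∷
              has (0F , 1F , 4F) ∷ has (0F , 2F , 4F) ∷ has (1F , 2F , 4F) ∷ fs
  more : Shape → List (Fact (5 + m))
  more α₁ = edges (lacks (0F , 3F , 4F) nowhere ∷ lacks (1F , 3F , 4F) nowhere ∷ [])
  more α₂ = edges (lacks (0F , 3F , 4F) nowhere ∷ lacks (3F , 1F , 4F) only₁ ∷ [])
  more α₃ = edges (lacks (3F , 0F , 4F) only₁ ∷ lacks (3F , 1F , 4F) only₁ ∷ [])
  more α₄ = edges (lacks (3F , 0F , 4F) only₁ ∷ lacks (4F , 1F , 3F) only₁ ∷ [])
  more β₁ = prisms (lacks (0F , 1F , 3F) nowhere ∷ lacks (0F , 1F , 4F) nowhere ∷ [])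
  more β₂ = prisms (lacks (0F , 1F , 3F) nowhere ∷ lacks (4F , 0F , 1F) only₁ ∷ [])
  more β₃ = prisms (lacks (3F , 0F , 1F) only₁ ∷ lacks (4F , 0F , 1F) only₁ ∷ [])

-- Soundness of the search

module Refute {A : Set} (_≟_ : DecidableEquality A) {vs}
  (F : Systems.TripleSystem _≟_ vs) (good : Systems.Good _≟_ F) {xs : List A} (u : Unique xs) where

  open Systems _≟_
  open TripleSystem

  open Named F u using (Mem′; trace-lookup)

  Lacks : Triple (length xs) → Bool × Bool × Bool → Set
  Lacks (i , j , k) = Missing F (lookup xs i , lookup xs j , lookup xs k)

  Valid : Fact (length xs) → Set
  Valid (has G) = Mem′ G
  Valid (lacks G b) = Lacks G b

  module _ {spare : ℕ} (enough : length (triples (allFin (length xs))) ≤ #₃ (mem? F) xs + spare) where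
    open Search (length xs) spare

    L : List V³
    L = triples (allFin (length xs))

    private
      mem′? : ∀ G → Dec (Mem′ G)
      mem′? (i , j , k) = mem? F (lookup xs i) (lookup xs j) (lookup xs k)

      Holds : V³ → Status → Set
      Holds G undecided = ⊤
      Holds G present = Mem′ G
      Holds G absent = ¬ Mem′ G

      Sat : List V³ → State → Set
      Sat = Pointwise Holds

      data Sat? (L : List V³) : Maybe State → Set where
        just : ∀ {st} → Sat L st → Sat? L (just st)

      set-sound : ∀ {L G s st} → Holds G s → Sat? L st → Sat? (G ∷ L) (set s st)
      set-sound h (just p) = just (h ∷ p)

      lacks-sound : ∀ G {b} → Lacks G b → ∀ {H} → trace Fin._≟_ G H ≡ b → ¬ Mem′ H
      lacks-sound (i , j , k) miss {r , s , t} eq m = miss m (≡.trans (trace-lookup i j k r s t) eq)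

      affirm-sound : ∀ {G} → Mem′ G → ∀ {L st} → Sat L st → Sat? L (affirm G L st)
      affirm-sound m [] = just []
      affirm-sound {G} m {H ∷ L} {s ∷ st} (h ∷ p) with equals G H in eq | s
      ... | false | s = set-sound h (affirm-sound m p)
      ... | true | absent = ⊥-elim (h (subst Mem′ (equals-≡ G H eq) m))
      ... | true | present = set-sound h (affirm-sound m p)
      ... | true | undecided = set-sound (subst Mem′ (equals-≡ G H eq) m) (affirm-sound m p)

      include-sound : ∀ {G} → Mem′ G → ∀ i {L st} → nth i L ≡ just G → Sat L st → Sat? L (include i st)
      include-sound m i eq [] = contradiction eq λ ()
      include-sound m zero {st = absent ∷ _} refl (h ∷ p) = ⊥-elim (h m)
      include-sound m zero {st = present ∷ _} refl (h ∷ p) = just (m ∷ p)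
      include-sound m zero {st = undecided ∷ _} refl (h ∷ p) = just (m ∷ p)
      include-sound m (suc i) eq (h ∷ p) = set-sound h (include-sound m i eq p)

      drop-sound : ∀ {G} → ¬ Mem′ G → ∀ i {L st} → nth i L ≡ just G → Sat L st → Sat? L (drop i st)
      drop-sound ¬m i eq [] = contradiction eq λ ()
      drop-sound ¬m zero {st = absent ∷ _} refl (h ∷ p) = just (¬m ∷ p)
      drop-sound ¬m zero {st = present ∷ _} refl (h ∷ p) = ⊥-elim (¬m h)
      drop-sound ¬m zero {st = undecided ∷ _} refl (h ∷ p) = just (¬m ∷ p)
      drop-sound ¬m (suc i) eq (h ∷ p) = set-sound h (drop-sound ¬m i eq p)

      forbid-sound : ∀ G {b} → Lacks G b → ∀ {L st} → Sat L st → Sat? L (forbid (encode b) (map (code G) L) st)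
      forbid-sound G miss [] = just []
      forbid-sound G {b} miss {H ∷ L} {s ∷ st} (h ∷ q) with encode b Nat.≡ᵇ code G H in eq | s
      ... | false | s = set-sound h (forbid-sound G miss q)
      ... | true | present = ⊥-elim (lacks-sound G miss (code-≡ G b H eq) h)
      ... | true | absent = set-sound h (forbid-sound G miss q)
      ... | true | undecided = set-sound (lacks-sound G miss (code-≡ G b H eq)) (forbid-sound G miss q)

      >>=-sound : ∀ {L st} {f : State → Maybe State} → Sat? L st → (∀ {st} → Sat L st → Sat? L (f st)) →
        Sat? L (st >>= f)
      >>=-sound (just p) g = g p

      -- A member of the family misses one of the eight patterns, so absence and the eight missing
      -- traces exhaust the possibilities.
      branches-sound : ∀ i {G st} → nth i L ≡ just G → Sat L st → Any (Sat? L) (branches L i G st)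
      branches-sound i {G} {st} eq p = go (mem′? G)
        where
        go : Dec (Mem′ G) → Any (Sat? L) (branches L i G st)
        go (no ¬m) = here (drop-sound ¬m i eq p)
        go (yes m) = let b , miss = good m in
          there (map⁺ {f = branch} (lose {P = λ b → Sat? L (branch b)} (∈-patterns b)
            (>>=-sound {f = forbid (encode b) (map (code G) L)} (include-sound m i eq p) (forbid-sound G miss))))
          where
          branch = λ b → include i st >>= forbid (encode b) (map (code G) L)

      -- Together with `enough` this bounds the number of absent triples by `spare`, which
      -- contradicts the test at the end of a branch.
      count : ∀ {L st} → Sat L st → #₁ mem′? L + absents st ≤ length L
      count [] = z≤n
      count {G ∷ L} {undecided ∷ st} (h ∷ p) =
        ≤-trans (≤-reflexive (+-assoc ⟦ mem′? G ⟧ _ _)) (+-mono-≤ (⟦⟧≤1 (mem′? G)) (count p))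
      count {G ∷ L} {present ∷ st} (h ∷ p) =
        ≤-trans (≤-reflexive (+-assoc ⟦ mem′? G ⟧ _ _)) (+-mono-≤ (⟦⟧≤1 (mem′? G)) (count p))
      count {G ∷ L} {absent ∷ st} (h ∷ p) rewrite ⟦⟧-no (mem′? G) h =
        ≤-trans (≤-reflexive (+-suc _ _)) (s≤s (count p))

      size-L : #₃ (mem? F) xs ≡ #₁ mem′? L
      size-L = begin
        #₃ (mem? F) xs                                   ≡⟨ cong (#₃ (mem? F)) (sym names) ⟩
        #₃ (mem? F) (map (lookup xs) (allFin _))         ≡⟨ #₃-map (mem? F) (lookup xs) (allFin _) ⟩
        #₃ (λ i j k → mem′? (i , j , k)) (allFin _)      ≡⟨ #₃-triples (λ i j k → mem′? (i , j , k)) (allFin _) ⟩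
        #₁ mem′? L                                       ∎
        where
        open ≡-Reasoning
        names : map (lookup xs) (allFin _) ≡ xs
        names = ≡.trans (map-tabulate id (lookup xs)) (tabulate-lookup xs)

      T-∧-split : ∀ x {y} → T (x ∧ y) → T x × T y
      T-∧-split true r = tt , r

      refutes-sound : ∀ t {st} → T (refutes L t st) → ¬ Sat? L st
      refutesAll-sound : ∀ ts {sts} → T (refutesAll L ts sts) → ¬ Any (Sat? L) sts

      refutes-sound · r (just {st} p) = <⇒≱ (<ᵇ⇒< _ _ r) (+-cancelˡ-≤ (#₁ mem′? L) _ _
        (≤-trans (count p) (≤-trans enough (+-monoˡ-≤ spare (≤-reflexive size-L)))))
      refutes-sound (i ▹ ts) r (just p) with nth i L in eq
      ... | just G = refutesAll-sound ts r (branches-sound i eq p)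

      refutesAll-sound [] {st ∷ sts} r (here p) = refutes-sound · (proj₁ (T-∧-split (refutes L · st) r)) p
      refutesAll-sound [] {st ∷ sts} r (there a) = refutesAll-sound [] (proj₂ (T-∧-split (refutes L · st) r)) a
      refutesAll-sound (t ∷ ts) {st ∷ sts} r (here p) = refutes-sound t (proj₁ (T-∧-split (refutes L t st) r)) p
      refutesAll-sound (t ∷ ts) {st ∷ sts} r (there a) = refutesAll-sound ts (proj₂ (T-∧-split (refutes L t st) r)) a

    private
      assume-sound : ∀ {fs} → All Valid fs → Sat? L (assume L fs)
      assume-sound [] = just (trivial L)
        where
        trivial : ∀ L → Sat L (map (λ _ → undecided) L)
        trivial [] = []
        trivial (_ ∷ L) = tt ∷ trivial L
      assume-sound {has G ∷ fs} (m ∷ ps) = >>=-sound (assume-sound ps) (affirm-sound m)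
      assume-sound {lacks G b ∷ fs} (miss ∷ ps) = >>=-sound (assume-sound ps) (forbid-sound G miss)

    refute : ∀ t fs → All Valid fs → T (refutes L t (assume L fs)) → ⊥
    refute t fs ps r = refutes-sound t r (assume-sound ps)

-- Found by computer search
tree₆ : Shape → Tree
tree₆ α₁ = 
  4 ▹ ((5 ▹ ((3 ▹ ((1 ▹ []) ∷ (1 ▹ []) ∷ [])) ∷ (1 ▹ ((2 ▹ []) ∷ (2 ▹ []) ∷ [])) ∷ · ∷ (1 ▹
  []) ∷ [])) ∷ (11 ▹ ((2 ▹ ((3 ▹ []) ∷ (3 ▹ []) ∷ [])) ∷ (1 ▹ ((2 ▹ []) ∷ (2 ▹ []) ∷ [])) ∷
  [])) ∷ (1 ▹ []) ∷ (15 ▹ ((2 ▹ []) ∷ · ∷ · ∷ · ∷ · ∷ · ∷ · ∷ (2 ▹ []) ∷ [])) ∷ · ∷ · ∷ · ∷ (8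
  ▹ []) ∷ [])
tree₆ α₂ = 6 ▹ ((1 ▹ []) ∷ · ∷ · ∷ · ∷ · ∷ · ∷ · ∷ (5 ▹ []) ∷ [])
tree₆ α₃ = 1 ▹ []
tree₆ α₄ = ·
tree₆ β₁ = 
  4 ▹ (· ∷ (10 ▹ (· ∷ (5 ▹ (· ∷ (7 ▹ []) ∷ · ∷ · ∷ (7 ▹ []) ∷ [])) ∷ · ∷ · ∷ (5 ▹ []) ∷ [])) ∷
  · ∷ · ∷ (10 ▹ (· ∷ (7 ▹ []) ∷ [])) ∷ [])
tree₆ β₂ = 
  4 ▹ (· ∷ (10 ▹ (· ∷ (5 ▹ (· ∷ (7 ▹ []) ∷ · ∷ · ∷ (8 ▹ []) ∷ [])) ∷ · ∷ · ∷ (5 ▹ []) ∷ [])) ∷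
  · ∷ · ∷ (10 ▹ (· ∷ (8 ▹ []) ∷ [])) ∷ [])
tree₆ β₃ = 4 ▹ (· ∷ (10 ▹ (· ∷ (5 ▹ []) ∷ [])) ∷ · ∷ · ∷ (9 ▹ []) ∷ [])

tree₇ : Shape → Tree
tree₇ α₁ = 
  25 ▹ ((5 ▹ ((6 ▹ ((15 ▹ ((16 ▹ ((1 ▹ ((2 ▹ ((3 ▹ []) ∷ [])) ∷ (3 ▹ []) ∷ (2 ▹ []) ∷ (2 ▹ [])
  ∷ (3 ▹ []) ∷ [])) ∷ (1 ▹ ((3 ▹ []) ∷ [])) ∷ · ∷ (10 ▹ ((3 ▹ []) ∷ · ∷ · ∷ · ∷ · ∷ · ∷ · ∷ (3
  ▹ []) ∷ [])) ∷ · ∷ · ∷ · ∷ (10 ▹ ((3 ▹ []) ∷ · ∷ · ∷ · ∷ (3 ▹ []) ∷ [])) ∷ [])) ∷ (2 ▹ ((16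
  ▹ ((3 ▹ []) ∷ [])) ∷ (3 ▹ []) ∷ (20 ▹ []) ∷ · ∷ (3 ▹ []) ∷ [])) ∷ · ∷ (12 ▹ ((11 ▹ ((3 ▹ [])
  ∷ · ∷ · ∷ · ∷ (3 ▹ []) ∷ [])) ∷ · ∷ · ∷ · ∷ (11 ▹ []) ∷ · ∷ (4 ▹ []) ∷ (13 ▹ ((3 ▹ []) ∷ · ∷
  · ∷ · ∷ · ∷ · ∷ · ∷ (3 ▹ []) ∷ [])) ∷ [])) ∷ · ∷ · ∷ · ∷ (10 ▹ ((11 ▹ ((3 ▹ []) ∷ · ∷ · ∷ ·
  ∷ · ∷ · ∷ · ∷ (3 ▹ []) ∷ [])) ∷ · ∷ · ∷ · ∷ (11 ▹ []) ∷ · ∷ (4 ▹ []) ∷ (11 ▹ ((3 ▹ []) ∷ · ∷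
  · ∷ · ∷ · ∷ · ∷ · ∷ (3 ▹ []) ∷ [])) ∷ [])) ∷ [])) ∷ (15 ▹ ((1 ▹ ((16 ▹ ((3 ▹ []) ∷ [])) ∷ (3
  ▹ []) ∷ · ∷ · ∷ (3 ▹ []) ∷ [])) ∷ (1 ▹ ((2 ▹ []) ∷ [])) ∷ · ∷ · ∷ · ∷ · ∷ · ∷ (3 ▹ ((4 ▹ [])
  ∷ (22 ▹ []) ∷ · ∷ · ∷ (22 ▹ []) ∷ · ∷ · ∷ (4 ▹ []) ∷ [])) ∷ [])) ∷ (15 ▹ []) ∷ (10 ▹ ((11 ▹
  ((3 ▹ []) ∷ · ∷ · ∷ · ∷ · ∷ · ∷ · ∷ (3 ▹ []) ∷ [])) ∷ · ∷ · ∷ · ∷ (11 ▹ []) ∷ · ∷ (4 ▹ []) ∷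
  (11 ▹ ((3 ▹ []) ∷ · ∷ · ∷ · ∷ · ∷ · ∷ · ∷ (3 ▹ []) ∷ [])) ∷ [])) ∷ · ∷ · ∷ · ∷ (15 ▹ ((12 ▹
  ((3 ▹ []) ∷ · ∷ · ∷ · ∷ · ∷ · ∷ · ∷ (3 ▹ []) ∷ [])) ∷ (3 ▹ []) ∷ · ∷ · ∷ · ∷ · ∷ · ∷ (10 ▹
  []) ∷ [])) ∷ [])) ∷ (16 ▹ ((15 ▹ ((2 ▹ ((6 ▹ ((3 ▹ []) ∷ [])) ∷ (3 ▹ []) ∷ · ∷ (10 ▹ []) ∷
  (3 ▹ []) ∷ [])) ∷ (2 ▹ ((3 ▹ []) ∷ [])) ∷ (6 ▹ []) ∷ (3 ▹ []) ∷ [])) ∷ (6 ▹ ((1 ▹ ((2 ▹ [])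
  ∷ [])) ∷ (1 ▹ []) ∷ [])) ∷ · ∷ · ∷ · ∷ · ∷ · ∷ (3 ▹ ((4 ▹ []) ∷ (20 ▹ []) ∷ · ∷ · ∷ (20 ▹
  []) ∷ · ∷ · ∷ (4 ▹ []) ∷ [])) ∷ [])) ∷ (6 ▹ ((16 ▹ []) ∷ [])) ∷ (15 ▹ ((22 ▹ ((13 ▹ ((3 ▹
  []) ∷ · ∷ · ∷ · ∷ · ∷ · ∷ · ∷ (3 ▹ []) ∷ [])) ∷ · ∷ · ∷ · ∷ (11 ▹ []) ∷ · ∷ (4 ▹ []) ∷ (11 ▹
  ((3 ▹ []) ∷ · ∷ · ∷ · ∷ (3 ▹ []) ∷ [])) ∷ [])) ∷ (3 ▹ ((4 ▹ []) ∷ (10 ▹ []) ∷ · ∷ · ∷ (10 ▹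
  []) ∷ · ∷ (4 ▹ []) ∷ [])) ∷ · ∷ (12 ▹ ((13 ▹ ((3 ▹ []) ∷ · ∷ · ∷ · ∷ · ∷ · ∷ · ∷ (3 ▹ []) ∷
  [])) ∷ · ∷ · ∷ · ∷ (11 ▹ []) ∷ · ∷ (4 ▹ []) ∷ (13 ▹ ((3 ▹ []) ∷ · ∷ · ∷ · ∷ · ∷ · ∷ · ∷ (3 ▹
  []) ∷ [])) ∷ [])) ∷ [])) ∷ · ∷ · ∷ · ∷ (16 ▹ ((20 ▹ ((11 ▹ ((3 ▹ []) ∷ · ∷ · ∷ · ∷ · ∷ · ∷ ·
  ∷ (3 ▹ []) ∷ [])) ∷ · ∷ · ∷ · ∷ (10 ▹ []) ∷ · ∷ (4 ▹ []) ∷ (11 ▹ ((3 ▹ []) ∷ · ∷ · ∷ · ∷ · ∷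
  · ∷ · ∷ (3 ▹ []) ∷ [])) ∷ [])) ∷ (3 ▹ ((4 ▹ []) ∷ (12 ▹ []) ∷ · ∷ · ∷ (12 ▹ []) ∷ · ∷ (4 ▹
  []) ∷ [])) ∷ · ∷ · ∷ · ∷ · ∷ · ∷ (10 ▹ []) ∷ [])) ∷ [])) ∷ (1 ▹ ((2 ▹ ((5 ▹ ((6 ▹ ((15 ▹
  ((10 ▹ []) ∷ [])) ∷ (10 ▹ []) ∷ (15 ▹ []) ∷ [])) ∷ (6 ▹ ((10 ▹ []) ∷ [])) ∷ (6 ▹ ((16 ▹ [])
  ∷ [])) ∷ (6 ▹ []) ∷ [])) ∷ (5 ▹ ((15 ▹ ((10 ▹ []) ∷ [])) ∷ (6 ▹ []) ∷ [])) ∷ (15 ▹ ((20 ▹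
  []) ∷ [])) ∷ (5 ▹ ((10 ▹ []) ∷ [])) ∷ [])) ∷ (6 ▹ ((2 ▹ ((16 ▹ ((10 ▹ []) ∷ [])) ∷ (5 ▹ [])
  ∷ [])) ∷ (15 ▹ ((5 ▹ []) ∷ [])) ∷ · ∷ (5 ▹ []) ∷ [])) ∷ (2 ▹ ((16 ▹ ((20 ▹ []) ∷ [])) ∷ (5 ▹
  []) ∷ [])) ∷ (2 ▹ ((6 ▹ ((10 ▹ []) ∷ [])) ∷ (6 ▹ []) ∷ [])) ∷ [])) ∷ · ∷ (5 ▹ ((15 ▹ ((3 ▹
  []) ∷ [])) ∷ (2 ▹ []) ∷ [])) ∷ (6 ▹ ((16 ▹ ((3 ▹ []) ∷ [])) ∷ (1 ▹ []) ∷ [])) ∷ (1 ▹ ((3 ▹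
  ((4 ▹ ((10 ▹ []) ∷ · ∷ · ∷ · ∷ (10 ▹ []) ∷ [])) ∷ · ∷ · ∷ · ∷ (4 ▹ ((10 ▹ []) ∷ · ∷ · ∷ · ∷
  (10 ▹ []) ∷ [])) ∷ · ∷ (4 ▹ []) ∷ (4 ▹ []) ∷ [])) ∷ (10 ▹ ((11 ▹ []) ∷ · ∷ · ∷ · ∷ (11 ▹ [])
  ∷ · ∷ · ∷ (11 ▹ []) ∷ [])) ∷ (3 ▹ []) ∷ (3 ▹ []) ∷ [])) ∷ (2 ▹ ((3 ▹ ((4 ▹ ((10 ▹ []) ∷ · ∷
  · ∷ · ∷ (10 ▹ []) ∷ [])) ∷ · ∷ · ∷ · ∷ (4 ▹ ((10 ▹ []) ∷ · ∷ · ∷ · ∷ (10 ▹ []) ∷ [])) ∷ · ∷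
  (4 ▹ []) ∷ (4 ▹ []) ∷ [])) ∷ (12 ▹ ((10 ▹ []) ∷ · ∷ · ∷ · ∷ (11 ▹ []) ∷ · ∷ · ∷ (13 ▹ []) ∷
  [])) ∷ (3 ▹ []) ∷ (3 ▹ []) ∷ [])) ∷ [])
tree₇ α₂ = 
  15 ▹ ((16 ▹ ((1 ▹ ((3 ▹ ((4 ▹ ((7 ▹ []) ∷ · ∷ · ∷ · ∷ (7 ▹ []) ∷ [])) ∷ (12 ▹ []) ∷ · ∷ · ∷
  (23 ▹ ((4 ▹ []) ∷ (4 ▹ []) ∷ [])) ∷ · ∷ · ∷ (4 ▹ []) ∷ [])) ∷ (22 ▹ ((13 ▹ []) ∷ (12 ▹ []) ∷
  · ∷ · ∷ · ∷ · ∷ · ∷ (13 ▹ []) ∷ [])) ∷ · ∷ (3 ▹ ((4 ▹ []) ∷ · ∷ · ∷ · ∷ (4 ▹ []) ∷ · ∷ · ∷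
  (4 ▹ []) ∷ [])) ∷ (28 ▹ ((23 ▹ ((12 ▹ []) ∷ (12 ▹ []) ∷ [])) ∷ · ∷ · ∷ · ∷ · ∷ (12 ▹ []) ∷
  (3 ▹ ((4 ▹ []) ∷ (12 ▹ []) ∷ [])) ∷ (3 ▹ []) ∷ [])) ∷ [])) ∷ (1 ▹ ((7 ▹ ((4 ▹ ((3 ▹ []) ∷ ·
  ∷ · ∷ · ∷ (3 ▹ []) ∷ [])) ∷ · ∷ · ∷ · ∷ (4 ▹ []) ∷ · ∷ (4 ▹ []) ∷ (8 ▹ ((4 ▹ []) ∷ · ∷ · ∷ ·
  ∷ · ∷ · ∷ · ∷ (12 ▹ []) ∷ [])) ∷ [])) ∷ (12 ▹ ((13 ▹ []) ∷ (22 ▹ []) ∷ · ∷ · ∷ (22 ▹ []) ∷ ·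
  ∷ · ∷ (13 ▹ []) ∷ [])) ∷ · ∷ · ∷ (7 ▹ ((8 ▹ ((3 ▹ []) ∷ · ∷ · ∷ · ∷ · ∷ · ∷ · ∷ (12 ▹ []) ∷
  [])) ∷ · ∷ · ∷ · ∷ (4 ▹ []) ∷ · ∷ (4 ▹ []) ∷ (8 ▹ ((12 ▹ []) ∷ · ∷ · ∷ · ∷ · ∷ · ∷ · ∷ (12 ▹
  []) ∷ [])) ∷ [])) ∷ [])) ∷ · ∷ (1 ▹ ((3 ▹ ((4 ▹ []) ∷ · ∷ · ∷ · ∷ (4 ▹ []) ∷ [])) ∷ (12 ▹
  []) ∷ · ∷ · ∷ (3 ▹ ((4 ▹ []) ∷ (12 ▹ []) ∷ · ∷ · ∷ (12 ▹ []) ∷ [])) ∷ [])) ∷ · ∷ · ∷ · ∷ (12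
  ▹ []) ∷ [])) ∷ (6 ▹ ((25 ▹ ((3 ▹ []) ∷ [])) ∷ (1 ▹ []) ∷ [])) ∷ (1 ▹ []) ∷ (12 ▹ []) ∷ · ∷ ·
  ∷ · ∷ (6 ▹ ((7 ▹ ((8 ▹ ((12 ▹ ((3 ▹ []) ∷ · ∷ · ∷ · ∷ (3 ▹ []) ∷ [])) ∷ · ∷ · ∷ · ∷ (3 ▹ [])
  ∷ · ∷ · ∷ (12 ▹ ((13 ▹ []) ∷ · ∷ · ∷ · ∷ (13 ▹ []) ∷ [])) ∷ [])) ∷ · ∷ · ∷ · ∷ (23 ▹ ((4 ▹
  []) ∷ [])) ∷ · ∷ (4 ▹ []) ∷ (8 ▹ ((13 ▹ ((12 ▹ []) ∷ · ∷ · ∷ · ∷ (12 ▹ []) ∷ [])) ∷ · ∷ · ∷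
  · ∷ (12 ▹ []) ∷ · ∷ · ∷ (22 ▹ ((13 ▹ []) ∷ · ∷ · ∷ · ∷ · ∷ · ∷ · ∷ (13 ▹ []) ∷ [])) ∷ [])) ∷
  [])) ∷ (16 ▹ ((28 ▹ ((8 ▹ []) ∷ · ∷ · ∷ · ∷ · ∷ · ∷ (3 ▹ []) ∷ [])) ∷ (7 ▹ ((3 ▹ []) ∷ · ∷ ·
  ∷ · ∷ (4 ▹ []) ∷ · ∷ · ∷ (8 ▹ []) ∷ [])) ∷ · ∷ (3 ▹ []) ∷ [])) ∷ (7 ▹ []) ∷ · ∷ · ∷ · ∷ · ∷
  (12 ▹ ((13 ▹ []) ∷ · ∷ · ∷ · ∷ (13 ▹ []) ∷ · ∷ · ∷ (13 ▹ []) ∷ [])) ∷ [])) ∷ [])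
tree₇ α₃ = 
  7 ▹ ((8 ▹ ((1 ▹ ((6 ▹ ((3 ▹ ((4 ▹ ((2 ▹ []) ∷ [])) ∷ (2 ▹ []) ∷ · ∷ · ∷ (4 ▹ []) ∷ · ∷ (4 ▹
  []) ∷ [])) ∷ (17 ▹ ((4 ▹ ((2 ▹ []) ∷ [])) ∷ · ∷ · ∷ · ∷ (4 ▹ []) ∷ · ∷ (2 ▹ []) ∷ (4 ▹ []) ∷
  [])) ∷ (17 ▹ []) ∷ (3 ▹ []) ∷ [])) ∷ (6 ▹ ((12 ▹ []) ∷ (12 ▹ []) ∷ [])) ∷ (24 ▹ []) ∷ · ∷ (6
  ▹ ((14 ▹ ((28 ▹ ((3 ▹ []) ∷ [])) ∷ · ∷ · ∷ · ∷ · ∷ (2 ▹ []) ∷ (2 ▹ []) ∷ (3 ▹ []) ∷ [])) ∷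
  (17 ▹ ((18 ▹ ((3 ▹ []) ∷ [])) ∷ · ∷ · ∷ · ∷ (4 ▹ []) ∷ · ∷ (2 ▹ []) ∷ (12 ▹ []) ∷ [])) ∷ · ∷
  (3 ▹ []) ∷ · ∷ · ∷ · ∷ (12 ▹ []) ∷ [])) ∷ [])) ∷ · ∷ · ∷ (14 ▹ ((2 ▹ []) ∷ · ∷ · ∷ (2 ▹ [])
  ∷ [])) ∷ (16 ▹ ((1 ▹ ((3 ▹ ((2 ▹ []) ∷ [])) ∷ · ∷ · ∷ · ∷ (17 ▹ ((2 ▹ []) ∷ [])) ∷ [])) ∷ (1
  ▹ ((2 ▹ ((3 ▹ []) ∷ (3 ▹ []) ∷ [])) ∷ · ∷ · ∷ · ∷ (2 ▹ ((3 ▹ []) ∷ (3 ▹ []) ∷ [])) ∷ [])) ∷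
  (2 ▹ []) ∷ [])) ∷ · ∷ (1 ▹ ((2 ▹ ((3 ▹ []) ∷ (3 ▹ []) ∷ [])) ∷ · ∷ · ∷ · ∷ (28 ▹ ((2 ▹ []) ∷
  [])) ∷ [])) ∷ (16 ▹ ((17 ▹ ((1 ▹ []) ∷ · ∷ · ∷ · ∷ · ∷ · ∷ · ∷ (6 ▹ []) ∷ [])) ∷ (28 ▹ ((6 ▹
  []) ∷ · ∷ · ∷ · ∷ · ∷ · ∷ (1 ▹ []) ∷ [])) ∷ [])) ∷ [])) ∷ · ∷ · ∷ (17 ▹ ((24 ▹ ((4 ▹ []) ∷
  [])) ∷ · ∷ · ∷ (2 ▹ []) ∷ (2 ▹ []) ∷ [])) ∷ (18 ▹ ((16 ▹ ((1 ▹ ((3 ▹ ((2 ▹ []) ∷ · ∷ · ∷ · ∷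
  · ∷ · ∷ · ∷ (4 ▹ []) ∷ [])) ∷ · ∷ · ∷ (14 ▹ []) ∷ (29 ▹ ((2 ▹ []) ∷ [])) ∷ [])) ∷ (1 ▹ ((3 ▹
  ((2 ▹ []) ∷ · ∷ · ∷ · ∷ · ∷ · ∷ · ∷ (4 ▹ []) ∷ [])) ∷ · ∷ · ∷ · ∷ (8 ▹ ((2 ▹ []) ∷ · ∷ · ∷ ·
  ∷ (2 ▹ []) ∷ [])) ∷ [])) ∷ (2 ▹ []) ∷ [])) ∷ · ∷ · ∷ · ∷ (1 ▹ ((2 ▹ ((3 ▹ []) ∷ (3 ▹ []) ∷
  [])) ∷ · ∷ · ∷ · ∷ (2 ▹ ((3 ▹ []) ∷ (3 ▹ []) ∷ [])) ∷ [])) ∷ · ∷ (1 ▹ ((2 ▹ ((3 ▹ []) ∷ (3 ▹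
  []) ∷ [])) ∷ · ∷ · ∷ · ∷ (2 ▹ ((3 ▹ []) ∷ (3 ▹ []) ∷ [])) ∷ [])) ∷ (16 ▹ ((1 ▹ []) ∷ (1 ▹
  []) ∷ [])) ∷ [])) ∷ · ∷ (1 ▹ ((2 ▹ ((4 ▹ ((8 ▹ []) ∷ [])) ∷ (8 ▹ ((4 ▹ []) ∷ [])) ∷ [])) ∷
  (6 ▹ []) ∷ · ∷ · ∷ (6 ▹ ((8 ▹ ((2 ▹ []) ∷ [])) ∷ (23 ▹ ((2 ▹ []) ∷ [])) ∷ [])) ∷ [])) ∷ (16
  ▹ ((18 ▹ ((23 ▹ ((1 ▹ []) ∷ [])) ∷ · ∷ · ∷ · ∷ (1 ▹ []) ∷ · ∷ · ∷ (6 ▹ []) ∷ [])) ∷ (18 ▹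
  ((8 ▹ ((1 ▹ []) ∷ · ∷ · ∷ · ∷ · ∷ · ∷ · ∷ (22 ▹ []) ∷ [])) ∷ · ∷ · ∷ · ∷ (6 ▹ ((1 ▹ []) ∷ (1
  ▹ []) ∷ [])) ∷ · ∷ · ∷ (6 ▹ []) ∷ [])) ∷ · ∷ · ∷ · ∷ · ∷ · ∷ (8 ▹ []) ∷ [])) ∷ [])
tree₇ α₄ = 
  5 ▹ ((16 ▹ ((7 ▹ ((8 ▹ ((1 ▹ []) ∷ [])) ∷ · ∷ · ∷ (8 ▹ []) ∷ (1 ▹ []) ∷ · ∷ · ∷ (8 ▹ []) ∷
  [])) ∷ (1 ▹ []) ∷ · ∷ (14 ▹ []) ∷ · ∷ · ∷ · ∷ (7 ▹ ((8 ▹ ((14 ▹ []) ∷ [])) ∷ · ∷ · ∷ · ∷ (8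
  ▹ []) ∷ · ∷ · ∷ (8 ▹ []) ∷ [])) ∷ [])) ∷ (16 ▹ ((1 ▹ []) ∷ · ∷ · ∷ · ∷ · ∷ · ∷ · ∷ (14 ▹ [])
  ∷ [])) ∷ (1 ▹ []) ∷ (14 ▹ []) ∷ · ∷ · ∷ · ∷ (17 ▹ ((18 ▹ ((24 ▹ ((7 ▹ []) ∷ [])) ∷ · ∷ · ∷ ·
  ∷ (7 ▹ []) ∷ · ∷ · ∷ (14 ▹ []) ∷ [])) ∷ · ∷ · ∷ · ∷ (8 ▹ ((7 ▹ []) ∷ [])) ∷ · ∷ (8 ▹ []) ∷
  (8 ▹ ((14 ▹ []) ∷ · ∷ · ∷ · ∷ · ∷ · ∷ · ∷ (14 ▹ []) ∷ [])) ∷ [])) ∷ [])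
tree₇ β₁ = 
  5 ▹ (· ∷ (15 ▹ (· ∷ (6 ▹ (· ∷ (9 ▹ ((17 ▹ []) ∷ [])) ∷ · ∷ · ∷ (16 ▹ (· ∷ (7 ▹ []) ∷ · ∷ · ∷
  (10 ▹ ((7 ▹ []) ∷ · ∷ · ∷ · ∷ (8 ▹ []) ∷ · ∷ · ∷ (11 ▹ []) ∷ [])) ∷ [])) ∷ [])) ∷ · ∷ · ∷ (6
  ▹ (· ∷ (16 ▹ (· ∷ (17 ▹ []) ∷ [])) ∷ · ∷ · ∷ (16 ▹ (· ∷ (7 ▹ ((8 ▹ []) ∷ (17 ▹ []) ∷ · ∷ · ∷
  (17 ▹ []) ∷ · ∷ · ∷ (8 ▹ []) ∷ [])) ∷ · ∷ · ∷ (7 ▹ []) ∷ [])) ∷ [])) ∷ [])) ∷ · ∷ · ∷ (15 ▹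
  (· ∷ (6 ▹ (· ∷ (16 ▹ (· ∷ (7 ▹ []) ∷ · ∷ · ∷ (7 ▹ ((8 ▹ []) ∷ (17 ▹ []) ∷ · ∷ · ∷ (17 ▹ [])
  ∷ · ∷ · ∷ (8 ▹ []) ∷ [])) ∷ [])) ∷ · ∷ · ∷ (16 ▹ (· ∷ · ∷ · ∷ · ∷ (17 ▹ []) ∷ [])) ∷ [])) ∷
  · ∷ · ∷ (6 ▹ (· ∷ (16 ▹ (· ∷ (12 ▹ ((7 ▹ []) ∷ · ∷ · ∷ · ∷ (8 ▹ []) ∷ · ∷ · ∷ (13 ▹ []) ∷
  [])) ∷ · ∷ · ∷ (7 ▹ []) ∷ [])) ∷ · ∷ · ∷ (16 ▹ (· ∷ (17 ▹ []) ∷ [])) ∷ [])) ∷ [])) ∷ [])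
tree₇ β₂ = 
  5 ▹ (· ∷ (15 ▹ (· ∷ (6 ▹ (· ∷ (16 ▹ (· ∷ (3 ▹ []) ∷ · ∷ · ∷ (10 ▹ ((3 ▹ []) ∷ · ∷ · ∷ · ∷ (4
  ▹ []) ∷ · ∷ · ∷ (11 ▹ []) ∷ [])) ∷ [])) ∷ · ∷ · ∷ (16 ▹ (· ∷ (20 ▹ ((3 ▹ []) ∷ · ∷ · ∷ · ∷
  (4 ▹ []) ∷ · ∷ · ∷ (7 ▹ []) ∷ [])) ∷ · ∷ · ∷ (10 ▹ ((11 ▹ ((3 ▹ []) ∷ · ∷ · ∷ · ∷ (3 ▹ []) ∷
  [])) ∷ · ∷ · ∷ · ∷ (11 ▹ ((3 ▹ []) ∷ · ∷ · ∷ · ∷ (3 ▹ []) ∷ [])) ∷ · ∷ (4 ▹ []) ∷ (11 ▹ [])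
  ∷ [])) ∷ [])) ∷ [])) ∷ · ∷ · ∷ (6 ▹ (· ∷ (16 ▹ (· ∷ (3 ▹ ((4 ▹ []) ∷ (17 ▹ []) ∷ · ∷ · ∷ (17
  ▹ []) ∷ · ∷ · ∷ (4 ▹ []) ∷ [])) ∷ · ∷ · ∷ (3 ▹ []) ∷ [])) ∷ · ∷ · ∷ (16 ▹ (· ∷ (20 ▹ ((21 ▹
  ((3 ▹ []) ∷ · ∷ · ∷ · ∷ · ∷ · ∷ · ∷ (17 ▹ []) ∷ [])) ∷ · ∷ · ∷ · ∷ (4 ▹ []) ∷ · ∷ (4 ▹ []) ∷
  (8 ▹ ((7 ▹ []) ∷ · ∷ · ∷ · ∷ (17 ▹ []) ∷ [])) ∷ [])) ∷ · ∷ · ∷ (20 ▹ ((3 ▹ []) ∷ · ∷ · ∷ · ∷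
  · ∷ · ∷ · ∷ (7 ▹ []) ∷ [])) ∷ [])) ∷ [])) ∷ [])) ∷ · ∷ · ∷ (15 ▹ (· ∷ (6 ▹ (· ∷ (16 ▹ (· ∷
  (3 ▹ ((4 ▹ []) ∷ (7 ▹ []) ∷ · ∷ · ∷ (7 ▹ []) ∷ · ∷ (4 ▹ []) ∷ [])) ∷ · ∷ · ∷ (10 ▹ ((11 ▹
  ((3 ▹ []) ∷ · ∷ · ∷ · ∷ · ∷ · ∷ · ∷ (7 ▹ []) ∷ [])) ∷ · ∷ · ∷ · ∷ (4 ▹ []) ∷ · ∷ (4 ▹ []) ∷
  (11 ▹ ((7 ▹ []) ∷ · ∷ · ∷ · ∷ · ∷ · ∷ · ∷ (7 ▹ []) ∷ [])) ∷ [])) ∷ [])) ∷ · ∷ · ∷ (16 ▹ (· ∷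
  (3 ▹ []) ∷ · ∷ · ∷ (10 ▹ ((3 ▹ []) ∷ · ∷ · ∷ · ∷ · ∷ · ∷ · ∷ (11 ▹ []) ∷ [])) ∷ [])) ∷ []))
  ∷ · ∷ · ∷ (6 ▹ (· ∷ (16 ▹ (· ∷ (12 ▹ ((13 ▹ ((3 ▹ []) ∷ · ∷ · ∷ · ∷ · ∷ · ∷ · ∷ (3 ▹ []) ∷
  [])) ∷ · ∷ · ∷ · ∷ (8 ▹ []) ∷ · ∷ (4 ▹ []) ∷ (13 ▹ ((3 ▹ []) ∷ · ∷ · ∷ · ∷ · ∷ · ∷ · ∷ (3 ▹
  []) ∷ [])) ∷ [])) ∷ · ∷ · ∷ (3 ▹ ((4 ▹ []) ∷ (7 ▹ []) ∷ · ∷ · ∷ (7 ▹ []) ∷ [])) ∷ [])) ∷ · ∷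
  · ∷ (16 ▹ (· ∷ (3 ▹ ((4 ▹ []) ∷ (17 ▹ []) ∷ · ∷ · ∷ (17 ▹ []) ∷ [])) ∷ · ∷ · ∷ (3 ▹ []) ∷
  [])) ∷ [])) ∷ [])) ∷ [])
tree₇ β₃ = 
  5 ▹ (· ∷ (15 ▹ (· ∷ (6 ▹ (· ∷ (16 ▹ (· ∷ · ∷ · ∷ · ∷ (17 ▹ []) ∷ [])) ∷ · ∷ · ∷ (16 ▹ (· ∷
  (7 ▹ []) ∷ · ∷ · ∷ (10 ▹ ((7 ▹ []) ∷ · ∷ · ∷ · ∷ · ∷ · ∷ · ∷ (11 ▹ []) ∷ [])) ∷ [])) ∷ []))
  ∷ · ∷ · ∷ (6 ▹ (· ∷ (16 ▹ (· ∷ (17 ▹ []) ∷ [])) ∷ · ∷ · ∷ (16 ▹ (· ∷ (7 ▹ ((8 ▹ []) ∷ (17 ▹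
  []) ∷ · ∷ · ∷ (17 ▹ []) ∷ [])) ∷ · ∷ · ∷ (7 ▹ []) ∷ [])) ∷ [])) ∷ [])) ∷ · ∷ · ∷ (15 ▹ (· ∷
  (6 ▹ (· ∷ (16 ▹ (· ∷ (7 ▹ []) ∷ · ∷ · ∷ (7 ▹ ((8 ▹ []) ∷ (17 ▹ []) ∷ · ∷ · ∷ (17 ▹ []) ∷
  [])) ∷ [])) ∷ · ∷ · ∷ (16 ▹ (· ∷ · ∷ · ∷ · ∷ (17 ▹ []) ∷ [])) ∷ [])) ∷ · ∷ · ∷ (6 ▹ (· ∷ (16
  ▹ (· ∷ (12 ▹ ((7 ▹ []) ∷ · ∷ · ∷ · ∷ · ∷ · ∷ · ∷ (13 ▹ []) ∷ [])) ∷ · ∷ · ∷ (7 ▹ []) ∷ []))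
  ∷ · ∷ · ∷ (16 ▹ (· ∷ (17 ▹ []) ∷ [])) ∷ [])) ∷ [])) ∷ [])

-- Of the 20 triples on six vertices at least 14 are present, which leaves 6 to spare.
checked₆ : ∀ s → T (Search.refutes 6 6 (triples (allFin 6)) (tree₆ s)
  (Search.assume 6 6 (triples (allFin 6)) (facts 1 s)))
checked₆ α₁ = tt
checked₆ α₂ = tt
checked₆ α₃ = tt
checked₆ α₄ = tt
checked₆ β₁ = tt
checked₆ β₂ = tt
checked₆ β₃ = tt

-- Of the 35 triples on seven vertices at least 17 are present, which leaves 18 to spare.
checked₇ : ∀ s → T (Search.refutes 7 18 (triples (allFin 7)) (tree₇ s)
  (Search.assume 7 18 (triples (allFin 7)) (facts 2 s)))
checked₇ α₁ = tt
checked₇ α₂ = tt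
checked₇ α₃ = tt
checked₇ α₄ = tt
checked₇ β₁ = tt
checked₇ β₂ = tt
checked₇ β₃ = tt

-- Families with a member that meets all the others

module WithMeeting {A : Set} (_≟_ : DecidableEquality A) {vs} (u : Unique vs)
  (F : Systems.TripleSystem _≟_ vs) (good : Systems.Good _≟_ F) {a₀ b₀ c₀ : A}
  (abc₀ : Systems.TripleSystem.Mem F a₀ b₀ c₀) (meets₀ : Systems.Meets _≟_ F a₀ b₀ c₀) where

  open Systems _≟_
  open TripleSystem

  -- The orderings of the meeting triple, generated by adjacent transpositions; they allow each
  -- argument to be made for one naming of its vertices.
  data Base : A → A → A → Set where
    base : Base a₀ b₀ c₀
    base-swap₁ : ∀ {a b c} → Base a b c → Base b a c
    base-swap₂ : ∀ {a b c} → Base a b c → Base a c b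

  base-mem : ∀ {a b c} → Base a b c → Mem F a b c
  base-mem base = abc₀
  base-mem (base-swap₁ b) = swap₁ F (base-mem b)
  base-mem (base-swap₂ b) = swap₂ F (base-mem b)

  base-meets : ∀ {a b c} → Base a b c → Meets F a b c
  base-meets base m = meets₀ m
  base-meets (base-swap₁ b) m = in-swap₁′ (base-meets b m)
    where
    in-swap₁′ : ∀ {P Q R : Set} → P ⊎ Q ⊎ R → Q ⊎ P ⊎ R
    in-swap₁′ (inj₁ p) = inj₂ (inj₁ p)
    in-swap₁′ (inj₂ (inj₁ q)) = inj₁ q
    in-swap₁′ (inj₂ (inj₂ r)) = inj₂ (inj₂ r)
  base-meets (base-swap₂ b) m = ⊎-map id ⊎-swap (base-meets b m)

  base-⊆ : ∀ {a b c} → Base a b c → ∀ {x} → In x a b c → In x a₀ b₀ c₀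
  base-⊆ base i = i
  base-⊆ (base-swap₁ b) i = base-⊆ b (in-swap₁ i)
  base-⊆ (base-swap₂ b) i = base-⊆ b (in-swap₂ i)

  base-⊇ : ∀ {a b c} → Base a b c → ∀ {x} → In x a₀ b₀ c₀ → In x a b c
  base-⊇ base i = i
  base-⊇ (base-swap₁ b) i = in-swap₁ (base-⊇ b i)
  base-⊇ (base-swap₂ b) i = in-swap₂ (base-⊇ b i)

  base-∌ : ∀ {B : TripleSystem vs} {a b c} → ¬ Mem B a₀ b₀ c₀ → Base a b c → ¬ Mem B a b c
  base-∌ ¬m base m = ¬m m
  base-∌ {B} ¬m (base-swap₁ b) m = base-∌ {B} ¬m b (swap₁ B m)
  base-∌ {B} ¬m (base-swap₂ b) m = base-∌ {B} ¬m b (swap₂ B m)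

  -- Edges and prisms over the meeting triple

  record Edge (B : TripleSystem vs) (a b c u v : A) : Set where
    constructor edge
    field
      letters : Base a b c
      auv : Mem B a u v
      buv : Mem B b u v
      u≢c : u ≢ c
      v≢c : v ≢ c

  record Prism (B : TripleSystem vs) (a b c u : A) : Set where
    constructor prism
    field
      abu : Mem B a b u
      acu : Mem B a c u
      bcu : Mem B b c u

  SomeEdge : TripleSystem vs → Set
  SomeEdge B = ∃[ a ] ∃[ b ] ∃[ c ] ∃[ u ] ∃[ v ] Edge B a b c u v

  module _ {B : TripleSystem vs} (B⊑F : B ⊑ F) (core : Core B) where
    open Core core

    Result : A → A → A → Set
    Result a b c = SomeEdge B ⊎ ∃[ u ] Prism B a b c u

    result-swap₁ : ∀ {a b c} → Result a b c → Result b a c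
    result-swap₁ (inj₁ e) = inj₁ e
    result-swap₁ (inj₂ (u , prism p q r)) = inj₂ (u , prism (swap₁ B p) r q)

    result-swap₂ : ∀ {a b c} → Result a b c → Result a c b
    result-swap₂ (inj₁ e) = inj₁ e
    result-swap₂ (inj₂ (u , prism p q r)) = inj₂ (u , prism q p (swap₁ B r))

    -- A second core triple through st has to meet abc, and s and t are off abc, so its third vertex
    -- is b or c.
    edge-at : ∀ {a b c s t} → Base a b c → Mem B a s t → s ≢ b → s ≢ c → t ≢ b → t ≢ c → SomeEdge B
    edge-at l m s≢b s≢c t≢b t≢c with q , q≢a , n ← again (rot B m)
      with third F (base-meets l) (B⊑F n) (≢-sym (distinct B m)) s≢b s≢c (≢-sym (distinct₁₃ B m)) t≢b t≢c
    ... | inj₁ q≡a = ⊥-elim (q≢a q≡a)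
    ... | inj₂ (inj₁ refl) = _ , _ , _ , _ , _ , edge l m (rot′ B n) s≢c t≢c
    ... | inj₂ (inj₂ refl) = _ , _ , _ , _ , _ , edge (base-swap₂ l) m (rot′ B n) s≢b t≢b

    -- The pairs at and bt lie in further core triples. If both have c as third vertex, there is a
    -- prism; any other third vertex is a case for `edge-at`.
    prism-at : ∀ {a b c t} → Base a b c → Mem B a b t → t ≢ c → SomeEdge B ⊎ Prism B a b c t
    prism-at {a} {b} {c} {t} l m t≢c
      with p , p≢b , acp ← again (swap₂ B m) | q , q≢a , bcq ← again (rot B m)
      with p ≟ c | q ≟ c
    ... | no p≢c | _ = inj₁ (edge-at l acp (≢-sym (distinct₂₃ B m)) t≢c p≢b p≢c)
    ... | yes refl | no q≢c =
      inj₁ (edge-at (base-swap₁ l) bcq (≢-sym (distinct₁₃ B m)) t≢c q≢a q≢c)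
    ... | yes refl | yes refl = inj₂ (prism m (swap₂ B acp) (swap₂ B bcq))

    pair-result : ∀ {a b c t} → Base a b c → Mem B a b t → Result a b c
    pair-result {c = c} {t} l m with t ≟ c
    ... | no t≢c = ⊎-map id (_ ,_) (prism-at l m t≢c)
    ... | yes refl with t′ , t′≢c , m′ ← again m = ⊎-map id (_ ,_) (prism-at l m′ t′≢c)

    letter-result : ∀ {a b c s t} → Base a b c → Mem B a s t → Result a b c
    letter-result {b = b} {c} {s} {t} l m with s ≟ b | s ≟ c | t ≟ b | t ≟ c
    ... | yes refl | _ | _ | _ = pair-result l m
    ... | no _ | yes refl | _ | _ = result-swap₂ (pair-result (base-swap₂ l) m)
    ... | no _ | no _ | yes refl | _ = pair-result l (swap₂ B m)
    ... | no _ | no _ | no _ | yes refl = result-swap₂ (pair-result (base-swap₂ l) (swap₂ B m))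
    ... | no s≢b | no s≢c | no t≢b | no t≢c = inj₁ (edge-at l m s≢b s≢c t≢b t≢c)

    letter-first : ∀ {x r s t} → In x r s t → Mem B r s t → ∃[ p ] ∃[ q ] Mem B x p q
    letter-first (inj₁ refl) m = _ , _ , m
    letter-first (inj₂ (inj₁ refl)) m = _ , _ , swap₁ B m
    letter-first (inj₂ (inj₂ refl)) m = _ , _ , rot′ B m

    edge-or-prism : ∀ {a b c} → Base a b c → Result a b c
    edge-or-prism l with base-meets l (B⊑F member)
    ... | inj₁ i with _ , _ , m ← letter-first i member = letter-result l m
    ... | inj₂ (inj₁ i) with _ , _ , m ← letter-first i member =
      result-swap₁ (letter-result (base-swap₁ l) m)
    ... | inj₂ (inj₂ i) with _ , _ , m ← letter-first i member =
      result-swap₂ (result-swap₁ (letter-result (base-swap₁ (base-swap₂ l)) m))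

    -- In a core without abc, a second triple through ab cannot end in c, so it leads to a second
    -- prism.
    edge-or-prisms : ∀ {a b c} → ¬ Mem B a₀ b₀ c₀ → Base a b c →
      SomeEdge B ⊎ ∃₂ λ u v → u ≢ v × Prism B a b c u × Prism B a b c v
    edge-or-prisms ∌ l with edge-or-prism l
    ... | inj₁ e = inj₁ e
    ... | inj₂ (u , p) with v , v≢u , m ← again (Prism.abu p)
      with prism-at l m (λ where refl → base-∌ {B} ∌ l m)
    ... | inj₁ e = inj₁ e
    ... | inj₂ q = inj₂ (u , v , ≢-sym v≢u , p , q)

    module _ {a b c u v} (e : Edge B a b c u v) where
      open Edge e

      -- On auv, abc realises the trace {a} and buv realises {u, v}; the core provides further
      -- triples through au and av.
      edge-kind : Meets F a u v ⊎ Dom F u a v ⊎ Dom F v a u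
      edge-kind with classify F good (B⊑F auv)
      ... | meets t = inj₁ t
      ... | dom₁ t = ⊥-elim (dom-miss F t (base-mem letters) (distinct B buv) (distinct₁₃ B buv) (≢-sym u≢c) (≢-sym v≢c))
      ... | dom₂ t = inj₂ (inj₁ t)
      ... | dom₃ t = inj₂ (inj₂ t)
      ... | own₁ t = ⊥-elim (distinct F (base-mem letters) (sym (t (B⊑F (rot B buv)))))
      ... | own₂ t with q , q≢ , m ← again (swap₂ B auv) = ⊥-elim (q≢ (t (B⊑F m)))
      ... | own₃ t with q , q≢ , m ← again auv = ⊥-elim (q≢ (t (B⊑F m)))

      edge-swap : Edge B b a c u v
      edge-swap = edge (base-swap₁ letters) buv auv u≢c v≢c

      edge-flip : Edge B a b c v u
      edge-flip = edge letters (swap₂ B auv) (swap₂ B buv) v≢c u≢c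

    data EdgeShape (a b c u v : A) : Set where
      ε₁ : Meets F a u v → Meets F b u v → EdgeShape a b c u v
      ε₂ : Meets F a u v → Dom F u b v → EdgeShape a b c u v
      ε₃ : Dom F u a v → Dom F u b v → EdgeShape a b c u v
      ε₄ : Dom F u a v → Dom F v b u → EdgeShape a b c u v

    private
      meets-flip : ∀ {a u v} → Meets F a u v → Meets F a v u
      meets-flip mt m = ⊎-map id ⊎-swap (mt m)

    -- up to exchanging a with b and u with v
    shape : SomeEdge B → ∃[ a ] ∃[ b ] ∃[ c ] ∃[ u ] ∃[ v ] Edge B a b c u v × EdgeShape a b c u v
    shape (_ , _ , _ , _ , _ , e) with edge-kind e | edge-kind (edge-swap e)
    ... | inj₁ p | inj₁ q = _ , _ , _ , _ , _ , e , ε₁ p q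
    ... | inj₁ p | inj₂ (inj₁ q) = _ , _ , _ , _ , _ , e , ε₂ p q
    ... | inj₁ p | inj₂ (inj₂ q) = _ , _ , _ , _ , _ , edge-flip e , ε₂ (meets-flip p) q
    ... | inj₂ (inj₁ p) | inj₁ q = _ , _ , _ , _ , _ , edge-swap e , ε₂ q p
    ... | inj₂ (inj₂ p) | inj₁ q = _ , _ , _ , _ , _ , edge-flip (edge-swap e) , ε₂ (meets-flip q) p
    ... | inj₂ (inj₁ p) | inj₂ (inj₁ q) = _ , _ , _ , _ , _ , e , ε₃ p q
    ... | inj₂ (inj₂ p) | inj₂ (inj₂ q) = _ , _ , _ , _ , _ , edge-flip e , ε₃ p q
    ... | inj₂ (inj₁ p) | inj₂ (inj₂ q) = _ , _ , _ , _ , _ , e , ε₄ p q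
    ... | inj₂ (inj₂ p) | inj₂ (inj₁ q) = _ , _ , _ , _ , _ , edge-flip e , ε₄ p q

  -- On abu, the triples acv and bcv of the other prism realise {a} and {b}; abc, acu and bcu
  -- realise the traces of size two.
  prism-kind : ∀ {a b c u v} → Base a b c → Prism F a b c u → Prism F a b c v → u ≢ v →
    Meets F a b u ⊎ Dom F u a b
  prism-kind {c = c} l p q u≢v with classify F good (Prism.abu p)
  ... | meets t = inj₁ t
  ... | dom₁ t = ⊥-elim (dom-miss F t (Prism.acu q) (≢-sym (distinct₂₃ F (base-mem l)))
                   (distinct₂₃ F (Prism.acu p)) (≢-sym (distinct₂₃ F (Prism.abu q))) (≢-sym u≢v))
  ... | dom₂ t = ⊥-elim (dom-miss F t (Prism.bcu q) (≢-sym (distinct₁₃ F (base-mem l)))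
                   (distinct₂₃ F (Prism.acu p)) (≢-sym (distinct₁₃ F (Prism.abu q))) (≢-sym u≢v))
  ... | dom₃ t = inj₂ t
  ... | own₁ t = ⊥-elim (distinct₁₃ F (base-mem l) (sym (t (swap₂ F (Prism.bcu p)))))
  ... | own₂ t = ⊥-elim (distinct₂₃ F (base-mem l) (sym (t (swap₂ F (Prism.acu p)))))
  ... | own₃ t = ⊥-elim (distinct₂₃ F (Prism.acu p) (t (base-mem l)))

  -- Deleting abc costs one of the two units of surplus.
  core₀ : length (pairs vs) + 2 < size F + length vs →
    Σ (TripleSystem vs) λ B → B ⊑ F × ¬ Mem B a₀ b₀ c₀ × Core B
  core₀ lt with B , B⊑ , c ← core u (F ∖ (a₀ , b₀ , c₀)) (pairs vs) (pairs-covering F ∘ proj₁) pairs-connected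
    (s≤s⁻¹ (≤-trans (≤-reflexive (cong suc (sym (+-suc (length (pairs vs)) 1))))
      (≤-trans lt (+-monoˡ-≤ (length vs) (size-∖ F u abc₀))))) =
    B , proj₁ ∘ B⊑ , (λ m → ∖-∌ F (B⊑ m)) , c

  unique₅ : ∀ {a b c u v} → Base a b c → u ≢ a → u ≢ b → u ≢ c → v ≢ a → v ≢ b → v ≢ c → u ≢ v →
    Unique (a ∷ b ∷ c ∷ u ∷ v ∷ [])
  unique₅ l ua ub uc va vb vc uv with (ab ∷ ac ∷ []) ∷ (bc ∷ []) ∷ _ ← unique₃ F (base-mem l) =
    (ab ∷ ac ∷ ≢-sym ua ∷ ≢-sym va ∷ []) ∷ (bc ∷ ≢-sym ub ∷ ≢-sym vb ∷ []) ∷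
    (≢-sym uc ∷ ≢-sym vc ∷ []) ∷ (uv ∷ []) ∷ [] ∷ []

  ⊆₅ : ∀ {a b c u v} → Base a b c → u ∈ vs → v ∈ vs → (a ∷ b ∷ c ∷ u ∷ v ∷ []) ⊆ vs
  ⊆₅ l u∈ v∈ (here refl) = support F (base-mem l)
  ⊆₅ l u∈ v∈ (there (here refl)) = support F (rot F (base-mem l))
  ⊆₅ l u∈ v∈ (there (there (here refl))) = support F (rot′ F (base-mem l))
  ⊆₅ l u∈ v∈ (there (there (there (here refl)))) = u∈
  ⊆₅ l u∈ v∈ (there (there (there (there (here refl))))) = v∈

  edge-unique : ∀ {B a b c u v} → Edge B a b c u v → Unique (a ∷ b ∷ c ∷ u ∷ v ∷ [])
  edge-unique {B} e = unique₅ letters (≢-sym (distinct B auv)) (≢-sym (distinct B buv)) u≢c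
    (≢-sym (distinct₁₃ B auv)) (≢-sym (distinct₁₃ B buv)) v≢c (distinct₂₃ B auv)
    where open Edge e

  edge-⊆ : ∀ {B a b c u v} → Edge B a b c u v → (a ∷ b ∷ c ∷ u ∷ v ∷ []) ⊆ vs
  edge-⊆ {B} e = ⊆₅ letters (support B (rot B auv)) (support B (rot′ B auv))
    where open Edge e

  prism-unique : ∀ {a b c u v} → Base a b c → Prism F a b c u → Prism F a b c v → u ≢ v →
    Unique (a ∷ b ∷ c ∷ u ∷ v ∷ [])
  prism-unique l p q = unique₅ l (≢-sym (distinct₁₃ F (abu p))) (≢-sym (distinct₂₃ F (abu p))) (≢-sym (distinct₂₃ F (acu p)))
    (≢-sym (distinct₁₃ F (abu q))) (≢-sym (distinct₂₃ F (abu q))) (≢-sym (distinct₂₃ F (acu q)))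
    where open Prism

  prism-⊆ : ∀ {a b c u v} → Base a b c → Prism F a b c u → Prism F a b c v →
    (a ∷ b ∷ c ∷ u ∷ v ∷ []) ⊆ vs
  prism-⊆ l p q = ⊆₅ l (support F (rot′ F (Prism.abu p))) (support F (rot′ F (Prism.abu q)))

  prism-⊑ : ∀ {B a b c u} → B ⊑ F → Prism B a b c u → Prism F a b c u
  prism-⊑ B⊑F (prism p q r) = prism (B⊑F p) (B⊑F q) (B⊑F r)

  -- Six and seven vertices

  Small : Set
  Small = (length vs ≡ 6 × 14 ≤ size F) ⊎ (length vs ≡ 7 × 17 ≤ size F)

  -- The facts are requested for every list that extends the five named vertices, because the
  -- remaining one or two are extracted only inside the proof.
  refute-shape : Small → ∀ s {a b c u v} → Unique (a ∷ b ∷ c ∷ u ∷ v ∷ []) → (a ∷ b ∷ c ∷ u ∷ v ∷ []) ⊆ vs →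
    (∀ {ws} (un : Unique (a ∷ b ∷ c ∷ u ∷ v ∷ ws)) → All (Refute.Valid _≟_ F good un) (facts (length ws) s)) → ⊥
  refute-shape small s un ⊆vs valid with ws , p ← extractAll un ⊆vs = go ws p small
    where
    go : ∀ ws → vs ↭ _ ∷ _ ∷ _ ∷ _ ∷ _ ∷ ws → Small → ⊥
    go (_ ∷ []) p (inj₁ (_ , le)) = Refute.refute _≟_ F good un′ {6}
      (+-monoˡ-≤ 6 (≤-trans le (≤-reflexive (size-↭ F p)))) (tree₆ s) (facts 1 s) (valid un′) (checked₆ s)
      where un′ = Unique-resp-↭ p u
    go (_ ∷ _ ∷ []) p (inj₂ (_ , le)) = Refute.refute _≟_ F good un′ {18}
      (+-monoˡ-≤ 18 (≤-trans le (≤-reflexive (size-↭ F p)))) (tree₇ s) (facts 2 s) (valid un′) (checked₇ s)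
      where un′ = Unique-resp-↭ p u
    go [] p (inj₁ (eq , _)) = contradiction (≡.trans (sym eq) (↭-length p)) λ ()
    go [] p (inj₂ (eq , _)) = contradiction (≡.trans (sym eq) (↭-length p)) λ ()
    go (_ ∷ []) p (inj₂ (eq , _)) = contradiction (≡.trans (sym eq) (↭-length p)) λ ()
    go (_ ∷ _ ∷ []) p (inj₁ (eq , _)) = contradiction (≡.trans (sym eq) (↭-length p)) λ ()
    go (_ ∷ _ ∷ _ ∷ _) p (inj₁ (eq , _)) = contradiction (≡.trans (sym eq) (↭-length p)) λ ()
    go (_ ∷ _ ∷ _ ∷ _) p (inj₂ (eq , _)) = contradiction (≡.trans (sym eq) (↭-length p)) λ ()

  not-small : length (pairs vs) + 2 < size F + length vs → ¬ Small
  not-small lt small with B , B⊑F , ∌ , c ← core₀ lt with edge-or-prisms {B} B⊑F c ∌ base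
  ... | inj₁ e with _ , _ , _ , _ , _ , e′ , sh ← shape {B} B⊑F c e = refute-edge e′ sh
    where
    refute-edge : ∀ {a b c′ u v} → Edge B a b c′ u v → EdgeShape {B} B⊑F c a b c′ u v → ⊥
    refute-edge e (ε₁ p q) = refute-shape small α₁ (edge-unique e) (edge-⊆ e) λ _ →
      missing-meets F (base-meets letters) ∷ base-mem letters ∷ B⊑F auv ∷ B⊑F buv ∷
      missing-meets F p ∷ missing-meets F q ∷ []
      where open Edge e
    refute-edge e (ε₂ p q) = refute-shape small α₂ (edge-unique e) (edge-⊆ e) λ _ →
      missing-meets F (base-meets letters) ∷ base-mem letters ∷ B⊑F auv ∷ B⊑F buv ∷
      missing-meets F p ∷ missing-dom F q ∷ []
      where open Edge e
    refute-edge e (ε₃ p q) = refute-shape small α₃ (edge-unique e) (edge-⊆ e) λ _ →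
      missing-meets F (base-meets letters) ∷ base-mem letters ∷ B⊑F auv ∷ B⊑F buv ∷
      missing-dom F p ∷ missing-dom F q ∷ []
      where open Edge e
    refute-edge e (ε₄ p q) = refute-shape small α₄ (edge-unique e) (edge-⊆ e) λ _ →
      missing-meets F (base-meets letters) ∷ base-mem letters ∷ B⊑F auv ∷ B⊑F buv ∷
      missing-dom F p ∷ missing-dom F q ∷ []
      where open Edge e
  ... | inj₂ (_ , _ , u≢v , p , q) = refute-prisms u≢v (prism-⊑ {B} B⊑F p) (prism-⊑ {B} B⊑F q)
    where
    prisms : ∀ {u v} → Prism F a₀ b₀ c₀ u → Prism F a₀ b₀ c₀ v → u ≢ v → ∀ s →
      (∀ {ws} (un : Unique (a₀ ∷ b₀ ∷ c₀ ∷ u ∷ v ∷ ws)) → All (Refute.Valid _≟_ F good un) (facts (length ws) s)) → ⊥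
    prisms p q u≢v s = refute-shape small s (prism-unique base p q u≢v) (prism-⊆ base p q)
    refute-prisms : ∀ {u v} → u ≢ v → Prism F a₀ b₀ c₀ u → Prism F a₀ b₀ c₀ v → ⊥
    refute-prisms u≢v P@(prism p q r) Q@(prism p′ q′ r′) with prism-kind base P Q u≢v | prism-kind base Q P (≢-sym u≢v)
    ... | inj₁ s | inj₁ t = prisms P Q u≢v β₁ λ _ →
      missing-meets F meets₀ ∷ abc₀ ∷ p ∷ q ∷ r ∷ p′ ∷ q′ ∷ r′ ∷ missing-meets F s ∷ missing-meets F t ∷ []
    ... | inj₁ s | inj₂ t = prisms P Q u≢v β₂ λ _ →
      missing-meets F meets₀ ∷ abc₀ ∷ p ∷ q ∷ r ∷ p′ ∷ q′ ∷ r′ ∷ missing-meets F s ∷ missing-dom F t ∷ []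
    ... | inj₂ s | inj₁ t = prisms Q P (≢-sym u≢v) β₂ λ _ →
      missing-meets F meets₀ ∷ abc₀ ∷ p′ ∷ q′ ∷ r′ ∷ p ∷ q ∷ r ∷ missing-meets F t ∷ missing-dom F s ∷ []
    ... | inj₂ s | inj₂ t = prisms P Q u≢v β₃ λ _ →
      missing-meets F meets₀ ∷ abc₀ ∷ p ∷ q ∷ r ∷ p′ ∷ q′ ∷ r′ ∷ missing-dom F s ∷ missing-dom F t ∷ []

  -- At least eight vertices, with all degrees at least n - 1

  module Large {d} (7≤d : 7 ≤ d) (len : length vs ≡ suc d) (deg : MinDegree F d) where

    private
      Covering : A → List (A × A) → Set
      Covering = Covers u F deg

      degree : ∀ {w} → w ∈ vs → (es : List (A × A)) → Covering w es → d ≤ length es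
      degree = degree-cover u F deg

      tight : ∀ {w} → w ∈ vs → (es : List (A × A)) → Covering w es → length es ≤ d →
        All (λ (s , t) → Mem F w s t) es
      tight = degree-tight u F deg

      remove : ∀ {w} (es : List (A × A)) i → let (x , y) = lookup es i in
        ¬ Mem F w x y → Covering w es → Covering w (removeAt es i)
      remove = covers-removeAt u F deg

      at : ∀ {x y : A} {es : List (A × A)} → (x , y) ∈ es → Linked es x y
      at e∈ = lose e∈ (inj₁ (refl , refl))

      at′ : ∀ {x y : A} {es : List (A × A)} → (x , y) ∈ es → Linked es y x
      at′ e∈ = lose e∈ (inj₂ (refl , refl))

      pattern #0 = here refl
      pattern #1 = there #0
      pattern #2 = there #1
      pattern #3 = there #2
      pattern #4 = there #3
      pattern #5 = there #4
      pattern #6 = there #5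
      pattern beyond₅ i = there (there (there (there (there i))))
      pattern beyond₆ i = there (beyond₅ i)

      d≡ : ∀ {w ws} → vs ↭ w ∷ ws → d ≡ length ws
      d≡ p = suc-injective (≡.trans (sym len) (↭-length p))

      three-more : ∀ {v₁ v₂ v₃ v₄ v₅ ws} → vs ↭ v₁ ∷ v₂ ∷ v₃ ∷ v₄ ∷ v₅ ∷ ws →
        ∃[ w₁ ] ∃[ w₂ ] ∃[ w₃ ] ∃[ ws′ ] ws ≡ w₁ ∷ w₂ ∷ w₃ ∷ ws′
      three-more {ws = ws} p = go ws (≤-trans 7≤d (≤-reflexive (d≡ p)))
        where
        go : ∀ ws → 7 ≤ 4 + length ws → ∃[ w₁ ] ∃[ w₂ ] ∃[ w₃ ] ∃[ ws′ ] ws ≡ w₁ ∷ w₂ ∷ w₃ ∷ ws′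
        go (w₁ ∷ w₂ ∷ w₃ ∷ ws′) le = w₁ , w₂ , w₃ , ws′ , refl
        go [] (s≤s (s≤s (s≤s (s≤s ()))))
        go (_ ∷ []) (s≤s (s≤s (s≤s (s≤s (s≤s ())))))
        go (_ ∷ _ ∷ []) (s≤s (s≤s (s≤s (s≤s (s≤s (s≤s ()))))))

      by-letters : ∀ {a b c w es} → Base a b c → w ≢ a → w ≢ b → w ≢ c →
        (∀ {t} → Mem F w a t → Linked es a t) → (∀ {t} → Mem F w b t → Linked es b t) →
        (∀ {t} → Mem F w c t → Linked es c t) → Covering w es
      by-letters l w≢a w≢b w≢c A′ B′ C′ m with base-meets l m
      ... | inj₁ (inj₁ p) = ⊥-elim (w≢a (sym p))
      ... | inj₁ (inj₂ (inj₁ refl)) = A′ m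
      ... | inj₁ (inj₂ (inj₂ refl)) = linked-sym (A′ (swap₂ F m))
      ... | inj₂ (inj₁ (inj₁ p)) = ⊥-elim (w≢b (sym p))
      ... | inj₂ (inj₁ (inj₂ (inj₁ refl))) = B′ m
      ... | inj₂ (inj₁ (inj₂ (inj₂ refl))) = linked-sym (B′ (swap₂ F m))
      ... | inj₂ (inj₂ (inj₁ p)) = ⊥-elim (w≢c (sym p))
      ... | inj₂ (inj₂ (inj₂ (inj₁ refl))) = C′ m
      ... | inj₂ (inj₂ (inj₂ (inj₂ refl))) = linked-sym (C′ (swap₂ F m))

    -- A triple through a vertex w off these five must meet abc, axy and bxy. Only seven pairs do,
    -- so the degree forces all of them into the link of w. With a second such vertex, the triples
    -- shatter axw.
    no-ε₁ : ∀ {a b c x y} → Edge F a b c x y → Meets F a x y → Meets F b x y → ⊥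
    no-ε₁ {a} {b} {c} {x} {y} e Ma Mb with ws , p ← extractAll (edge-unique e) (edge-⊆ e)
      with w , w′ , _ , ws′ , refl ← three-more p =
      shatter good (0F , 3F , 5F)
        ((0F , 3F , 4F) ∷ (0F , 1F , 5F) ∷ (1F , 3F , 5F) ∷ (1F , 4F , 6F) ∷ (0F , 1F , 2F) ∷
         (1F , 3F , 4F) ∷ (1F , 4F , 5F) ∷ [])
        (rot F (wax full) ∷ auv ∷ rot F (wab full) ∷ rot F (wbx full) ∷ rot F (wby full′) ∷
         base-mem letters ∷ buv ∷ rot F (wby full) ∷ [])
      where
      open Edge e
      un = Unique-resp-↭ p u
      open Named F un renaming (distinct-names to ≠)
      es : List (A × A)
      es = (a , b) ∷ (a , x) ∷ (a , y) ∷ (b , x) ∷ (b , y) ∷ (c , x) ∷ (c , y) ∷ []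
      module _ {w} (w≢a : w ≢ a) (w≢b : w ≢ b) (w≢c : w ≢ c) (w≢x : w ≢ x) (w≢y : w ≢ y) where
        A′ : ∀ {t} → Mem F w a t → Linked es a t
        A′ m with third F Mb m w≢b w≢x w≢y (≠ 0F 1F) (≠ 0F 3F) (≠ 0F 4F)
        ... | inj₁ refl = at #0
        ... | inj₂ (inj₁ refl) = at #1
        ... | inj₂ (inj₂ refl) = at #2
        B′ : ∀ {t} → Mem F w b t → Linked es b t
        B′ m with third F Ma m w≢a w≢x w≢y (≠ 1F 0F) (≠ 1F 3F) (≠ 1F 4F)
        ... | inj₁ refl = at′ #0
        ... | inj₂ (inj₁ refl) = at #3
        ... | inj₂ (inj₂ refl) = at #4
        C′ : ∀ {t} → Mem F w c t → Linked es c t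
        C′ m with third F Ma m w≢a w≢x w≢y (≠ 2F 0F) (≠ 2F 3F) (≠ 2F 4F)
        ... | inj₂ (inj₁ refl) = at #5
        ... | inj₂ (inj₂ refl) = at #6
        ... | inj₁ refl with third F Mb m w≢b w≢x w≢y (≠ 2F 1F) (≠ 2F 3F) (≠ 2F 4F)
        ...   | inj₁ q = ⊥-elim (≠ 0F 1F q)
        ...   | inj₂ (inj₁ q) = ⊥-elim (≠ 0F 3F q)
        ...   | inj₂ (inj₂ q) = ⊥-elim (≠ 0F 4F q)
        everything : w ∈ vs → All (λ (s , t) → Mem F w s t) es
        everything w∈ = tight w∈ es (by-letters letters w≢a w≢b w≢c A′ B′ C′) 7≤d
      full = everything (≠ 5F 0F) (≠ 5F 1F) (≠ 5F 2F) (≠ 5F 3F) (≠ 5F 4F) (∈-resp-↭ (↭-sym p) #5)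
      full′ = everything (≠ 6F 0F) (≠ 6F 1F) (≠ 6F 2F) (≠ 6F 3F) (≠ 6F 4F) (∈-resp-↭ (↭-sym p) #6)
      wab : ∀ {w} → All (λ (s , t) → Mem F w s t) es → Mem F w a b
      wab al = All.lookup al #0
      wax : ∀ {w} → All (λ (s , t) → Mem F w s t) es → Mem F w a x
      wax al = All.lookup al #1
      wbx : ∀ {w} → All (λ (s , t) → Mem F w s t) es → Mem F w b x
      wbx al = All.lookup al #3
      wby : ∀ {w} → All (λ (s , t) → Mem F w s t) es → Mem F w b y
      wby al = All.lookup al #4

    -- A pair in the link of x meets {a, y}, {b, y} and {a, b, c}. It is ab or joins y to a letter,
    -- so x has degree at most four.
    no-ε₃ : ∀ {a b c x y} → Edge F a b c x y → Dom F x a y → Dom F x b y → ⊥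
    no-ε₃ {a} {b} {c} {x} {y} e Da Db = contradiction
      (degree (support F (rot F auv)) es (by-letters letters (≠ 3F 0F) (≠ 3F 1F) (≠ 3F 2F) A′ B′ C′))
      (<⇒≱ (≤-trans (s≤s (s≤s (s≤s (s≤s (s≤s z≤n))))) 7≤d))
      where
      open Edge e
      open Named F (edge-unique e) renaming (distinct-names to ≠)
      es : List (A × A)
      es = (y , a) ∷ (y , b) ∷ (y , c) ∷ (a , b) ∷ []
      A′ : ∀ {t} → Mem F x a t → Linked es a t
      A′ m with dom-third F Db m (≠ 0F 1F) (≠ 0F 4F)
      ... | inj₁ refl = at #3
      ... | inj₂ refl = at′ #0
      B′ : ∀ {t} → Mem F x b t → Linked es b t
      B′ m with dom-third F Da m (≠ 1F 0F) (≠ 1F 4F)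
      ... | inj₁ refl = at′ #3
      ... | inj₂ refl = at′ #1
      C′ : ∀ {t} → Mem F x c t → Linked es c t
      C′ m with dom-third F Da m (≠ 2F 0F) (≠ 2F 4F)
      ... | inj₂ refl = at′ #2
      ... | inj₁ refl = ⊥-elim (dom-miss F Db m (≠ 2F 1F) (≠ 2F 4F) (≠ 0F 1F) (≠ 0F 4F))

    private
      module Mixed {a b c x y} (e : Edge F a b c x y) (Ma : Meets F a x y) (Db : Dom F x b y) where
        open Edge e

        -- A pair in the link of x contains b or is ay or cy. These are n = `d + 1` pairs, so at
        -- most one of them can be absent.
        absent-twice : ∀ {w w′ ws} → vs ↭ a ∷ b ∷ c ∷ x ∷ y ∷ w ∷ w′ ∷ ws →
          Mem F b x w ⊎ Mem F b x w′
        absent-twice {w} {w′} {ws} p with mem? F b x w | mem? F b x w′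
        ... | yes m | _ = inj₁ m
        ... | no _ | yes m = inj₂ m
        ... | no n | no n′ = contradiction
          (degree (support F (rot F auv)) _
            (remove (removeAt es 6F) 5F (λ m → n (swap₁ F m)) (remove es 6F (λ m → n′ (swap₁ F m))
              (by-letters letters (≠ 3F 0F) (≠ 3F 1F) (≠ 3F 2F) A′ B′ C′))))
          (<⇒≱ (≤-reflexive (sym (≡.trans (d≡ p) (cong (6 +_) (sym (length-map (b ,_) ws)))))))
          where
          un = Unique-resp-↭ p u
          open Named F un renaming (distinct-names to ≠)
          es : List (A × A)
          es = (a , b) ∷ (b , c) ∷ (b , y) ∷ (a , y) ∷ (c , y) ∷ (b , w) ∷ (b , w′) ∷ map (b ,_) ws
          A′ : ∀ {t} → Mem F x a t → Linked es a t
          A′ m with dom-third F Db m (≠ 0F 1F) (≠ 0F 4F)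
          ... | inj₁ refl = at #0
          ... | inj₂ refl = at #3
          B′ : ∀ {t} → Mem F x b t → Linked es b t
          B′ m with ∈-resp-↭ p (support F (rot′ F m))
          ... | #0 = at′ #0
          ... | #1 = ⊥-elim (distinct₂₃ F m refl)
          ... | #2 = at #1
          ... | #3 = ⊥-elim (distinct₁₃ F m refl)
          ... | #4 = at #2
          ... | beyond₅ t∈ = at (beyond₅ (∈-map⁺ (b ,_) t∈))
          C′ : ∀ {t} → Mem F x c t → Linked es c t
          C′ m with dom-third F Db m (≠ 2F 1F) (≠ 2F 4F)
          ... | inj₁ refl = at′ #1
          ... | inj₂ refl = at #4

        module _ {w w′ ws} (p : vs ↭ a ∷ b ∷ c ∷ x ∷ y ∷ w ∷ w′ ∷ ws)
          (bxw : Mem F b x w) (bxw′ : Mem F b x w′) where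
          private
            un = Unique-resp-↭ p u
          open Named F un renaming (distinct-names to ≠)

          private
            es : List (A × A)
            es = (a , b) ∷ (a , c) ∷ (b , x) ∷ (b , y) ∷ (c , y) ∷ (a , y) ∷ map (a ,_) (w′ ∷ ws)

            w∈ : w ∈ vs
            w∈ = ∈-resp-↭ (↭-sym p) #5

            size-es : d ≡ 6 + length (map (a ,_) ws)
            size-es = ≡.trans (d≡ p) (cong (6 +_) (sym (length-map (a ,_) ws)))

            off-x : ∀ {l} → l ≢ b → l ≢ y → ¬ Mem F w l x
            off-x l≢b l≢y m = dom-miss F Db (rot F (rot F m)) (≠ 5F 1F) (≠ 5F 4F) l≢b l≢y

            covering : Covering w es
            covering = by-letters letters (≠ 5F 0F) (≠ 5F 1F) (≠ 5F 2F) A′ B′ C′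
              where
              A′ : ∀ {t} → Mem F w a t → Linked es a t
              A′ m with ∈-resp-↭ p (support F (rot′ F m))
              ... | #0 = ⊥-elim (distinct₂₃ F m refl)
              ... | #1 = at #0
              ... | #2 = at #1
              ... | #3 = ⊥-elim (off-x (≠ 0F 1F) (≠ 0F 4F) m)
              ... | #4 = at #5
              ... | #5 = ⊥-elim (distinct₁₃ F m refl)
              ... | beyond₆ t∈ = at (beyond₆ (∈-map⁺ (a ,_) t∈))
              B′ : ∀ {t} → Mem F w b t → Linked es b t
              B′ m with third F Ma m (≠ 5F 0F) (≠ 5F 3F) (≠ 5F 4F) (≠ 1F 0F) (≠ 1F 3F) (≠ 1F 4F)
              ... | inj₁ refl = at′ #0
              ... | inj₂ (inj₁ refl) = at #2
              ... | inj₂ (inj₂ refl) = at #3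
              C′ : ∀ {t} → Mem F w c t → Linked es c t
              C′ m with third F Ma m (≠ 5F 0F) (≠ 5F 3F) (≠ 5F 4F) (≠ 2F 0F) (≠ 2F 3F) (≠ 2F 4F)
              ... | inj₁ refl = at′ #1
              ... | inj₂ (inj₁ refl) = ⊥-elim (off-x (≠ 2F 1F) (≠ 2F 4F) m)
              ... | inj₂ (inj₂ refl) = at #4

            by-or-cy : Mem F w b y ⊎ Mem F w c y
            by-or-cy with mem? F w b y | mem? F w c y
            ... | yes m | _ = inj₁ m
            ... | no _ | yes m = inj₂ m
            ... | no n | no n′ = contradiction
              (degree w∈ _ (remove (removeAt es 4F) 3F n (remove es 4F n′ covering)))
              (<⇒≱ (≤-reflexive (sym size-es)))

            ab-or-ac : Mem F w a b ⊎ Mem F w a c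
            ab-or-ac with mem? F w a b | mem? F w a c
            ... | yes m | _ = inj₁ m
            ... | no _ | yes m = inj₂ m
            ... | no n | no n′ = contradiction
              (degree w∈ _ (remove (removeAt es 1F) 0F n (remove es 1F n′ covering)))
              (<⇒≱ (≤-reflexive (sym size-es)))

            -- The list `es` has `d + 1` pairs, so at most one of them is absent from the link of w.
            -- Hence one of wby, wcy and one of wab, wac are present; they realise {y, w} and {a, w}
            -- on ayw, and ayw would be shattered.
            ¬ay : ¬ Mem F w a y
            ¬ay m with by-or-cy | ab-or-ac
            ... | inj₁ n | inj₁ n′ = shatter good (0F , 4F , 5F)
              ((0F , 3F , 4F) ∷ (1F , 3F , 6F) ∷ (0F , 1F , 2F) ∷ (1F , 3F , 4F) ∷ (1F , 3F , 5F) ∷ (1F , 4F , 5F) ∷ (0F , 1F , 5F) ∷ [])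
              (rot F m ∷ auv ∷ bxw′ ∷ base-mem letters ∷ buv ∷ bxw ∷ rot F n ∷ rot F n′ ∷ [])
            ... | inj₁ n | inj₂ n′ = shatter good (0F , 4F , 5F)
              ((0F , 3F , 4F) ∷ (1F , 3F , 6F) ∷ (0F , 1F , 2F) ∷ (1F , 3F , 4F) ∷ (1F , 3F , 5F) ∷ (1F , 4F , 5F) ∷ (0F , 2F , 5F) ∷ [])
              (rot F m ∷ auv ∷ bxw′ ∷ base-mem letters ∷ buv ∷ bxw ∷ rot F n ∷ rot F n′ ∷ [])
            ... | inj₂ n | inj₁ n′ = shatter good (0F , 4F , 5F)
              ((0F , 3F , 4F) ∷ (1F , 3F , 6F) ∷ (0F , 1F , 2F) ∷ (1F , 3F , 4F) ∷ (1F , 3F , 5F) ∷ (2F , 4F , 5F) ∷ (0F , 1F , 5F) ∷ [])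
              (rot F m ∷ auv ∷ bxw′ ∷ base-mem letters ∷ buv ∷ bxw ∷ rot F n ∷ rot F n′ ∷ [])
            ... | inj₂ n | inj₂ n′ = shatter good (0F , 4F , 5F)
              ((0F , 3F , 4F) ∷ (1F , 3F , 6F) ∷ (0F , 1F , 2F) ∷ (1F , 3F , 4F) ∷ (1F , 3F , 5F) ∷ (2F , 4F , 5F) ∷ (0F , 2F , 5F) ∷ [])
              (rot F m ∷ auv ∷ bxw′ ∷ base-mem letters ∷ buv ∷ bxw ∷ rot F n ∷ rot F n′ ∷ [])

          full : All (λ (s , t) → Mem F w s t) (removeAt es 5F)
          full = tight w∈ (removeAt es 5F) (remove es 5F ¬ay covering) (≤-reflexive (sym size-es))

        -- By `¬ay` the pair ay is the single absence in the list for w, and likewise for w′. All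
        -- the other pairs are in the links, and the resulting triples shatter byw.
        impossible : ∀ {w w′ ws} → vs ↭ a ∷ b ∷ c ∷ x ∷ y ∷ w ∷ w′ ∷ ws → Mem F b x w → Mem F b x w′ → ⊥
        impossible p bxw bxw′ = Named.shatter F (Unique-resp-↭ p u) good (1F , 4F , 5F)
          ((1F , 3F , 4F) ∷ (1F , 3F , 5F) ∷ (2F , 4F , 5F) ∷ (0F , 2F , 6F) ∷ (0F , 1F , 2F) ∷ (0F , 3F , 4F) ∷ (0F , 5F , 6F) ∷ [])
          (rot F (All.lookup f #3) ∷ buv ∷ bxw ∷ rot F (All.lookup f #4) ∷ rot F (All.lookup f′ #1) ∷
           base-mem letters ∷ auv ∷ swap₁ F (All.lookup f #5) ∷ [])
          where
          f = full p bxw bxw′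
          f′ = full (↭-trans p (prep _ (prep _ (prep _ (prep _ (prep _ (swap _ _ refl))))))) bxw′ bxw

    no-ε₂ : ∀ {a b c x y} → Edge F a b c x y → Meets F a x y → Dom F x b y → ⊥
    no-ε₂ {a} {b} {c} {x} {y} e Ma Db with ws , p ← extractAll (edge-unique e) (edge-⊆ e)
      -- Three further vertices exist because there are at least eight in all: at most one of the
      -- three triples bxw is absent, and `impossible` needs two.
      with w₁ , w₂ , w₃ , ws′ , refl ← three-more p = go (absent-twice p) (absent-twice p₁₃) (absent-twice p₂₃)
      where
      open Mixed e Ma Db
      past₅ : ∀ {xs ys : List A} → xs ↭ ys → a ∷ b ∷ c ∷ x ∷ y ∷ xs ↭ a ∷ b ∷ c ∷ x ∷ y ∷ ys
      past₅ q = prep _ (prep _ (prep _ (prep _ (prep _ q))))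
      p₁₃ : vs ↭ a ∷ b ∷ c ∷ x ∷ y ∷ w₁ ∷ w₃ ∷ w₂ ∷ ws′
      p₁₃ = ↭-trans p (past₅ (prep _ (swap _ _ refl)))
      p₂₃ : vs ↭ a ∷ b ∷ c ∷ x ∷ y ∷ w₂ ∷ w₃ ∷ w₁ ∷ ws′
      p₂₃ = ↭-trans p (past₅ (↭-trans (swap _ _ refl) (prep _ (swap _ _ refl))))
      go : Mem F b x w₁ ⊎ Mem F b x w₂ → Mem F b x w₁ ⊎ Mem F b x w₃ → Mem F b x w₂ ⊎ Mem F b x w₃ → ⊥
      go (inj₁ m) _ (inj₁ n) = impossible p m n
      go (inj₁ m) _ (inj₂ n) = impossible p₁₃ m n
      go (inj₂ m) (inj₁ n) _ = impossible p n m
      go (inj₂ m) (inj₂ n) _ = impossible p₂₃ m n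

    -- Spines: the edges that survive

    record Spine (H : TripleSystem vs) (a b c x y : A) : Set where
      constructor spine
      field
        letters : Base a b c
        axy : Mem H a x y
        bxy : Mem H b x y
        abx : Mem H a b x
        aby : Mem H a b y
        dom-x : Dom F x a y
        dom-y : Dom F y b x
        x≢c : x ≢ c
        y≢c : y ≢ c

    spine-⊑ : ∀ {H a b c x y} → H ⊑ F → Spine H a b c x y → Spine F a b c x y
    spine-⊑ H⊑F (spine l p q r s d d′ x≢c y≢c) = spine l (H⊑F p) (H⊑F q) (H⊑F r) (H⊑F s) d d′ x≢c y≢c

    SomeSpine : TripleSystem vs → Set
    SomeSpine H = ∃[ a ] ∃[ b ] ∃[ c ] ∃[ x ] ∃[ y ] Spine H a b c x y

    -- In the shape `ε₄`, a core triple through bx other than bxy must contain a, by domination at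
    -- x; a core triple through ay other than axy must contain b, by domination at y.
    edge⇒spine : ∀ {B} (B⊑F : B ⊑ F) → Core B → SomeEdge B → SomeSpine B
    edge⇒spine {B} B⊑F core e with shape {B} B⊑F core e
    ... | a , b , c , x , y , edge l axy bxy x≢c y≢c , sh = go sh
      where
      open Core core
      e′ : Edge F a b c x y
      e′ = edge l (B⊑F axy) (B⊑F bxy) x≢c y≢c
      a≢b = distinct F (base-mem l)
      go : EdgeShape {B} B⊑F core a b c x y → SomeSpine B
      go (ε₁ p q) = ⊥-elim (no-ε₁ e′ p q)
      go (ε₂ p q) = ⊥-elim (no-ε₂ e′ p q)
      go (ε₃ p q) = ⊥-elim (no-ε₃ e′ p q)
      go (ε₄ p q) with t , t≢y , m ← again (swap₁ B bxy) | s , s≢x , n ← again (rot′ B axy)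
        with dom-third F p (B⊑F m) (≢-sym a≢b) (distinct₁₃ B bxy)
           | dom-third F q (B⊑F n) a≢b (distinct B axy)
      ... | inj₂ t≡y | _ = ⊥-elim (t≢y t≡y)
      ... | inj₁ _ | inj₂ s≡x = ⊥-elim (s≢x s≡x)
      ... | inj₁ refl | inj₁ refl =
        a , b , c , x , y , spine l axy bxy (rev B m) (rot B n) p q x≢c y≢c

    private
      Off : A → Set
      Off t = ¬ In t a₀ b₀ c₀

      off : ∀ {a b c t} → Base a b c → t ≢ a → t ≢ b → t ≢ c → Off t
      off l t≢a t≢b t≢c i = [ t≢a , [ t≢b , t≢c ]′ ]′ (base-⊇ l i)

      off₁ : ∀ {a b c t} → Base a b c → Off t → t ≢ a
      off₁ l o t≡a = o (base-⊆ l (inj₁ t≡a))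

      off₂ : ∀ {a b c t} → Base a b c → Off t → t ≢ b
      off₂ l o t≡b = o (base-⊆ l (inj₂ (inj₁ t≡b)))

      off₃ : ∀ {a b c t} → Base a b c → Off t → t ≢ c
      off₃ l o t≡c = o (base-⊆ l (inj₂ (inj₂ t≡c)))

      spine-off : ∀ {H a b c x y} → Spine H a b c x y → Off x × Off y
      spine-off {H} s =
        off letters (≢-sym (distinct H axy)) (≢-sym (distinct H bxy)) x≢c ,
        off letters (≢-sym (distinct₁₃ H axy)) (≢-sym (distinct₁₃ H bxy)) y≢c
        where open Spine s

    private
      -- Counting at x leaves no room for the triple c x y to be absent
      closing : ∀ {a b c x y z w ws} → Spine F a b c x y →
        vs ↭ a ∷ b ∷ c ∷ x ∷ y ∷ z ∷ w ∷ ws → ¬ Mem F x a z → Mem F x y c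
      closing {a} {b} {c} {x} {y} {z} {w} {ws} s p ¬az =
        All.lookup (tight (support F (rot F axy)) es (by-letters letters (≠ 3F 0F) (≠ 3F 1F) (≠ 3F 2F) A′ B′ C′)
          (≤-reflexive (≡.trans (cong (6 +_) (length-map (a ,_) ws)) (sym (d≡ p))))) #3
        where
        open Spine s
        un = Unique-resp-↭ p u
        open Named F un renaming (distinct-names to ≠)
        es : List (A × A)
        es = (a , b) ∷ (a , c) ∷ (y , b) ∷ (y , c) ∷ (a , y) ∷ (a , w) ∷ map (a ,_) ws
        A′ : ∀ {t} → Mem F x a t → Linked es a t
        A′ m with ∈-resp-↭ p (support F (rot′ F m))
        ... | #0 = ⊥-elim (distinct₂₃ F m refl)
        ... | #1 = at #0
        ... | #2 = at #1
        ... | #3 = ⊥-elim (distinct₁₃ F m refl)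
        ... | #4 = at #4
        ... | #5 = ⊥-elim (¬az m)
        ... | #6 = at #5
        ... | there (beyond₆ t∈) = at (beyond₆ (∈-map⁺ (a ,_) t∈))
        B′ : ∀ {t} → Mem F x b t → Linked es b t
        B′ m with dom-third F dom-x m (≠ 1F 0F) (≠ 1F 4F)
        ... | inj₁ refl = at′ #0
        ... | inj₂ refl = at′ #2
        C′ : ∀ {t} → Mem F x c t → Linked es c t
        C′ m with dom-third F dom-x m (≠ 2F 0F) (≠ 2F 4F)
        ... | inj₁ refl = at′ #1
        ... | inj₂ refl = at′ #3

      -- If axx′ and axy′ were both present, the dominations at x′ and y′ would force a = a′ and a =
      -- b′. So one of them is absent, and `closing` applies.
      closing′ : ∀ {a b c x y a′ b′ c′ x′ y′ ws} → Spine F a b c x y → Spine F a′ b′ c′ x′ y′ →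
        vs ↭ a ∷ b ∷ c ∷ x ∷ y ∷ x′ ∷ y′ ∷ ws → Mem F c x y
      closing′ {a} {x = x} {y} {a′} {b′} {x′ = x′} {y′} s s′ p with mem? F x a x′ | mem? F x a y′
      ... | no ¬m | _ = rot′ F (closing s p ¬m)
      ... | yes _ | no ¬n =
        rot′ F (closing s (↭-trans p (prep _ (prep _ (prep _ (prep _ (prep _ (swap _ _ refl))))))) ¬n)
      ... | yes m | yes n = ⊥-elim (distinct F (base-mem S′.letters) (≡.trans (sym a≡a′) a≡b′))
        where
        module S = Spine s
        module S′ = Spine s′
        open Named F (Unique-resp-↭ p u) renaming (distinct-names to ≠)
        o = proj₁ (spine-off s)
        a≡a′ : a ≡ a′
        a≡a′ with S′.dom-x (rot′ F m)
        ... | inj₁ (inj₁ q) = ⊥-elim (off₁ S′.letters o q)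
        ... | inj₁ (inj₂ q) = ⊥-elim (≠ 3F 6F q)
        ... | inj₂ (inj₁ q) = q
        ... | inj₂ (inj₂ q) = ⊥-elim (≠ 0F 6F q)
        a≡b′ : a ≡ b′
        a≡b′ with S′.dom-y (rot′ F n)
        ... | inj₁ (inj₁ q) = ⊥-elim (off₂ S′.letters o q)
        ... | inj₁ (inj₂ q) = ⊥-elim (≠ 3F 5F q)
        ... | inj₂ (inj₁ q) = q
        ... | inj₂ (inj₂ q) = ⊥-elim (≠ 0F 5F q)

    -- If the pairs xy and x′y′ shared a vertex, domination there would identify them and put axy
    -- into `H`. So they are disjoint, `closing′` completes both spines by the third letter, and the
    -- triples from a letter to xy or x′y′, with abx and abc, shatter abx.
    two-spines : ∀ {H a b c x y} → SomeSpine H → H ⊑ F → Spine F a b c x y → ¬ Mem H a x y → ⊥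
    two-spines {H} {a} {b} {c} {x} {y} (a′ , b′ , c′ , x′ , y′ , s″) H⊑F s ¬axy =
      shatter good (0F , 1F , 3F)
        ((0F , 1F , 2F) ∷ (0F , 3F , 4F) ∷ (1F , 3F , 4F) ∷ (2F , 5F , 6F) ∷ (0F , 5F , 6F) ∷ (1F , 5F , 6F) ∷ (2F , 3F , 4F) ∷ [])
        (S.abx ∷ base-mem S.letters ∷ S.axy ∷ S.bxy ∷ all′ (inj₂ (inj₂ refl)) ∷ all′ (inj₁ refl) ∷ all′ (inj₂ (inj₁ refl)) ∷
         closing′ s s′ (proj₂ (extractAll un₇ ⊆₇)) ∷ [])
      where
      s′ = spine-⊑ H⊑F s″
      module S = Spine s
      module S′ = Spine s′
      module S″ = Spine s″
      ox = proj₁ (spine-off s)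
      oy = proj₂ (spine-off s)
      ox′ = proj₁ (spine-off s′)
      oy′ = proj₂ (spine-off s′)
      a′≢b′ = distinct F (base-mem S′.letters)
      same-ends : Mem H a′ x y → Mem H b′ x y → Mem F a′ b′ x → ⊥
      same-ends m n k = dom-miss F S.dom-x (rot′ F k) (λ where refl → ¬axy m) (≢-sym (off₁ S′.letters oy))
        (λ where refl → ¬axy n) (≢-sym (off₂ S′.letters oy))
      ≢x : ∀ {w w′} → Off w′ → Mem H a′ w w′ → Mem H b′ w w′ → Mem F a′ b′ w → w ≢ x
      ≢x o′ m n k refl with S.dom-x (swap₁ F (H⊑F m)) | S.dom-x (swap₁ F (H⊑F n))
      ... | inj₁ (inj₁ q) | inj₁ (inj₁ r) = a′≢b′ (≡.trans q (sym r))
      ... | inj₁ (inj₂ refl) | _ = off₁ S′.letters oy refl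
      ... | _ | inj₁ (inj₂ refl) = off₂ S′.letters oy refl
      ... | inj₂ (inj₁ refl) | _ = off₁ S.letters o′ refl
      ... | _ | inj₂ (inj₁ refl) = off₁ S.letters o′ refl
      ... | inj₂ (inj₂ refl) | _ = same-ends m n k
      ... | _ | inj₂ (inj₂ refl) = same-ends m n k
      ≢y : ∀ {w w′} → Off w′ → Mem H a′ w w′ → Mem H b′ w w′ → Mem F a′ b′ w′ → w ≢ y
      ≢y o′ m n k refl with S.dom-y (swap₁ F (H⊑F m)) | S.dom-y (swap₁ F (H⊑F n))
      ... | inj₁ (inj₁ q) | inj₁ (inj₁ r) = a′≢b′ (≡.trans q (sym r))
      ... | inj₁ (inj₂ refl) | _ = off₁ S′.letters ox refl
      ... | _ | inj₁ (inj₂ refl) = off₂ S′.letters ox refl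
      ... | inj₂ (inj₁ refl) | _ = off₂ S.letters o′ refl
      ... | _ | inj₂ (inj₁ refl) = off₂ S.letters o′ refl
      ... | inj₂ (inj₂ refl) | _ = same-ends (swap₂ H m) (swap₂ H n) k
      ... | _ | inj₂ (inj₂ refl) = same-ends (swap₂ H m) (swap₂ H n) k
      x′≢x = ≢x oy′ S″.axy S″.bxy S′.abx
      x′≢y = ≢y oy′ S″.axy S″.bxy S′.aby
      y′≢x = ≢x ox′ (swap₂ H S″.axy) (swap₂ H S″.bxy) S′.aby
      y′≢y = ≢y ox′ (swap₂ H S″.axy) (swap₂ H S″.bxy) S′.abx
      un₇ : Unique (a ∷ b ∷ c ∷ x ∷ y ∷ x′ ∷ y′ ∷ [])
      un₇ with (ab ∷ ac ∷ []) ∷ (bc ∷ []) ∷ _ ← unique₃ F (base-mem S.letters) =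
        (ab ∷ ac ∷ ≢-sym (off₁ S.letters ox) ∷ ≢-sym (off₁ S.letters oy) ∷
           ≢-sym (off₁ S.letters ox′) ∷ ≢-sym (off₁ S.letters oy′) ∷ []) ∷
        (bc ∷ ≢-sym (off₂ S.letters ox) ∷ ≢-sym (off₂ S.letters oy) ∷
           ≢-sym (off₂ S.letters ox′) ∷ ≢-sym (off₂ S.letters oy′) ∷ []) ∷
        (≢-sym (off₃ S.letters ox) ∷ ≢-sym (off₃ S.letters oy) ∷
           ≢-sym (off₃ S.letters ox′) ∷ ≢-sym (off₃ S.letters oy′) ∷ []) ∷
        (distinct₂₃ F S.axy ∷ ≢-sym x′≢x ∷ ≢-sym y′≢x ∷ []) ∷
        (≢-sym x′≢y ∷ ≢-sym y′≢y ∷ []) ∷ (distinct₂₃ F S′.axy ∷ []) ∷ [] ∷ []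
      ⊆₇ : (a ∷ b ∷ c ∷ x ∷ y ∷ x′ ∷ y′ ∷ []) ⊆ vs
      ⊆₇ #0 = support F S.axy
      ⊆₇ #1 = support F S.bxy
      ⊆₇ #2 = support F (rot′ F (base-mem S.letters))
      ⊆₇ #3 = support F (rot F S.axy)
      ⊆₇ #4 = support F (rot′ F S.axy)
      ⊆₇ #5 = support F (rot F S′.axy)
      ⊆₇ #6 = support F (rot′ F S′.axy)
      open Named F un₇
      letters′ : ∀ {l} → In l a b c → In l a′ b′ c′
      letters′ i = base-⊇ S′.letters (base-⊆ S.letters i)
      un₇′ : Unique (a′ ∷ b′ ∷ c′ ∷ x′ ∷ y′ ∷ x ∷ y ∷ [])
      un₇′ with (ab ∷ ac ∷ []) ∷ (bc ∷ []) ∷ _ ← unique₃ F (base-mem S′.letters) =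
        (ab ∷ ac ∷ ≢-sym (off₁ S′.letters ox′) ∷ ≢-sym (off₁ S′.letters oy′) ∷
           ≢-sym (off₁ S′.letters ox) ∷ ≢-sym (off₁ S′.letters oy) ∷ []) ∷
        (bc ∷ ≢-sym (off₂ S′.letters ox′) ∷ ≢-sym (off₂ S′.letters oy′) ∷
           ≢-sym (off₂ S′.letters ox) ∷ ≢-sym (off₂ S′.letters oy) ∷ []) ∷
        (≢-sym (off₃ S′.letters ox′) ∷ ≢-sym (off₃ S′.letters oy′) ∷
           ≢-sym (off₃ S′.letters ox) ∷ ≢-sym (off₃ S′.letters oy) ∷ []) ∷
        (distinct₂₃ F S′.axy ∷ x′≢x ∷ x′≢y ∷ []) ∷
        (y′≢x ∷ y′≢y ∷ []) ∷ (distinct₂₃ F S.axy ∷ []) ∷ [] ∷ []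
      ⊆₇′ : (a′ ∷ b′ ∷ c′ ∷ x′ ∷ y′ ∷ x ∷ y ∷ []) ⊆ vs
      ⊆₇′ #0 = support F S′.axy
      ⊆₇′ #1 = support F S′.bxy
      ⊆₇′ #2 = support F (rot′ F (base-mem S′.letters))
      ⊆₇′ #3 = support F (rot F S′.axy)
      ⊆₇′ #4 = support F (rot′ F S′.axy)
      ⊆₇′ #5 = support F (rot F S.axy)
      ⊆₇′ #6 = support F (rot′ F S.axy)
      all′ : ∀ {l} → In l a b c → Mem F l x′ y′
      all′ i with letters′ i
      ... | inj₁ refl = S′.axy
      ... | inj₂ (inj₁ refl) = S′.bxy
      ... | inj₂ (inj₂ refl) = closing′ s′ s (proj₂ (extractAll un₇′ ⊆₇′))

    -- Two prisms over the meeting triple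

    private
      Star Empty : A → A → Set
      Star l z = ∀ {s t} → Mem F l s t → Off s → Off t → s ≡ z ⊎ t ≡ z
      Empty l z = ∀ {t} → Mem F z l t → ¬ Off t

      Thin : A → A → Set
      Thin l w = ∃[ z ] (∀ {t} → Mem F w l t → Off t → t ≡ z)

      -- Three pairs of letters and one further pair for each letter bound the degree of w by six.
      no-thin : ∀ {a b c w} → Base a b c → Off w → w ∈ vs → Thin a w → Thin b w → Thin c w → ⊥
      no-thin {a} {b} {c} {w} l o w∈ (p , P) (q , Q) (r , R) =
        contradiction (degree w∈ es (by-letters l (off₁ l o) (off₂ l o) (off₃ l o) A′ B′ C′)) (<⇒≱ 7≤d)
        where
        es : List (A × A)
        es = (a , b) ∷ (a , c) ∷ (b , c) ∷ (a , p) ∷ (b , q) ∷ (c , r) ∷ []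
        A′ : ∀ {t} → Mem F w a t → Linked es a t
        A′ {t} m with in? _≟_ t a b c
        ... | yes (inj₁ refl) = ⊥-elim (distinct₂₃ F m refl)
        ... | yes (inj₂ (inj₁ refl)) = at #0
        ... | yes (inj₂ (inj₂ refl)) = at #1
        ... | no ¬i with refl ← P m (¬i ∘ base-⊇ l) = at #3
        B′ : ∀ {t} → Mem F w b t → Linked es b t
        B′ {t} m with in? _≟_ t a b c
        ... | yes (inj₁ refl) = at′ #0
        ... | yes (inj₂ (inj₁ refl)) = ⊥-elim (distinct₂₃ F m refl)
        ... | yes (inj₂ (inj₂ refl)) = at #2
        ... | no ¬i with refl ← Q m (¬i ∘ base-⊇ l) = at #4
        C′ : ∀ {t} → Mem F w c t → Linked es c t
        C′ {t} m with in? _≟_ t a b c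
        ... | yes (inj₁ refl) = at′ #1
        ... | yes (inj₂ (inj₁ refl)) = at′ #2
        ... | yes (inj₂ (inj₂ refl)) = ⊥-elim (distinct₂₃ F m refl)
        ... | no ¬i with refl ← R m (¬i ∘ base-⊇ l) = at #5

      module TwoPrisms {x y} (ox : Off x) (oy : Off y) (x≢y : x ≢ y) (x∈ : x ∈ vs) (y∈ : y ∈ vs) where

        Tag : A → Set
        Tag l = (Star l x ⊎ Empty l x) × (Star l y ⊎ Empty l y)

        empty-thin : ∀ {l z} → Empty l z → Thin l z
        empty-thin {z = z} e = z , λ m o → ⊥-elim (e m o)

        star-thin : ∀ {l w z} → Off w → w ≢ z → Star l z → Thin l w
        star-thin {z = z} ow w≢z s = z , λ m o → [ (λ q → ⊥-elim (w≢z q)) , id ]′ (s (swap₁ F m) ow o)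

        thin-x : ∀ {l} → Tag l → Thin l x ⊎ Star l x × Empty l y
        thin-x (inj₂ e , _) = inj₁ (empty-thin e)
        thin-x (inj₁ s , inj₁ t) = inj₁ (star-thin ox x≢y t)
        thin-x (inj₁ s , inj₂ e) = inj₂ ((λ {_} {_} → s) , λ {_} → e)

        thin-y : ∀ {l} → Tag l → Thin l y ⊎ Empty l x
        thin-y (_ , inj₂ e) = inj₁ (empty-thin e)
        thin-y (inj₁ s , inj₁ t) = inj₁ (star-thin oy (≢-sym x≢y) s)
        thin-y (inj₂ e , inj₁ t) = inj₂ e

        thin-w : ∀ {l w} → Off w → w ≢ x → w ≢ y → Tag l → Thin l w ⊎ Empty l x × Empty l y
        thin-w o w≢x w≢y (inj₁ s , _) = inj₁ (star-thin o w≢x s)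
        thin-w o w≢x w≢y (inj₂ _ , inj₁ s) = inj₁ (star-thin o w≢y s)
        thin-w o w≢x w≢y (inj₂ e , inj₂ f) = inj₂ ((λ {_} → e) , λ {_} → f)

        -- The link of x is covered by the three pairs of letters and the pairs at with t off abc
        -- and different from x and y. That makes n - 2 = `d - 1` pairs.
        lone : ∀ {a b c} → Base a b c → Empty a y → Empty b x → Empty c x → ⊥
        lone {a} {b} {c} l ea eb ec with ws , p ← extractAll
          (unique₅ l (off₁ l ox) (off₂ l ox) (off₃ l ox) (off₁ l oy) (off₂ l oy) (off₃ l oy) x≢y) (⊆₅ l x∈ y∈) =
          contradiction (degree x∈ es (by-letters l (off₁ l ox) (off₂ l ox) (off₃ l ox) A′ B′ C′))
            (<⇒≱ (≤-reflexive (sym (≡.trans (d≡ p) (cong (4 +_) (sym (length-map (a ,_) ws)))))))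
          where
          es : List (A × A)
          es = (a , b) ∷ (a , c) ∷ (b , c) ∷ map (a ,_) ws
          A′ : ∀ {t} → Mem F x a t → Linked es a t
          A′ m with ∈-resp-↭ p (support F (rot′ F m))
          ... | #0 = ⊥-elim (distinct₂₃ F m refl)
          ... | #1 = at #0
          ... | #2 = at #1
          ... | #3 = ⊥-elim (distinct₁₃ F m refl)
          ... | #4 = ⊥-elim (ea (rev F m) ox)
          ... | beyond₅ t∈ = at (there (there (there (∈-map⁺ (a ,_) t∈))))
          B′ : ∀ {t} → Mem F x b t → Linked es b t
          B′ {t} m with in? _≟_ t a b c
          ... | yes (inj₁ refl) = at′ #0
          ... | yes (inj₂ (inj₁ refl)) = ⊥-elim (distinct₂₃ F m refl)
          ... | yes (inj₂ (inj₂ refl)) = at #2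
          ... | no ¬i = ⊥-elim (eb m (¬i ∘ base-⊇ l))
          C′ : ∀ {t} → Mem F x c t → Linked es c t
          C′ {t} m with in? _≟_ t a b c
          ... | yes (inj₁ refl) = at′ #1
          ... | yes (inj₂ (inj₁ refl)) = at′ #2
          ... | yes (inj₂ (inj₂ refl)) = ⊥-elim (distinct₂₃ F m refl)
          ... | no ¬i = ⊥-elim (ec m (¬i ∘ base-⊇ l))

        -- A vertex w off abc, x and y contradicts `no-thin`, unless b or c is empty at both x and
        -- y. Then y contradicts it, unless the remaining letter is empty at x, which is the case of
        -- `lone`.
        two-left : ∀ {a b c} → Base a b c → Star a x → Empty a y → Tag b → Tag c → ⊥
        two-left {a} {b} {c} l s e tb tc with ws , p ← extractAll
          (unique₅ l (off₁ l ox) (off₂ l ox) (off₃ l ox) (off₁ l oy) (off₂ l oy) (off₃ l oy) x≢y) (⊆₅ l x∈ y∈)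
          with w , _ , _ , _ , refl ← three-more p = go (thin-w ow w≢x w≢y tb) (thin-w ow w≢x w≢y tc)
          where
          open Named F (Unique-resp-↭ p u) renaming (distinct-names to ≠)
          ow = off l (≠ 5F 0F) (≠ 5F 1F) (≠ 5F 2F)
          w≢x = ≠ 5F 3F
          w≢y = ≠ 5F 4F
          go : Thin b w ⊎ Empty b x × Empty b y → Thin c w ⊎ Empty c x × Empty c y → ⊥
          go (inj₁ m) (inj₁ n) =
            no-thin l ow (∈-resp-↭ (↭-sym p) #5) (star-thin ow w≢x s) m n
          go (inj₂ (f , g)) _ with thin-y tc
          ... | inj₁ n = no-thin l oy y∈ (empty-thin e) (empty-thin g) n
          ... | inj₂ h = lone l e f h
          go (inj₁ _) (inj₂ (f , g)) with thin-y tb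
          ... | inj₁ n = no-thin l oy y∈ (empty-thin e) n (empty-thin g)
          ... | inj₂ h = lone l e h f

        tags : ∀ {a b c} → Base a b c → Tag a → Tag b → Tag c → ⊥
        tags l ta tb tc with thin-x ta | thin-x tb | thin-x tc
        ... | inj₁ p | inj₁ q | inj₁ r = no-thin l ox x∈ p q r
        ... | inj₂ (s , e) | _ | _ = two-left l s e tb tc
        ... | inj₁ _ | inj₂ (s , e) | _ = two-left (base-swap₁ l) s e ta tc
        ... | inj₁ _ | inj₁ _ | inj₂ (s , e) = two-left (base-swap₁ (base-swap₂ l)) s e ta tb

      -- If abx misses the trace ∅, a triple that meets abc in c alone must contain x. If it misses
      -- {x}, a triple through x and c must contain a or b.
      half-tag : ∀ {a b c x y} → Base a b c → Off x → Prism F a b c x → Prism F a b c y → x ≢ y →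
        Star c x ⊎ Empty c x
      half-tag {a} {b} {c} {x} l ox p q x≢y with prism-kind l p q x≢y
      ... | inj₁ mt = inj₁ λ {s} {t} m os ot → star (mt m) os ot
        where
        star : ∀ {s t} → In a c s t ⊎ In b c s t ⊎ In x c s t → Off s → Off t → s ≡ x ⊎ t ≡ x
        star (inj₁ (inj₁ e)) os ot = ⊥-elim (distinct₁₃ F (base-mem l) e)
        star (inj₁ (inj₂ (inj₁ e))) os ot = ⊥-elim (off₁ l os (sym e))
        star (inj₁ (inj₂ (inj₂ e))) os ot = ⊥-elim (off₁ l ot (sym e))
        star (inj₂ (inj₁ (inj₁ e))) os ot = ⊥-elim (distinct₂₃ F (base-mem l) e)
        star (inj₂ (inj₁ (inj₂ (inj₁ e)))) os ot = ⊥-elim (off₂ l os (sym e))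
        star (inj₂ (inj₁ (inj₂ (inj₂ e)))) os ot = ⊥-elim (off₂ l ot (sym e))
        star (inj₂ (inj₂ (inj₁ e))) os ot = ⊥-elim (off₃ l ox e)
        star (inj₂ (inj₂ (inj₂ (inj₁ e)))) os ot = inj₁ (sym e)
        star (inj₂ (inj₂ (inj₂ (inj₂ e)))) os ot = inj₂ (sym e)
      ... | inj₂ d = inj₂ λ m ot → dom-miss F d m (≢-sym (distinct₁₃ F (base-mem l)))
              (≢-sym (distinct₂₃ F (base-mem l))) (off₁ l ot) (off₂ l ot)

      prism-swap₂ : ∀ {a b c x} → Prism F a b c x → Prism F a c b x
      prism-swap₂ (prism p q r) = prism q p (swap₁ F r)

      prism-swap₁ : ∀ {a b c x} → Prism F a b c x → Prism F b a c x
      prism-swap₁ (prism p q r) = prism (swap₁ F p) r q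

    no-prisms : ∀ {x y} → x ≢ y → Prism F a₀ b₀ c₀ x → Prism F a₀ b₀ c₀ y → ⊥
    no-prisms {x} {y} x≢y p q =
      tags base
        (tag (base-swap₂ (base-swap₁ base)) (prism-swap₂ (prism-swap₁ p)) (prism-swap₂ (prism-swap₁ q)))
        (tag (base-swap₂ base) (prism-swap₂ p) (prism-swap₂ q))
        (tag base p q)
      where
      prism-off : ∀ {x} → Prism F a₀ b₀ c₀ x → Off x
      prism-off (prism p q r) = off base (≢-sym (distinct₁₃ F p)) (≢-sym (distinct₂₃ F p)) (≢-sym (distinct₂₃ F q))
      open TwoPrisms (prism-off p) (prism-off q) x≢y
        (support F (rot′ F (Prism.abu p))) (support F (rot′ F (Prism.abu q)))
      tag : ∀ {a b c} → Base a b c → Prism F a b c x → Prism F a b c y → Tag c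
      tag l p′ q′ = half-tag l (prism-off p) p′ q′ x≢y , half-tag l (prism-off q) q′ p′ (≢-sym x≢y)

    spine-of : ∀ {B} → B ⊑ F → ¬ Mem B a₀ b₀ c₀ → Core B → SomeSpine B
    spine-of {B} B⊑F ∌ core with edge-or-prisms {B} B⊑F core ∌ base
    ... | inj₁ e = edge⇒spine B⊑F core e
    ... | inj₂ (_ , _ , x≢y , p , q) = ⊥-elim (no-prisms x≢y (prism-⊑ {B} B⊑F p) (prism-⊑ {B} B⊑F q))

    -- Excluding a spine

    module _ (surplus : length (pairs vs) + 2 < size F + length vs) {a b c x y} (S : Spine F a b c x y) where
      open Spine S

      private
        ox = proj₁ (spine-off S)
        oy = proj₂ (spine-off S)

        surplus′ : length (pairs vs) + 1 < size (F ∖ (a , x , y)) + length vs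
        surplus′ = s≤s⁻¹ (≤-trans (≤-reflexive (cong suc (sym (+-suc (length (pairs vs)) 1))))
          (≤-trans surplus (+-monoˡ-≤ (length vs) (size-∖ F u axy))))

        avoiding : ∀ p q → ∃[ z ] z ∈ vs × z ≢ p × z ≢ q
        avoiding p q with a₀ ≟ p | a₀ ≟ q | b₀ ≟ p | b₀ ≟ q
        ... | no ap | no aq | _ | _ = a₀ , support F abc₀ , ap , aq
        ... | _ | _ | no bp | no bq = b₀ , support F (rot F abc₀) , bp , bq
        ... | yes refl | _ | _ | yes refl =
          c₀ , support F (rot′ F abc₀) , ≢-sym (distinct₁₃ F abc₀) , ≢-sym (distinct₂₃ F abc₀)
        ... | _ | yes refl | yes refl | _ =
          c₀ , support F (rot′ F abc₀) , ≢-sym (distinct₂₃ F abc₀) , ≢-sym (distinct₁₃ F abc₀)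
        ... | yes refl | _ | yes e | _ = ⊥-elim (distinct F abc₀ (sym e))
        ... | _ | yes refl | _ | yes e = ⊥-elim (distinct F abc₀ (sym e))

      -- An uncovered pair would make room for a second spine.
      covered : ∀ {p q} → p ∈ vs → q ∈ vs → p ≢ q → ∃[ t ] Mem F p q t
      covered {p} {q} p∈ q∈ p≢q with any? (mem? F p q) vs
      ... | yes c = let t , _ , m = find c in t , m
      ... | no ¬c with z , z∈ , z≢p , z≢q ← avoiding p q
        with B , B⊑ , core ← core u ((F ∖ (a , x , y)) ∖ (a₀ , b₀ , c₀)) (pairs vs without (p , q))
          (λ ((m , _) , _) → linked-without (pairs-covering F m) λ where
            (inj₁ (refl , refl)) → ¬c (lose (support F (rot′ F m)) m)
            (inj₂ (refl , refl)) → ¬c (lose (support F (rot′ F m)) (swap₁ F m)))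
          (connected-without z pairs-connected
            (linked-without (pairs-linked p∈ z∈ (≢-sym z≢p)) λ where
              (inj₁ (_ , e)) → z≢q e
              (inj₂ (e , _)) → p≢q e)
            (linked-without (pairs-linked z∈ q∈ z≢q) λ where
              (inj₁ (e , _)) → z≢p e
              (inj₂ (e , _)) → z≢q e))
          (shrink (length-without (pairs-linked p∈ q∈ p≢q))
            (size-∖ (F ∖ (a , x , y)) u (abc₀ , λ (_ , i , _) → ox i)) surplus′) =
        ⊥-elim (two-spines (spine-of (proj₁ ∘ proj₁ ∘ B⊑) (λ m → ∖-∌ (F ∖ (a , x , y)) (B⊑ m)) core)
          (proj₁ ∘ proj₁ ∘ B⊑) S (λ m → ∖-∌ F (proj₁ (B⊑ m))))

      private
        no-off : ∀ {r s t} → Mem F r s t → Off r → Off s → ¬ Off t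
        no-off m or os ot = [ outside , [ outside′ , outside″ ]′ ]′ (meets₀ m)
          where
          outside : ¬ In a₀ _ _ _
          outside (inj₁ refl) = or (inj₁ refl)
          outside (inj₂ (inj₁ refl)) = os (inj₁ refl)
          outside (inj₂ (inj₂ refl)) = ot (inj₁ refl)
          outside′ : ¬ In b₀ _ _ _
          outside′ (inj₁ refl) = or (inj₂ (inj₁ refl))
          outside′ (inj₂ (inj₁ refl)) = os (inj₂ (inj₁ refl))
          outside′ (inj₂ (inj₂ refl)) = ot (inj₂ (inj₁ refl))
          outside″ : ¬ In c₀ _ _ _
          outside″ (inj₁ refl) = or (inj₂ (inj₂ refl))
          outside″ (inj₂ (inj₁ refl)) = os (inj₂ (inj₂ refl))
          outside″ (inj₂ (inj₂ refl)) = ot (inj₂ (inj₂ refl))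

        -- Domination at x leaves a or y as the third vertex of a triple covering xt, and xyt would
        -- be disjoint from abc.
        along-x : ∀ {t} → t ∈ vs → Off t → t ≢ x → t ≢ y → Mem F a x t
        along-x t∈ ot t≢x t≢y with s , m ← covered (support F (rot F axy)) t∈ (≢-sym t≢x)
          with dom-third F dom-x m (off₁ letters ot) t≢y
        ... | inj₁ refl = rot′ F m
        ... | inj₂ refl = ⊥-elim (no-off m ox ot oy)

        along-y : ∀ {t} → t ∈ vs → Off t → t ≢ x → t ≢ y → Mem F b y t
        along-y t∈ ot t≢x t≢y with s , m ← covered (support F (rot′ F axy)) t∈ (≢-sym t≢y)
          with dom-third F dom-y m (off₂ letters ot) t≢x
        ... | inj₁ refl = rot′ F m
        ... | inj₂ refl = ⊥-elim (no-off m oy ot ox)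

        unique₆ : ∀ {w} → Off w → w ≢ x → w ≢ y → Unique (a ∷ b ∷ c ∷ x ∷ y ∷ w ∷ [])
        unique₆ ow w≢x w≢y with (ab ∷ ac ∷ []) ∷ (bc ∷ []) ∷ _ ← unique₃ F (base-mem letters) =
          (ab ∷ ac ∷ ≢-sym (off₁ letters ox) ∷ ≢-sym (off₁ letters oy) ∷ ≢-sym (off₁ letters ow) ∷ []) ∷
          (bc ∷ ≢-sym (off₂ letters ox) ∷ ≢-sym (off₂ letters oy) ∷ ≢-sym (off₂ letters ow) ∷ []) ∷
          (≢-sym (off₃ letters ox) ∷ ≢-sym (off₃ letters oy) ∷ ≢-sym (off₃ letters ow) ∷ []) ∷
          (distinct₂₃ F axy ∷ ≢-sym w≢x ∷ []) ∷ (≢-sym w≢y ∷ []) ∷ [] ∷ []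

        ⊆₆ : ∀ {w} → w ∈ vs → (a ∷ b ∷ c ∷ x ∷ y ∷ w ∷ []) ⊆ vs
        ⊆₆ w∈ #0 = support F axy
        ⊆₆ w∈ #1 = support F bxy
        ⊆₆ w∈ #2 = support F (rot′ F (base-mem letters))
        ⊆₆ w∈ #3 = support F (rot F axy)
        ⊆₆ w∈ #4 = support F (rot′ F axy)
        ⊆₆ w∈ #5 = w∈

      module _ {w} (p : Prism F a b c w) where
        open Prism p renaming (abu to abw; acu to acw; bcu to bcw)

        private
          ow : Off w
          ow = off letters (≢-sym (distinct₁₃ F abw)) (≢-sym (distinct₂₃ F abw)) (≢-sym (distinct₂₃ F acw))
          w≢x : w ≢ x
          w≢x refl = dom-miss F dom-x (rot′ F bcw) (≢-sym (distinct F abw)) (≢-sym (off₂ letters oy))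
            (≢-sym (distinct F acw)) (≢-sym (off₃ letters oy))
          w≢y : w ≢ y
          w≢y refl = dom-miss F dom-y (rot′ F acw) (distinct F abw) (≢-sym (off₁ letters ox))
            (≢-sym (distinct F bcw)) (≢-sym (off₃ letters ox))
          w∈ : w ∈ vs
          w∈ = support F (rot′ F abw)
          a≢b = distinct F abw
          a≢c = distinct F acw
          b≢c = distinct F bcw
          a≢w = distinct₁₃ F abw
          b≢w = distinct₂₃ F abw

          -- Every other trace on acw is realised: ∅ by bxy, {a} by axy, {w} by byw, and those of
          -- size two by bcw, abw and abc.
          dom-ca : Dom F c a w
          dom-ca with classify F good acw
          ... | meets t = ⊥-elim ([ ≢-sym a≢b , [ b≢c , b≢w ]′ ]′ (third F t (rot F bxy) (off₁ letters ox)
                            (off₃ letters ox) (≢-sym w≢x) (off₁ letters oy) (off₃ letters oy) (≢-sym w≢y)))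
          ... | dom₁ t = ⊥-elim (dom-miss F t axy (off₃ letters ox) (≢-sym w≢x) (off₃ letters oy) (≢-sym w≢y))
          ... | dom₂ t = t
          ... | dom₃ t = ⊥-elim (dom-miss F t (rot′ F (along-y w∈ ow w≢x w≢y)) (≢-sym a≢b) b≢c
                           (off₁ letters oy) (off₃ letters oy))
          ... | own₁ t = ⊥-elim (a≢b (sym (t (rot F bcw))))
          ... | own₂ t = ⊥-elim (b≢c (t (swap₂ F abw)))
          ... | own₃ t = ⊥-elim (b≢w (t (swap₂ F (base-mem letters))))

          dom-cb : Dom F c b w
          dom-cb with classify F good bcw
          ... | meets t = ⊥-elim ([ a≢b , [ a≢c , a≢w ]′ ]′ (third F t (rot F axy) (off₂ letters ox)
                            (off₃ letters ox) (≢-sym w≢x) (off₂ letters oy) (off₃ letters oy) (≢-sym w≢y)))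
          ... | dom₁ t = ⊥-elim (dom-miss F t bxy (off₃ letters ox) (≢-sym w≢x) (off₃ letters oy) (≢-sym w≢y))
          ... | dom₂ t = t
          ... | dom₃ t = ⊥-elim (dom-miss F t (rot′ F (along-x w∈ ow w≢x w≢y)) a≢b a≢c
                           (off₂ letters ox) (off₃ letters ox))
          ... | own₁ t = ⊥-elim (a≢b (t (rot F acw)))
          ... | own₂ t = ⊥-elim (a≢c (t (rot F abw)))
          ... | own₃ t = ⊥-elim (a≢w (t (rot F (base-mem letters))))

        module _ {v} (v∈ : v ∈ vs) (ov : Off v) (v≢x : v ≢ x) (v≢y : v ≢ y) (v≢w : v ≢ w) where
          private
            -- Since `along-x` provides axv and axt and `along-y` provides byv and byt, the triples
            -- avt and bvt together would make avt shattered.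
            no-both : ∀ {t} → Mem F v a t → ¬ Mem F v b t
            no-both {t} m n = Named.shatter F un good (0F , 5F , 6F)
              ((0F , 3F , 5F) ∷ (0F , 3F , 6F) ∷ (1F , 5F , 6F) ∷ (1F , 3F , 4F) ∷ (0F , 1F , 2F) ∷ (1F , 4F , 5F) ∷ (1F , 4F , 6F) ∷ [])
              (swap₁ F m ∷ along-x v∈ ov v≢x v≢y ∷ along-x t∈ ot t≢x t≢y ∷ swap₁ F n ∷ bxy ∷ base-mem letters ∷
               along-y v∈ ov v≢x v≢y ∷ along-y t∈ ot t≢x t≢y ∷ [])
              where
              t∈ : t ∈ vs
              t∈ = support F (rot′ F m)
              t≢c : t ≢ c
              t≢c refl = dom-miss F dom-cb (rot′ F m) (off₂ letters ov) v≢w a≢b a≢w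
              t≢x : t ≢ x
              t≢x refl = dom-miss F dom-x (rev F n) (≢-sym a≢b) (≢-sym (off₂ letters oy)) (off₁ letters ov) v≢y
              t≢y : t ≢ y
              t≢y refl = dom-miss F dom-y (rev F m) a≢b (≢-sym (off₁ letters ox)) (off₂ letters ov) v≢x
              ot : Off t
              ot = off letters (≢-sym (distinct₂₃ F m)) (≢-sym (distinct₂₃ F n)) t≢c
              un : Unique (a ∷ b ∷ c ∷ x ∷ y ∷ v ∷ t ∷ [])
              un with (ab ∷ ac ∷ ax ∷ ay ∷ av ∷ []) ∷ (bc ∷ bx ∷ by ∷ bv ∷ []) ∷ (cx ∷ cy ∷ cv ∷ []) ∷
                      (xy ∷ xv ∷ []) ∷ (yv ∷ []) ∷ _ ← unique₆ ov v≢x v≢y =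
                (ab ∷ ac ∷ ax ∷ ay ∷ av ∷ ≢-sym (off₁ letters ot) ∷ []) ∷
                (bc ∷ bx ∷ by ∷ bv ∷ ≢-sym (off₂ letters ot) ∷ []) ∷
                (cx ∷ cy ∷ cv ∷ ≢-sym (off₃ letters ot) ∷ []) ∷
                (xy ∷ xv ∷ ≢-sym t≢x ∷ []) ∷ (yv ∷ ≢-sym t≢y ∷ []) ∷ (distinct₁₃ F m ∷ []) ∷ [] ∷ []

            pick : A → A × A
            pick t with mem? F v a t
            ... | yes _ = a , t
            ... | no _ = b , t

            pick-a : ∀ {t} → Mem F v a t → pick t ≡ (a , t)
            pick-a {t} m with mem? F v a t
            ... | yes _ = refl
            ... | no n = ⊥-elim (n m)

            pick-b : ∀ {t} → Mem F v b t → pick t ≡ (b , t)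
            pick-b {t} m with mem? F v a t
            ... | yes n = ⊥-elim (no-both n m)
            ... | no _ = refl

          -- By `no-both` every vertex t off abc lies with only one of a and b in the link of v, and
          -- domination at c leaves cw as the only pair through c. With ab this makes `d - 1` pairs.
          few-at : ∀ {ws} → vs ↭ a ∷ b ∷ c ∷ x ∷ y ∷ w ∷ v ∷ ws → ⊥
          few-at {ws} q = contradiction (degree v∈ es (by-letters letters (off₁ letters ov) (off₂ letters ov) (off₃ letters ov) A′ B′ C′))
            (<⇒≱ (≤-reflexive (sym (≡.trans (d≡ q) (cong (6 +_) (sym (length-map pick ws)))))))
            where
            es : List (A × A)
            es = (a , b) ∷ (c , w) ∷ map pick (x ∷ y ∷ w ∷ ws)
            picked : ∀ {l t} → pick t ≡ (l , t) → t ∈ x ∷ y ∷ w ∷ ws → Linked es l t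
            picked eq t∈ = at (there (there (subst (_∈ map pick (x ∷ y ∷ w ∷ ws)) eq (∈-map⁺ pick t∈))))
            A′ : ∀ {t} → Mem F v a t → Linked es a t
            A′ m with ∈-resp-↭ q (support F (rot′ F m))
            ... | #0 = ⊥-elim (distinct₂₃ F m refl)
            ... | #1 = at #0
            ... | #2 = ⊥-elim (dom-miss F dom-cb (rot′ F m) (off₂ letters ov) v≢w a≢b a≢w)
            ... | #3 = picked (pick-a m) #0
            ... | #4 = picked (pick-a m) #1
            ... | #5 = picked (pick-a m) #2
            ... | #6 = ⊥-elim (distinct₁₃ F m refl)
            ... | there (beyond₆ t∈) = picked (pick-a m) (there (there (there t∈)))
            B′ : ∀ {t} → Mem F v b t → Linked es b t
            B′ m with ∈-resp-↭ q (support F (rot′ F m))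
            ... | #0 = at′ #0
            ... | #1 = ⊥-elim (distinct₂₃ F m refl)
            ... | #2 = ⊥-elim (dom-miss F dom-ca (rot′ F m) (off₁ letters ov) v≢w (≢-sym a≢b) b≢w)
            ... | #3 = picked (pick-b m) #0
            ... | #4 = picked (pick-b m) #1
            ... | #5 = picked (pick-b m) #2
            ... | #6 = ⊥-elim (distinct₁₃ F m refl)
            ... | there (beyond₆ t∈) = picked (pick-b m) (there (there (there t∈)))
            C′ : ∀ {t} → Mem F v c t → Linked es c t
            C′ m with dom-third F dom-ca (swap₁ F m) (off₁ letters ov) v≢w
                    | dom-third F dom-cb (swap₁ F m) (off₂ letters ov) v≢w
            ... | inj₂ refl | _ = at #1
            ... | inj₁ _ | inj₂ refl = at #1
            ... | inj₁ refl | inj₁ e = ⊥-elim (a≢b e)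

        no-prism : ⊥
        no-prism with ws , q ← extractAll (unique₆ ow w≢x w≢y) (⊆₆ w∈)
          with _ , v , _ , _ , refl ← three-more q =
          few-at (∈-resp-↭ (↭-sym q) #6)
            (off letters (≠ 6F 0F) (≠ 6F 1F) (≠ 6F 2F)) (≠ 6F 3F) (≠ 6F 4F) (≠ 6F 5F) q
          where open Named F (Unique-resp-↭ q u) renaming (distinct-names to ≠)

      no-spine : ⊥
      no-spine with B , B⊑ , core ← core u (F ∖ (a , x , y)) (pairs vs) (pairs-covering F ∘ proj₁) pairs-connected surplus′
        -- Deleting axy leaves one unit of surplus, just enough for a core but not for deleting abc
        -- as well. The core may contain abc, so only a single prism is to be had.
        with edge-or-prism {B} (proj₁ ∘ B⊑) core letters
      ... | inj₁ e = two-spines (edge⇒spine (proj₁ ∘ B⊑) core e) (proj₁ ∘ B⊑) S (λ m → ∖-∌ F (B⊑ m))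
      ... | inj₂ (_ , p) = no-prism (prism-⊑ {B} (proj₁ ∘ B⊑) p)

    not-large : ¬ (length (pairs vs) + 2 < size F + length vs)
    not-large surplus with B , B⊑F , ∌ , core ← core₀ surplus
      with _ , _ , _ , _ , _ , s ← spine-of B⊑F ∌ core = no-spine surplus (spine-⊑ B⊑F s)

-- The bound for abstract triple systems

pairCount : ℕ → ℕ
pairCount zero = 0
pairCount (suc n) = n + pairCount n

tripleCount : ℕ → ℕ
tripleCount zero = 0
tripleCount (suc n) = pairCount n + tripleCount n

pairCount-C : ∀ n → pairCount n ≡ n C 2
pairCount-C zero = refl
pairCount-C (suc n) = ≡.trans (cong₂ _+_ (sym (nC1≡n n)) (pairCount-C n)) (nCk+nC[k+1]≡[n+1]C[k+1] n 1)

module _ {A : Set} where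

  #₂≤pairCount : {P : A → A → Set} (P? : Decidable P) → ∀ xs → #₂ P? xs ≤ pairCount (length xs)
  #₂≤pairCount P? [] = z≤n
  #₂≤pairCount P? (x ∷ xs) = +-mono-≤ (#₁≤length (P? x) xs) (#₂≤pairCount P? xs)

  #₃≤tripleCount : {F : A → A → A → Set} (F? : Decidable₃ F) → ∀ xs → #₃ F? xs ≤ tripleCount (length xs)
  #₃≤tripleCount F? [] = z≤n
  #₃≤tripleCount F? (x ∷ xs) = +-mono-≤ (#₂≤pairCount (F? x) xs) (#₃≤tripleCount F? xs)

  length-pairs : (xs : List A) → length (pairs xs) ≡ pairCount (length xs)
  length-pairs [] = refl
  length-pairs (x ∷ xs) = ≡.trans (length-++ (map (x ,_) xs)) (cong₂ _+_ (length-map (x ,_) xs) (length-pairs xs))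

module Bound {A : Set} (_≟_ : DecidableEquality A) where

  open Systems _≟_
  open TripleSystem

  delete : ∀ {vs w ws} → vs ↭ w ∷ ws → TripleSystem vs → TripleSystem ws
  delete {vs} {w} {ws} p F = record
    { Mem = λ r s t → Mem F r s t × ¬ In w r s t
    ; mem? = λ r s t → mem? F r s t ×-dec ¬? (in? _≟_ w r s t)
    ; swap₁ = λ (m , n) → swap₁ F m , λ i → n (in-swap₁ i)
    ; swap₂ = λ (m , n) → swap₂ F m , λ i → n (in-swap₂ i)
    ; distinct = λ (m , _) → distinct F m
    ; support = λ (m , n) → remaining (∈-resp-↭ p (support F m)) (λ eq → n (inj₁ (sym eq)))
    }
    where
    remaining : ∀ {r} → r ∈ w ∷ ws → r ≢ w → r ∈ ws
    remaining (here eq) r≢w = ⊥-elim (r≢w eq)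
    remaining (there r∈) _ = r∈

  good-delete : ∀ {vs w ws} (p : vs ↭ w ∷ ws) (F : TripleSystem vs) → Good F → Good (delete p F)
  good-delete p F good (m , _) with b , miss ← good m = b , λ (n , _) → miss n

  size-delete : ∀ {vs w ws} → Unique vs → (p : vs ↭ w ∷ ws) (F : TripleSystem vs) →
    size F ≤ #₂ (mem? F w) ws + size (delete p F)
  size-delete {ws = ws} u p F with w∉ ∷ _ ← Unique-resp-↭ p u = ≤-trans (≤-reflexive (size-↭ F p))
    (+-monoʳ-≤ _ (#₃-mono (mem? F) (mem? (delete p F)) ws (λ r∈ s∈ t∈ m → m , λ where
      (inj₁ eq) → All.lookup w∉ r∈ eq
      (inj₂ (inj₁ eq)) → All.lookup w∉ s∈ eq
      (inj₂ (inj₂ eq)) → All.lookup w∉ t∈ eq)))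

  -- Bounded m is about 5 + m vertices; 5 and 6 are exceptional.
  Bounded : ℕ → ℕ → Set
  -- All triples on five vertices; no two of them are disjoint, so even the full family misses the
  -- trace ∅ on each of its members.
  Bounded 0 s = s ≤ 10
  -- One less than 10 + 4: a larger family has all degrees at least 4, as the case without a meeting
  -- member requires. On seven vertices 17 - 13 = 4 serves again.
  Bounded 1 s = s ≤ 13
  -- Because C(n, 2) - n + 1 = C(n-1, 2), this is the bound of the theorem, written without
  -- subtraction.
  Bounded m@(suc (suc _)) s = s + (5 + m) ≤ pairCount (5 + m) + 2

  AllBounded : ℕ → Set₁
  AllBounded m = ∀ {vs} → Unique vs → length vs ≡ 5 + m → (F : TripleSystem vs) → Good F → Bounded m (size F)

  private
    no-surplus : ∀ {vs} → Unique vs → (F : TripleSystem vs) → Good F → MinDegree F 4 →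
      (∀ {a b c} → Mem F a b c → ¬ Meets F a b c) → ¬ (length (pairs vs) + 2 < size F + length vs)
    no-surplus u F good deg = NoMeets.surplus≤1 _≟_ u F good deg

    surplus : ∀ {vs n s} (F : TripleSystem vs) → length vs ≡ n → s ≤ size F → pairCount n + 2 < s + n →
      length (pairs vs) + 2 < size F + length vs
    surplus {vs} F refl le lt =
      ≤-trans (s≤s (≤-reflexive (cong (_+ 2) (length-pairs vs)))) (≤-trans lt (+-monoˡ-≤ (length vs) le))

    -- The triples in excess of what fits on the other vertices must pass through the deleted one.
    min-degree : ∀ m → AllBounded m → ∀ {vs} → Unique vs → length vs ≡ 6 + m → (F : TripleSystem vs) → Good F →
      ∀ {d} → (∀ {s} → Bounded m s → d + s ≤ size F) → MinDegree F d
    min-degree m ih u len F good f p with _ ∷ u′ ← Unique-resp-↭ p u =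
      +-cancelʳ-≤ (size (delete p F)) _ _ (≤-trans
        (f (ih u′ (suc-injective (≡.trans (sym (↭-length p)) len)) (delete p F) (good-delete p F good)))
        (size-delete u p F))

  bounded-suc : ∀ m → AllBounded m → AllBounded (suc m)
  bounded-suc 0 ih u len F good with size F ≤? 13
  ... | yes le = le
  ... | no ≰ = ⊥-elim (no-surplus u F good
    (min-degree 0 ih u len F good (λ b → ≤-trans (+-monoʳ-≤ 4 b) (≰⇒> ≰)))
    (λ m mt → WithMeeting.not-small _≟_ u F good m mt extra (inj₁ (len , ≰⇒> ≰))) extra)
    where
    extra = surplus F len (≰⇒> ≰) (≤ᵇ⇒≤ 18 20 tt)
  bounded-suc 1 ih u len F good with size F + 7 ≤? 23
  ... | yes le = le
  ... | no ≰ = ⊥-elim (no-surplus u F good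
    (min-degree 1 ih u len F good (λ b → ≤-trans (+-monoʳ-≤ 4 b) 17≤))
    (λ m mt → WithMeeting.not-small _≟_ u F good m mt extra (inj₂ (len , 17≤))) extra)
    where
    17≤ : 17 ≤ size F
    17≤ = +-cancelʳ-≤ 7 17 (size F) (≰⇒> ≰)
    extra = surplus F len 17≤ (≤ᵇ⇒≤ 24 24 tt)
  bounded-suc (suc (suc k)) ih {vs} u len F good with size F + (8 + k) ≤? pairCount (8 + k) + 2
  ... | yes le = le
  ... | no ≰ = ⊥-elim (no-surplus u F good (λ p → ≤-trans (s≤s (s≤s (s≤s (s≤s z≤n)))) (deg p))
    (λ m mt → WithMeeting.Large.not-large _≟_ u F good m mt {7 + k} (m≤m+n 7 k) len deg extra) extra)
    where
    extra : length (pairs vs) + 2 < size F + length vs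
    extra = surplus F len ≤-refl (≰⇒> ≰)
    deg : MinDegree F (7 + k)
    -- With n = 8 + k, the degree is at least C(n-1, 2) + 2 minus C(n-2, 2) + 1, which is n - 1.
    deg = min-degree (2 + k) ih u len F good λ {s} b → +-cancelʳ-≤ (8 + k) _ _ (begin
      7 + k + s + (8 + k)                        ≡⟨ rearrange₁ k s ⟩
      suc (7 + k + (s + (7 + k)))                ≤⟨ s≤s (+-monoʳ-≤ (7 + k) b) ⟩
      suc (7 + k + (pairCount (7 + k) + 2))      ≡⟨ cong suc (+-assoc (7 + k) (pairCount (7 + k)) 2) ⟨
      suc (pairCount (8 + k) + 2)                ≤⟨ ≰⇒> ≰ ⟩
      size F + (8 + k)                           ∎)
      where
      open ≤-Reasoning
      rearrange₁ : ∀ k s → 7 + k + s + (8 + k) ≡ suc (7 + k + (s + (7 + k)))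
      rearrange₁ = solve 2 (λ k s → con 7 :+ k :+ s :+ (con 8 :+ k) := con 1 :+ (con 7 :+ k :+ (s :+ (con 7 :+ k)))) refl
        where open +-*-Solver

  bounded : ∀ m → AllBounded m
  bounded zero {vs} u len F good = ≤-trans (#₃≤tripleCount (mem? F) vs) (≤-reflexive (cong tripleCount len))
  bounded (suc m) = bounded-suc m (bounded m)

-- Set systems as triple systems

module FromSets {n : ℕ} (𝓕 : SetSystem n) where

  open Systems (Fin._≟_ {n})
  open TripleSystem

  set : Fin n → Fin n → Fin n → Subset n
  set x y z = ⁅ x ⁆ ∪ (⁅ y ⁆ ∪ ⁅ z ⁆)

  ∈-set⁺ : ∀ {w x y z} → In w x y z → w Sub.∈ set x y z
  ∈-set⁺ {w} (inj₁ refl) = x∈p∪q⁺ (inj₁ (x∈⁅x⁆ w))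
  ∈-set⁺ {w} (inj₂ (inj₁ refl)) = x∈p∪q⁺ (inj₂ (x∈p∪q⁺ (inj₁ (x∈⁅x⁆ w))))
  ∈-set⁺ {w} (inj₂ (inj₂ refl)) = x∈p∪q⁺ (inj₂ (x∈p∪q⁺ (inj₂ (x∈⁅x⁆ w))))

  ∈-set⁻ : ∀ {w x y z} → w Sub.∈ set x y z → In w x y z
  ∈-set⁻ {x = x} {y} {z} w∈ with x∈p∪q⁻ ⁅ x ⁆ (⁅ y ⁆ ∪ ⁅ z ⁆) w∈
  ... | inj₁ p = inj₁ (x∈⁅y⁆⇒x≡y x p)
  ... | inj₂ q with x∈p∪q⁻ ⁅ y ⁆ ⁅ z ⁆ q
  ...   | inj₁ p = inj₂ (inj₁ (x∈⁅y⁆⇒x≡y y p))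
  ...   | inj₂ p = inj₂ (inj₂ (x∈⁅y⁆⇒x≡y z p))

  set-≡ : ∀ {x y z S} → (∀ {w} → In w x y z → w Sub.∈ S) → (∀ {w} → w Sub.∈ S → In w x y z) → set x y z ≡ S
  set-≡ f g = ⊆-antisym (f ∘ ∈-set⁻) (∈-set⁺ ∘ g)

  set-swap₁ : ∀ x y z → set x y z ≡ set y x z
  set-swap₁ x y z = set-≡ (∈-set⁺ ∘ in-swap₁) (in-swap₁ ∘ ∈-set⁻)

  set-swap₂ : ∀ x y z → set x y z ≡ set x z y
  set-swap₂ x y z = set-≡ (∈-set⁺ ∘ in-swap₂) (in-swap₂ ∘ ∈-set⁻)

  _≟ˢ_ : DecidableEquality (Subset n)
  _≟ˢ_ = Vec.≡-dec Bool._≟_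

  record Member (x y z : Fin n) : Set where
    constructor member
    field
      x≢y : x ≢ y
      x≢z : x ≢ z
      y≢z : y ≢ z
      set∈ : set x y z ∈ 𝓕

  system : TripleSystem (allFin n)
  system = record
    { Mem = Member
    ; mem? = λ x y z → map′ (λ (p , q , r , s) → member p q r s) (λ (member p q r s) → p , q , r , s)
        (¬? (x Fin.≟ y) ×-dec ¬? (x Fin.≟ z) ×-dec ¬? (y Fin.≟ z) ×-dec any? (set x y z ≟ˢ_) 𝓕)
    ; swap₁ = λ {x} {y} {z} (member p q r s) → member (≢-sym p) r q (subst (_∈ 𝓕) (set-swap₁ x y z) s)
    ; swap₂ = λ {x} {y} {z} (member p q r s) → member q p (≢-sym r) (subst (_∈ 𝓕) (set-swap₂ x y z) s)
    ; distinct = Member.x≢y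
    ; support = λ {x} _ → ∈-allFin x
    }

  private
    pattern-of : Fin n × Fin n × Fin n → Subset n → Bool × Bool × Bool
    pattern-of (x , y , z) S = Vec.lookup S x , Vec.lookup S y , Vec.lookup S z

    lookup-set : ∀ w {x y z} → Vec.lookup (set x y z) w ≡ does (in? Fin._≟_ w x y z)
    lookup-set w {x} {y} {z} = go (in? Fin._≟_ w x y z)
      where
      go : (d : Dec (In w x y z)) → Vec.lookup (set x y z) w ≡ does d
      go (yes i) = []=⇒lookup (∈-set⁺ i)
      go (no ¬i) = Bool.¬-not (λ eq → ¬i (∈-set⁻ (lookup⇒[]= w (set x y z) eq)))

    realized? : ∀ G b → Dec (Any (λ F → pattern-of G F ≡ b) 𝓕)
    realized? G b = any? (λ F → ≡-dec Bool._≟_ (≡-dec Bool._≟_ Bool._≟_) (pattern-of G F) b) 𝓕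

  module _ (uniform : Uniform 3 𝓕) (vc : VCDim≤ 𝓕 2) where

    -- If all eight patterns occurred on xyz, a member with the same pattern as a given subset of
    -- xyz would have that subset as its trace, and xyz would be shattered.
    good : Good system
    good {x} {y} {z} (member _ _ _ S∈) with All.all? (realized? (x , y , z)) patterns
    ... | yes all = ⊥-elim (vc (set x y z) (All.lookup uniform S∈) shatters′)
      where
      shatters′ : Shatters 𝓕 (set x y z)
      shatters′ S S⊆ with F , F∈ , eq ← find (All.lookup all (∈-patterns (pattern-of (x , y , z) S))) =
        F , F∈ , ⊆-antisym
          (λ w∈ → let w∈F , w∈xyz = x∈p∩q⁻ F (set x y z) w∈ in
            transfer F S eq (∈-set⁻ w∈xyz) w∈F)
          (λ w∈ → x∈p∩q⁺ (transfer S F (sym eq) (∈-set⁻ (S⊆ w∈)) w∈ , S⊆ w∈))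
        where
        transfer : ∀ P Q → pattern-of (x , y , z) P ≡ pattern-of (x , y , z) Q →
          ∀ {w} → In w x y z → w Sub.∈ P → w Sub.∈ Q
        transfer P Q eq {w} i w∈ = lookup⇒[]= w Q (≡.trans (sym (same-at i)) ([]=⇒lookup w∈))
          where
          same-at : In w x y z → Vec.lookup P w ≡ Vec.lookup Q w
          same-at (inj₁ refl) = cong proj₁ eq
          same-at (inj₂ (inj₁ refl)) = cong (proj₁ ∘ proj₂) eq
          same-at (inj₂ (inj₂ refl)) = cong (proj₂ ∘ proj₂) eq
    ... | no ¬all with b , _ , ¬b ← find (¬All⇒Any¬ (realized? (x , y , z)) patterns ¬all) =
      b , λ m eq → ¬b (lose (Member.set∈ m)
        (≡.trans (cong₂ _,_ (lookup-set x) (cong₂ _,_ (lookup-set y) (lookup-set z))) eq))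

  elements : ∀ {m} → Subset m → List (Fin m)
  elements [] = []
  elements (true ∷ S) = zero ∷ map suc (elements S)
  elements (false ∷ S) = map suc (elements S)

  length-elements : ∀ {m} (S : Subset m) → length (elements S) ≡ ∣ S ∣
  length-elements [] = refl
  length-elements (true ∷ S) = cong suc (≡.trans (length-map suc (elements S)) (length-elements S))
  length-elements (false ∷ S) = ≡.trans (length-map suc (elements S)) (length-elements S)

  ∈-elements⁺ : ∀ {m} {S : Subset m} {w} → w Sub.∈ S → w ∈ elements S
  ∈-elements⁺ {S = true ∷ S} here = here refl
  ∈-elements⁺ {S = true ∷ S} (there w∈) = there (∈-map⁺ suc (∈-elements⁺ w∈))
  ∈-elements⁺ {S = false ∷ S} (there w∈) = ∈-map⁺ suc (∈-elements⁺ w∈)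

  ∈-elements⁻ : ∀ {m} {S : Subset m} {w} → w ∈ elements S → w Sub.∈ S
  ∈-elements⁻ {S = true ∷ S} (here refl) = here
  ∈-elements⁻ {S = true ∷ S} (there w∈) with _ , v∈ , refl ← ∈-map⁻ suc w∈ = there (∈-elements⁻ v∈)
  ∈-elements⁻ {S = false ∷ S} w∈ with _ , v∈ , refl ← ∈-map⁻ suc w∈ = there (∈-elements⁻ v∈)

  elements-unique : ∀ {m} (S : Subset m) → Unique (elements S)
  elements-unique [] = []
  elements-unique (true ∷ S) =
    All.tabulate (λ w∈ eq → case ≡.trans eq (proj₂ (proj₂ (∈-map⁻ suc w∈))) of λ ()) ∷
    Unique-map⁺ Fin.suc-injective (elements-unique S)
  elements-unique (false ∷ S) = Unique-map⁺ Fin.suc-injective (elements-unique S)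

-- Comparing the length of the family with the size of the triple system

module _ {A : Set} where

  pairs-any : {P : A → A → Set} → (∀ {x y} → P x y → P y x) → ∀ {xs x y} → x ∈ xs → y ∈ xs → x ≢ y →
    P x y → Any (uncurry P) (pairs xs)
  pairs-any s (here refl) (here refl) x≢y p = ⊥-elim (x≢y refl)
  pairs-any s {z ∷ zs} (here refl) (there y∈) x≢y p = lose (∈-++⁺ˡ (∈-map⁺ (z ,_) y∈)) p
  pairs-any s {z ∷ zs} (there x∈) (here refl) x≢y p = lose (∈-++⁺ˡ (∈-map⁺ (z ,_) x∈)) (s p)
  pairs-any s {z ∷ zs} (there x∈) (there y∈) x≢y p = ++⁺ʳ (map (z ,_) zs) (pairs-any s x∈ y∈ x≢y p)

  triples-any : {P : A → A → A → Set} → (∀ {x y z} → P x y z → P y x z) → (∀ {x y z} → P x y z → P x z y) →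
    ∀ {xs x y z} → x ∈ xs → y ∈ xs → z ∈ xs → x ≢ y → x ≢ z → y ≢ z →
    P x y z → Any (λ (x , y , z) → P x y z) (triples xs)
  triples-any s t (here refl) (here refl) z∈ x≢y x≢z y≢z p = ⊥-elim (x≢y refl)
  triples-any s t (here refl) (there _) (here refl) x≢y x≢z y≢z p = ⊥-elim (x≢z refl)
  triples-any s t (there _) (here refl) (here refl) x≢y x≢z y≢z p = ⊥-elim (y≢z refl)
  triples-any s t (here refl) (there y∈) (there z∈) x≢y x≢z y≢z p =
    ++⁺ˡ (map⁺ (pairs-any t y∈ z∈ y≢z p))
  triples-any s t (there x∈) (here refl) (there z∈) x≢y x≢z y≢z p =
    ++⁺ˡ (map⁺ (pairs-any t x∈ z∈ x≢z (s p)))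
  triples-any s t (there x∈) (there y∈) (here refl) x≢y x≢z y≢z p =
    ++⁺ˡ (map⁺ (pairs-any t x∈ y∈ x≢y (s (t p))))
  triples-any s t {w ∷ ws} (there x∈) (there y∈) (there z∈) x≢y x≢z y≢z p =
    ++⁺ʳ (map (w ,_) (pairs ws)) (triples-any s t x∈ y∈ z∈ x≢y x≢z y≢z p)

module _ {A B : Set} (_≟_ : DecidableEquality B) {P : A → Set} (P? : Decidable₁ P) (f : A → B) where

  -- Each counted element of `xs` accounts for a single value of `f`, so removing that value from
  -- `ys` shortens it by at most one.
  length-≤-# : ∀ {ys} xs → Unique ys → (∀ {y} → y ∈ ys → Any (λ x → P x × f x ≡ y) xs) → length ys ≤ #₁ P? xs
  length-≤-# {[]} xs u g = z≤n
  length-≤-# {y ∷ ys} [] u g = case g (here refl) of λ ()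
  length-≤-# {ys@(_ ∷ _)} (x ∷ xs) u g = go (P? x)
    where
    go : (p : Dec (P x)) → length ys ≤ ⟦ p ⟧ + #₁ P? xs
    go (no ¬p) = length-≤-# xs u λ y∈ → case g y∈ of λ where
      (here (p , _)) → ⊥-elim (¬p p)
      (there a) → a
    go (yes _) = ≤-trans (Systems.filter-≢ _≟_ (f x) u)
      (s≤s (length-≤-# xs (filter⁺ (λ y → ¬? (y ≟ f x)) u) λ y∈ →
        let y∈ys , y≢ = ∈-filter⁻ (λ y → ¬? (y ≟ f x)) y∈ in case g y∈ys of λ where
          (here (_ , eq)) → ⊥-elim (y≢ (sym eq))
          (there a) → a))

module _ {n : ℕ} (𝓕 : SetSystem n) (unique : Unique 𝓕) (uniform : Uniform 3 𝓕) where

  open FromSets 𝓕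
  open Systems (Fin._≟_ {n})
  open TripleSystem

  length≤size : length 𝓕 ≤ size system
  length≤size = ≤-trans
    (length-≤-# _≟ˢ_ (λ (x , y , z) → mem? system x y z) (λ (x , y , z) → set x y z) (triples (allFin n)) unique
      (λ {S} F∈ → find-triple F∈ (≡.trans (length-elements S) (All.lookup uniform F∈)) refl))
    (≤-reflexive (sym (#₃-triples (mem? system) (allFin n))))
    where
    find-triple : ∀ {F es} → F ∈ 𝓕 → length es ≡ 3 → elements F ≡ es →
      Any (λ (x , y , z) → Member x y z × set x y z ≡ F) (triples (allFin n))
    find-triple {F} {x ∷ y ∷ z ∷ []} F∈ _ eq
      with (x≢y ∷ x≢z ∷ []) ∷ (y≢z ∷ []) ∷ _ ← subst Unique eq (elements-unique F) =
      triples-any {P = λ x y z → Member x y z × set x y z ≡ F}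
        (λ {x} {y} {z} (m , e) → swap₁ system m , ≡.trans (sym (set-swap₁ x y z)) e)
        (λ {x} {y} {z} (m , e) → swap₂ system m , ≡.trans (sym (set-swap₂ x y z)) e)
        (∈-allFin x) (∈-allFin y) (∈-allFin z) x≢y x≢z y≢z
        (member x≢y x≢z y≢z (subst (_∈ 𝓕) (sym F≡) F∈) , F≡)
      where
      F≡ : set x y z ≡ F
      F≡ = set-≡
        (λ i → ∈-elements⁻ (subst (_ ∈_) (sym eq) (listed i)))
        (λ w∈ → unlisted (subst (_ ∈_) eq (∈-elements⁺ w∈)))
        where
        listed : ∀ {w} → In w x y z → w ∈ x ∷ y ∷ z ∷ []
        listed (inj₁ refl) = here refl
        listed (inj₂ (inj₁ refl)) = there (here refl)
        listed (inj₂ (inj₂ refl)) = there (there (here refl))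
        unlisted : ∀ {w} → w ∈ x ∷ y ∷ z ∷ [] → In w x y z
        unlisted (here refl) = inj₁ refl
        unlisted (there (here refl)) = inj₂ (inj₁ refl)
        unlisted (there (there (here refl))) = inj₂ (inj₂ refl)

theorem1p2 : (n : ℕ) → n ≥ 7 → (𝓕 : SetSystem n) → Unique 𝓕 →
    Uniform 3 𝓕 → VCDim≤ 𝓕 2 → length 𝓕 ≤ ((n ∸ 1) C 2) + 1
-- Matching on the inequality brings n into the form 7 + k, for which `Bounded (2 + k)` unfolds to
-- its general clause.
theorem1p2 _ (s≤s (s≤s (s≤s (s≤s (s≤s (s≤s (s≤s (z≤n {k})))))))) 𝓕 unique uniform vc =
  ≤-trans (length≤size 𝓕 unique uniform) (+-cancelʳ-≤ (7 + k) _ _ (begin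
    size system + (7 + k)                   ≤⟨ bounded (2 + k) (allFin⁺ (7 + k)) (length-tabulate id) system (good uniform vc) ⟩
    6 + k + pairCount (6 + k) + 2           ≡⟨ rearrange k (pairCount (6 + k)) ⟩
    pairCount (6 + k) + 1 + (7 + k)         ≡⟨ cong (λ m → m + 1 + (7 + k)) (pairCount-C (6 + k)) ⟩
    (6 + k) C 2 + 1 + (7 + k)               ∎))
  where
  open FromSets 𝓕
  open Systems (Fin._≟_ {7 + k}) using (module TripleSystem)
  open TripleSystem using (size)
  open Bound (Fin._≟_ {7 + k})
  open ≤-Reasoning
  rearrange : ∀ k p → 6 + k + p + 2 ≡ p + 1 + (7 + k)
  rearrange = solve 2 (λ k p → con 6 :+ k :+ p :+ con 2 := p :+ con 1 :+ (con 7 :+ k)) refl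
    where open +-*-Solver
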